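{- Let $(\mathbf r,\mathbf h)$ be a pattern, with $\mathbf r=(r_1,\dots,r_t)$ and $\mathbf h=(h_1,\dots,h_t)$, and let $H=\sum_{j=1}^t h_j$ and $B=\sum_{j=1}^t h_j|r_j|$. Let $n\ge 2$ be an integer satisfying $n>B$ and $\gcd(n,r_1\cdots r_t)=1$. Then $$T^{(n)}_{\mathbf r,\mathbf h}(\alpha_{1,n},\dots,\alpha_{n-1,n})=n\,\mathsf S_0(\mathbf r,\mathbf h)-2^{H}.$$ In particular, for every fixed pattern, the cyclotomic cosine evaluation is an affine function of $n$ on the set of all such $n$.
   Context: A pattern $(\mathbf r,\mathbf h)$ consists of an integer $t\ge 1$, a tuple $\mathbf r=(r_1,\dots,r_t)$ of nonzero integers with $r_1=1$, and a tuple $\mathbf h=(h_1,\dots,h_t)$ of nonnegative integers. For $n\ge 2$ put $\Omega_n=\{1,\dots,n-1\}$ and $\alpha_{k,n}=\cos(2\pi k/n)$ for $k\in\Omega_n$. For an integer $r$ with $\gcd(r,n)=1$, let $\sigma_r:\Omega_n\to\Omega_n$ be the permutation determined by $\sigma_r(k)\equiv rk\pmod n$. If $\gcd(n,r_1\cdots r_t)=1$, the pattern sum is $$T^{(n)}_{\mathbf r,\mathbf h}(x_1,\dots,x_{n-1})=\sum_{k\in\Omega_n}\prod_{j=1}^t\bigl(2x_{\sigma_{r_j}(k)}\bigr)^{h_j}\in\mathbb{Q}[x_1,\dots,x_{n-1}].$$ $\mathsf S_M(\mathbf r,\mathbf h)$ denotes the coefficient of $u^M$ in the Laurent polynomial $\prod_{j=1}^t(u^{r_j}+u^{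 -r_j})^{h_j}$; in particular $\mathsf S_0(\mathbf r,\mathbf h)$ is its constant coefficient. -}

module Defs where

open import Algebra.Bundles using (RawRing)
import Algebra.Definitions.RawSemiring as RawSemiringDefs
open import Data.Empty using (⊥-elim)
open import Data.Fin.Base as Fin using (Fin; toℕ)
import Data.Fin.Properties as Fin
open import Data.Integer.Base as ℤ using (ℤ; +_; -[1+_]; 0ℤ; 1ℤ; -1ℤ)
import Data.Integer.Divisibility as ℤ
import Data.Integer.Divisibility.Signed as ℤS
import Data.Integer.DivMod as ℤ
import Data.Integer.GCD as ℤ
import Data.Integer.Properties as ℤ
import Data.Integer.Coprimality as ℤC
open import Data.List.Base as List using (List; []; _∷_)
open import Data.Nat.Base as ℕ using (ℕ; zero; suc; z≤n; s≤s; _!; NonTrivial)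
import Data.Nat.Coprimality as ℕC
import Data.Nat.Divisibility as ℕ
import Data.Nat.Properties as ℕ
open import Data.Product.Base using (Σ-syntax; ∃-syntax; _×_; _,_; proj₁; proj₂)
open import Data.Rational.Base as ℚ using (ℚ; 0ℚ; 1ℚ; ½; ∣_∣; _/_)
import Data.Rational.Properties as ℚ
open import Data.Rational.Solver using (module +-*-Solver)
import Data.Rational.Unnormalised.Base as ℚᵘ
import Data.Rational.Unnormalised.Properties as ℚᵘ
open import Data.Sum.Base using (inj₁; inj₂)
open import Data.Vec.Base as Vec using (Vec)
open import Data.Vec.Functional using (Vector; foldr)
open import Level using (0ℓ)
open import Relation.Binary.PropositionalEquality
open import Relation.Nullary using (¬_; yes; no)
open import Tactic.RingSolver.Core.Expression using (Expr; Κ; Ι; _⊕_; _⊗_; _⊛_; module Eval)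

open RawSemiringDefs ℚ.+-*-rawSemiring using () renaming (_^_ to infixr 8 _^ℚ_)

module RationalEstimates where
  open +-*-Solver using (solve; _:+_; _:*_; :-_; _:-_; _:=_; con)

  0≤/ : ∀ n d .{{_ : ℕ.NonZero d}} → 0ℚ ℚ.≤ + n / d
  0≤/ n d = ℚ.nonNegative⁻¹ (+ n / d) {{ℚ.normalize-nonNeg n d}}

  toℚᵘ-/1 : ∀ i → ℚ.toℚᵘ (i / 1) ℚᵘ.≃ ℚᵘ.mkℚᵘ i 0
  toℚᵘ-/1 i = ℚ.toℚᵘ-fromℚᵘ (ℚᵘ.mkℚᵘ i 0)

  opaque
    fromℕℚ : ℕ → ℚ
    fromℕℚ n = + n / 1

    fromℕℚ-def : ∀ n → fromℕℚ n ≡ + n / 1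
    fromℕℚ-def n = refl

    0≤fromℕℚ : ∀ n → 0ℚ ℚ.≤ fromℕℚ n
    0≤fromℕℚ n = 0≤/ n 1

    0<fromℕℚ : ∀ n .{{_ : ℕ.NonZero n}} → 0ℚ ℚ.< fromℕℚ n
    0<fromℕℚ (suc n) = ℚ.positive⁻¹ (+ suc n / 1) {{ℚ.normalize-pos (suc n) 1}}

    toℚᵘ-fromℕℚ : ∀ n → ℚ.toℚᵘ (fromℕℚ n) ℚᵘ.≃ ℚᵘ.mkℚᵘ (+ n) 0
    toℚᵘ-fromℕℚ n = toℚᵘ-/1 (+ n)

    fromℕℚ-1 : fromℕℚ 1 ≡ 1ℚ
    fromℕℚ-1 = refl

  fromℕℚ-* : ∀ m n → fromℕℚ (m ℕ.* n) ≡ fromℕℚ m ℚ.* fromℕℚ n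
  fromℕℚ-* m n = ℚ.toℚᵘ-injective (begin
    ℚ.toℚᵘ (fromℕℚ (m ℕ.* n))                     ≈⟨ toℚᵘ-fromℕℚ _ ⟩
    ℚᵘ.mkℚᵘ (+ (m ℕ.* n)) 0                        ≈⟨ ℚᵘ.*≡* (cong (ℤ._* 1ℤ) (ℤ.pos-* m n)) ⟩
    ℚᵘ.mkℚᵘ (+ m) 0 ℚᵘ.* ℚᵘ.mkℚᵘ (+ n) 0           ≈⟨ ℚᵘ.*-cong (toℚᵘ-fromℕℚ m) (toℚᵘ-fromℕℚ n) ⟨
    ℚ.toℚᵘ (fromℕℚ m) ℚᵘ.* ℚ.toℚᵘ (fromℕℚ n)     ≈⟨ ℚ.toℚᵘ-homo-* (fromℕℚ m) (fromℕℚ n) ⟨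
    ℚ.toℚᵘ (fromℕℚ m ℚ.* fromℕℚ n)               ∎)
    where open ℚᵘ.≃-Reasoning

  fromℕℚ-+ : ∀ m n → fromℕℚ (m ℕ.+ n) ≡ fromℕℚ m ℚ.+ fromℕℚ n
  fromℕℚ-+ m n = ℚ.toℚᵘ-injective (begin
    ℚ.toℚᵘ (fromℕℚ (m ℕ.+ n))                     ≈⟨ toℚᵘ-fromℕℚ _ ⟩
    ℚᵘ.mkℚᵘ (+ (m ℕ.+ n)) 0                        ≈⟨ ℚᵘ.*≡* (cong (ℤ._* 1ℤ) (trans (ℤ.pos-+ m n) (cong₂ ℤ._+_ (sym (ℤ.*-identityʳ (+ m))) (sym (ℤ.*-identityʳ (+ n)))))) ⟩
    ℚᵘ.mkℚᵘ (+ m) 0 ℚᵘ.+ ℚᵘ.mkℚᵘ (+ n) 0           ≈⟨ ℚᵘ.+-cong (toℚᵘ-fromℕℚ m) (toℚᵘ-fromℕℚ n) ⟨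
    ℚ.toℚᵘ (fromℕℚ m) ℚᵘ.+ ℚ.toℚᵘ (fromℕℚ n)     ≈⟨ ℚ.toℚᵘ-homo-+ (fromℕℚ m) (fromℕℚ n) ⟨
    ℚ.toℚᵘ (fromℕℚ m ℚ.+ fromℕℚ n)               ∎)
    where open ℚᵘ.≃-Reasoning

  fromℕℚ-suc : ∀ n → fromℕℚ (suc n) ≡ 1ℚ ℚ.+ fromℕℚ n
  fromℕℚ-suc n = trans (fromℕℚ-+ 1 n) (cong (ℚ._+ fromℕℚ n) fromℕℚ-1)

  fromℕℚ-2* : ∀ n → fromℕℚ (2 ℕ.* n) ≡ fromℕℚ n ℚ.+ fromℕℚ n
  fromℕℚ-2* n = trans (cong (λ z → fromℕℚ (n ℕ.+ z)) (ℕ.+-identityʳ n)) (fromℕℚ-+ n n)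

  fromℕℚ-^ : ∀ m k → fromℕℚ (m ℕ.^ k) ≡ fromℕℚ m ^ℚ k
  fromℕℚ-^ m zero    = fromℕℚ-1
  fromℕℚ-^ m (suc k) = trans (fromℕℚ-* m (m ℕ.^ k)) (cong (fromℕℚ m ℚ.*_) (fromℕℚ-^ m k))

  fromℕℚ-mono : ∀ {m n} → m ℕ.≤ n → fromℕℚ m ℚ.≤ fromℕℚ n
  fromℕℚ-mono {m} {n} m≤n = ℚ.toℚᵘ-cancel-≤ (begin
    ℚ.toℚᵘ (fromℕℚ m)   ≃⟨ toℚᵘ-fromℕℚ m ⟩
    ℚᵘ.mkℚᵘ (+ m) 0     ≤⟨ ℚᵘ.*≤* (ℤ.*-monoʳ-≤-nonNeg 1ℤ (ℤ.+≤+ m≤n)) ⟩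
    ℚᵘ.mkℚᵘ (+ n) 0     ≃⟨ toℚᵘ-fromℕℚ n ⟨
    ℚ.toℚᵘ (fromℕℚ n)   ∎)
    where open ℚᵘ.≤-Reasoning

  1/suc* : ∀ d → (+ 1 / suc d) ℚ.* fromℕℚ (suc d) ≡ 1ℚ
  1/suc* d = ℚ.toℚᵘ-injective (begin
    ℚ.toℚᵘ ((+ 1 / suc d) ℚ.* fromℕℚ (suc d))              ≈⟨ ℚ.toℚᵘ-homo-* (+ 1 / suc d) (fromℕℚ (suc d)) ⟩
    ℚ.toℚᵘ (+ 1 / suc d) ℚᵘ.* ℚ.toℚᵘ (fromℕℚ (suc d))      ≈⟨ ℚᵘ.*-cong (ℚ.toℚᵘ-fromℚᵘ (ℚᵘ.mkℚᵘ 1ℤ d)) (toℚᵘ-fromℕℚ (suc d)) ⟩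
    ℚᵘ.mkℚᵘ 1ℤ d ℚᵘ.* ℚᵘ.mkℚᵘ (+ suc d) 0                   ≈⟨ ℚᵘ.*≡* (cong +_ eq) ⟩
    ℚᵘ.1ℚᵘ                                                  ∎)
    where
    open ℚᵘ.≃-Reasoning
    eq : ((suc d ℕ.+ 0) ℕ.* 1) ≡ ((suc d ℕ.* 1) ℕ.+ 0)
    eq = trans (ℕ.*-identityʳ (suc d ℕ.+ 0)) (cong (ℕ._+ 0) (sym (ℕ.*-identityʳ (suc d))))

  1/* : ∀ d .{{_ : ℕ.NonZero d}} → (+ 1 / d) ℚ.* fromℕℚ d ≡ 1ℚ
  1/* (suc d) = 1/suc* d

  *-mono-≤ : ∀ {a b c d} → 0ℚ ℚ.≤ a → 0ℚ ℚ.≤ d → a ℚ.≤ b → c ℚ.≤ d → a ℚ.* c ℚ.≤ b ℚ.* d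
  *-mono-≤ {a} {b} {c} {d} 0≤a 0≤d a≤b c≤d = ℚ.≤-trans
    (ℚ.*-monoˡ-≤-nonNeg a {{ℚ.nonNegative 0≤a}} c≤d)
    (ℚ.*-monoʳ-≤-nonNeg d {{ℚ.nonNegative 0≤d}} a≤b)

  0≤* : ∀ {a b} → 0ℚ ℚ.≤ a → 0ℚ ℚ.≤ b → 0ℚ ℚ.≤ a ℚ.* b
  0≤* {a} {b} 0≤a 0≤b = subst (ℚ._≤ a ℚ.* b) (ℚ.*-zeroʳ a) (ℚ.*-monoˡ-≤-nonNeg a {{ℚ.nonNegative 0≤a}} 0≤b)

  0<* : ∀ {a b} → 0ℚ ℚ.< a → 0ℚ ℚ.< b → 0ℚ ℚ.< a ℚ.* b
  0<* {a} {b} 0<a 0<b = subst (ℚ._< a ℚ.* b) (ℚ.*-zeroʳ a) (ℚ.*-monoʳ-<-pos a {{ℚ.positive 0<a}} 0<b)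

  0<1/suc : ∀ d → 0ℚ ℚ.< + 1 / suc d
  0<1/suc d = ℚ.positive⁻¹ (+ 1 / suc d) {{ℚ.normalize-pos 1 (suc d)}}

  ∣∣-tri : ∀ a b c → ∣ a ℚ.- c ∣ ℚ.≤ ∣ a ℚ.- b ∣ ℚ.+ ∣ b ℚ.- c ∣
  ∣∣-tri a b c = subst (λ x → ∣ x ∣ ℚ.≤ ∣ a ℚ.- b ∣ ℚ.+ ∣ b ℚ.- c ∣)
    (solve 3 (λ a b c → (a :- b) :+ (b :- c) := a :- c) refl a b c)
    (ℚ.∣p+q∣≤∣p∣+∣q∣ (a ℚ.- b) (b ℚ.- c))

  ∣-∣-comm : ∀ a b → ∣ a ℚ.- b ∣ ≡ ∣ b ℚ.- a ∣
  ∣-∣-comm a b = trans (sym (ℚ.∣-p∣≡∣p∣ (a ℚ.- b)))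
    (cong ∣_∣ (solve 2 (λ a b → :- (a :- b) := b :- a) refl a b))

  halves : ∀ ε → ½ ℚ.* ε ℚ.+ ½ ℚ.* ε ≡ ε
  halves ε = solve 1 (λ ε → con ½ :* ε :+ con ½ :* ε := ε) refl ε

  0<½* : ∀ {ε} → 0ℚ ℚ.< ε → 0ℚ ℚ.< ½ ℚ.* ε
  0<½* = 0<* (ℚ.positive⁻¹ ½)

  opaque
    ceil : ∀ q → ∃[ K ] q ℚ.≤ fromℕℚ K
    ceil q@(ℚ.mkℚ (+ n) d _) = n , ℚ.toℚᵘ-cancel-≤ (ℚᵘ.≤-respʳ-≃ (ℚᵘ.≃-sym (toℚᵘ-fromℕℚ n))
      (ℚᵘ.*≤* (subst₂ ℤ._≤_ (ℤ.pos-* n 1) (ℤ.pos-* n (suc d)) (ℤ.+≤+ (ℕ.*-monoʳ-≤ n (s≤s z≤n))))))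
    ceil q@(ℚ.mkℚ -[1+ n ] d _) = 0 , ℚ.≤-trans (ℚ.<⇒≤ (ℚ.negative⁻¹ q)) (0≤fromℕℚ 0)

    -- ε/(K+1), a margin η > 0 with K η < ε
    margin : ∀ ε K → 0ℚ ℚ.< ε → ∃[ η ] 0ℚ ℚ.< η × fromℕℚ K ℚ.* η ℚ.< ε
    margin ε K 0<ε = η , 0<η , (begin-strict
        fromℕℚ K ℚ.* η              ≡⟨ ℚ.+-identityˡ _ ⟨
        0ℚ ℚ.+ fromℕℚ K ℚ.* η       <⟨ ℚ.+-monoˡ-< (fromℕℚ K ℚ.* η) 0<η ⟩
        η ℚ.+ fromℕℚ K ℚ.* η        ≡⟨ solve 2 (λ η k → η :+ k :* η := (con 1ℚ :+ k) :* η) refl η (fromℕℚ K) ⟩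
        (1ℚ ℚ.+ fromℕℚ K) ℚ.* η     ≡⟨ cong (ℚ._* η) (fromℕℚ-suc K) ⟨
        fromℕℚ (suc K) ℚ.* η        ≡⟨ solve 3 (λ s ε i → s :* (ε :* i) := ε :* (i :* s)) refl (fromℕℚ (suc K)) ε (+ 1 / suc K) ⟩
        ε ℚ.* ((+ 1 / suc K) ℚ.* fromℕℚ (suc K)) ≡⟨ cong (ε ℚ.*_) (1/suc* K) ⟩
        ε ℚ.* 1ℚ                    ≡⟨ ℚ.*-identityʳ ε ⟩
        ε ∎)
      where
      open ℚ.≤-Reasoning
      η : ℚ
      η = ε ℚ.* (+ 1 / suc K)
      0<η : 0ℚ ℚ.< η
      0<η = 0<* 0<ε (0<1/suc K)

  pow≤ : ∀ {x K} n → ∣ x ∣ ℚ.≤ K → ∣ x ^ℚ n ∣ ℚ.≤ K ^ℚ n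
  0≤pow : ∀ {K} n → 0ℚ ℚ.≤ K → 0ℚ ℚ.≤ K ^ℚ n
  0≤pow zero    0≤K = ℚ.nonNegative⁻¹ 1ℚ
  0≤pow (suc n) 0≤K = 0≤* 0≤K (0≤pow n 0≤K)
  pow≤ zero    h = ℚ.≤-refl
  pow≤ {x} {K} (suc n) h = subst (ℚ._≤ K ℚ.* K ^ℚ n) (sym (ℚ.∣p*q∣≡∣p∣*∣q∣ x (x ^ℚ n)))
    (*-mono-≤ (ℚ.0≤∣p∣ x) (0≤pow n (ℚ.≤-trans (ℚ.0≤∣p∣ x) h)) h (pow≤ n h))

open RationalEstimates

IsCauchy : (ℕ → ℚ) → Set
IsCauchy s = ∀ ε → 0ℚ ℚ.< ε → ∃[ N ] ∀ m n → N ℕ.≤ m → N ℕ.≤ n → ∣ s m ℚ.- s n ∣ ℚ.< ε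

-- A real number is a Cauchy sequence of rationals; the setoid equality is _≃_.
record ℝ : Set where
  constructor mkℝ
  field
    seq    : ℕ → ℚ
    cauchy : IsCauchy seq
open ℝ public

infix 4 _≃_ _<_

_≃_ : ℝ → ℝ → Set
x ≃ y = ∀ ε → 0ℚ ℚ.< ε → ∃[ N ] ∀ n → N ℕ.≤ n → ∣ seq x n ℚ.- seq y n ∣ ℚ.< ε

_<_ : ℝ → ℝ → Set
x < y = ∃[ ε ] 0ℚ ℚ.< ε × (∃[ N ] ∀ n → N ℕ.≤ n → seq x n ℚ.+ ε ℚ.< seq y n)

private
  open +-*-Solver using (solve; _:+_; _:*_; :-_; _:-_; _:=_; con)

  prefixBound : (ℕ → ℚ) → ℕ → ℚ
  prefixBound s zero    = ∣ s 0 ∣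
  prefixBound s (suc n) = ∣ s (suc n) ∣ ℚ.+ prefixBound s n

  0≤prefix : ∀ s N → 0ℚ ℚ.≤ prefixBound s N
  0≤prefix s zero    = ℚ.0≤∣p∣ (s 0)
  0≤prefix s (suc N) = ℚ.+-mono-≤ (ℚ.0≤∣p∣ (s (suc N))) (0≤prefix s N)

  ∣s∣≤prefix : ∀ s N n → n ℕ.≤ N → ∣ s n ∣ ℚ.≤ prefixBound s N
  ∣s∣≤prefix s zero    zero z≤n = ℚ.≤-refl
  ∣s∣≤prefix s (suc N) n n≤sN with ℕ.m≤n⇒m<n∨m≡n n≤sN
  ... | inj₁ (s≤s n≤N) = ℚ.≤-trans (∣s∣≤prefix s N n n≤N)
          (subst (ℚ._≤ prefixBound s (suc N)) (ℚ.+-identityˡ _) (ℚ.+-monoˡ-≤ (prefixBound s N) (ℚ.0≤∣p∣ (s (suc N)))))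
  ... | inj₂ refl = subst (ℚ._≤ prefixBound s (suc N)) (ℚ.+-identityʳ _) (ℚ.+-monoʳ-≤ ∣ s (suc N) ∣ (0≤prefix s N))

opaque
  bounded : (x : ℝ) → ∃[ K ] ∀ n → ∣ seq x n ∣ ℚ.≤ fromℕℚ K
  bounded (mkℝ s c) with c 1ℚ (ℚ.positive⁻¹ 1ℚ)
  ... | N , close with ceil (1ℚ ℚ.+ prefixBound s N)
  ...   | K , K-big = K , λ n → ℚ.≤-trans (go n) K-big
    where
    open ℚ.≤-Reasoning
    go : ∀ n → ∣ s n ∣ ℚ.≤ 1ℚ ℚ.+ prefixBound s N
    go n with ℕ.≤-total n N
    ... | inj₁ n≤N = begin
      ∣ s n ∣                    ≤⟨ ∣s∣≤prefix s N n n≤N ⟩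
      prefixBound s N            ≡⟨ ℚ.+-identityˡ _ ⟨
      0ℚ ℚ.+ prefixBound s N     ≤⟨ ℚ.+-monoˡ-≤ (prefixBound s N) (ℚ.nonNegative⁻¹ 1ℚ) ⟩
      1ℚ ℚ.+ prefixBound s N     ∎
    ... | inj₂ N≤n = begin
      ∣ s n ∣                       ≡⟨ cong ∣_∣ (solve 2 (λ a b → a := (a :- b) :+ b) refl (s n) (s N)) ⟩
      ∣ (s n ℚ.- s N) ℚ.+ s N ∣     ≤⟨ ℚ.∣p+q∣≤∣p∣+∣q∣ (s n ℚ.- s N) (s N) ⟩
      ∣ s n ℚ.- s N ∣ ℚ.+ ∣ s N ∣   ≤⟨ ℚ.+-mono-≤ (ℚ.<⇒≤ (close n N N≤n ℕ.≤-refl)) (∣s∣≤prefix s N N ℕ.≤-refl) ⟩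
      1ℚ ℚ.+ prefixBound s N        ∎

fromℚ : ℚ → ℝ
fromℚ q = mkℝ (λ _ → q) λ ε 0<ε → 0 , λ _ _ _ _ → subst (ℚ._< ε) (sym (cong ∣_∣ (ℚ.+-inverseʳ q))) 0<ε

fromℤ : ℤ → ℝ
fromℤ i = fromℚ (i / 1)

0ℝ 1ℝ : ℝ
0ℝ = fromℚ 0ℚ
1ℝ = fromℚ 1ℚ

infixl 6 _+_
infixl 7 _*_
infix  8 -_

private
  opaque
    +-cauchy : ∀ s t → IsCauchy s → IsCauchy t → IsCauchy (λ n → s n ℚ.+ t n)
    +-cauchy s t c d ε 0<ε with c (½ ℚ.* ε) (0<½* 0<ε) | d (½ ℚ.* ε) (0<½* 0<ε)
    ... | M , p | N , q = M ℕ.⊔ N , λ m n Lm Ln → begin-strict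
      ∣ (s m ℚ.+ t m) ℚ.- (s n ℚ.+ t n) ∣       ≡⟨ cong ∣_∣ (solve 4 (λ a b c d → (a :+ b) :- (c :+ d) := (a :- c) :+ (b :- d)) refl (s m) (t m) (s n) (t n)) ⟩
      ∣ (s m ℚ.- s n) ℚ.+ (t m ℚ.- t n) ∣       ≤⟨ ℚ.∣p+q∣≤∣p∣+∣q∣ (s m ℚ.- s n) (t m ℚ.- t n) ⟩
      ∣ s m ℚ.- s n ∣ ℚ.+ ∣ t m ℚ.- t n ∣       <⟨ ℚ.+-mono-< (p m n (ℕ.m⊔n≤o⇒m≤o M N Lm) (ℕ.m⊔n≤o⇒m≤o M N Ln)) (q m n (ℕ.m⊔n≤o⇒n≤o M N Lm) (ℕ.m⊔n≤o⇒n≤o M N Ln)) ⟩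
      ½ ℚ.* ε ℚ.+ ½ ℚ.* ε                       ≡⟨ halves ε ⟩
      ε                                         ∎
      where open ℚ.≤-Reasoning

_+_ : ℝ → ℝ → ℝ
x + y = mkℝ (λ n → seq x n ℚ.+ seq y n) (+-cauchy (seq x) (seq y) (cauchy x) (cauchy y))

private
  opaque
    neg-cauchy : ∀ s → IsCauchy s → IsCauchy (λ n → ℚ.- s n)
    neg-cauchy s c ε 0<ε = proj₁ (c ε 0<ε) , λ m n M N →
      subst (ℚ._< ε)
        (trans (∣-∣-comm (s m) (s n)) (cong ∣_∣ (solve 2 (λ a b → b :- a := :- a :- (:- b)) refl (s m) (s n))))
        (proj₂ (c ε 0<ε) m n M N)

-_ : ℝ → ℝ
- x = mkℝ (λ n → ℚ.- seq x n) (neg-cauchy (seq x) (cauchy x))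

private
  *-diff : ∀ a b c d k l η → 0ℚ ℚ.≤ η → 0ℚ ℚ.≤ l → ∣ a ∣ ℚ.≤ k → ∣ d ∣ ℚ.≤ l →
           ∣ a ℚ.- c ∣ ℚ.≤ η → ∣ b ℚ.- d ∣ ℚ.≤ η → ∣ a ℚ.* b ℚ.- c ℚ.* d ∣ ℚ.≤ (k ℚ.+ l) ℚ.* η
  *-diff a b c d k l η 0≤η 0≤l ha hd hac hbd = begin
    ∣ a ℚ.* b ℚ.- c ℚ.* d ∣                           ≡⟨ cong ∣_∣ (solve 4 (λ a b c d → a :* b :- c :* d := a :* (b :- d) :+ (a :- c) :* d) refl a b c d) ⟩
    ∣ a ℚ.* (b ℚ.- d) ℚ.+ (a ℚ.- c) ℚ.* d ∣           ≤⟨ ℚ.∣p+q∣≤∣p∣+∣q∣ (a ℚ.* (b ℚ.- d)) ((a ℚ.- c) ℚ.* d) ⟩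
    ∣ a ℚ.* (b ℚ.- d) ∣ ℚ.+ ∣ (a ℚ.- c) ℚ.* d ∣       ≡⟨ cong₂ ℚ._+_ (ℚ.∣p*q∣≡∣p∣*∣q∣ a (b ℚ.- d)) (ℚ.∣p*q∣≡∣p∣*∣q∣ (a ℚ.- c) d) ⟩
    ∣ a ∣ ℚ.* ∣ b ℚ.- d ∣ ℚ.+ ∣ a ℚ.- c ∣ ℚ.* ∣ d ∣   ≤⟨ ℚ.+-mono-≤ (*-mono-≤ (ℚ.0≤∣p∣ a) 0≤η ha hbd) (*-mono-≤ (ℚ.0≤∣p∣ (a ℚ.- c)) 0≤l hac hd) ⟩
    k ℚ.* η ℚ.+ η ℚ.* l                               ≡⟨ solve 3 (λ k η l → k :* η :+ η :* l := (k :+ l) :* η) refl k η l ⟩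
    (k ℚ.+ l) ℚ.* η                                   ∎
    where open ℚ.≤-Reasoning

  opaque
    *-cauchy : ∀ s t K L → (∀ n → ∣ s n ∣ ℚ.≤ fromℕℚ K) → (∀ n → ∣ t n ∣ ℚ.≤ fromℕℚ L) →
               IsCauchy s → IsCauchy t → IsCauchy (λ n → s n ℚ.* t n)
    *-cauchy s t K L hK hL c d ε 0<ε with margin ε (K ℕ.+ L) 0<ε
    ... | η , 0<η , small with c η 0<η | d η 0<η
    ...   | M , p | N , q = M ℕ.⊔ N , λ m n Lm Ln → ℚ.≤-<-trans
      (*-diff (s m) (t m) (s n) (t n) (fromℕℚ K) (fromℕℚ L) η (ℚ.<⇒≤ 0<η) (0≤fromℕℚ L) (hK m) (hL n)
        (ℚ.<⇒≤ (p m n (ℕ.m⊔n≤o⇒m≤o M N Lm) (ℕ.m⊔n≤o⇒m≤o M N Ln)))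
        (ℚ.<⇒≤ (q m n (ℕ.m⊔n≤o⇒n≤o M N Lm) (ℕ.m⊔n≤o⇒n≤o M N Ln))))
      (subst (λ z → z ℚ.* η ℚ.< ε) (fromℕℚ-+ K L) small)

_*_ : ℝ → ℝ → ℝ
x * y = mkℝ (λ n → seq x n ℚ.* seq y n)
  (*-cauchy (seq x) (seq y) (proj₁ (bounded x)) (proj₁ (bounded y)) (proj₂ (bounded x)) (proj₂ (bounded y)) (cauchy x) (cauchy y))

ℝ-rawRing : RawRing 0ℓ 0ℓ
ℝ-rawRing = record
  { Carrier = ℝ ; _≈_ = _≃_ ; _+_ = _+_ ; _*_ = _*_ ; -_ = -_ ; 0# = 0ℝ ; 1# = 1ℝ }

∑< : ℕ → (ℕ → ℚ) → ℚ
∑< zero    f = 0ℚ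
∑< (suc N) f = ∑< N f ℚ.+ f N

cosTerm : ℚ → ℕ → ℚ
cosTerm q k = (((-1ℤ ℤ.^ k) / (2 ℕ.* k) !) {{(2 ℕ.* k) ℕ.!≢0}}) ℚ.* q ^ℚ (2 ℕ.* k)

cosPartial : ℕ → ℚ → ℚ
cosPartial N q = ∑< N (cosTerm q)

module PowerSeriesEstimates where
  1/! : ℕ → ℚ
  1/! m = ((+ 1) / m !) {{m ℕ.!≢0}}

  opaque
    2^- : ℕ → ℚ
    2^- n = (+ 1 / 2 ℕ.^ n) {{ℕ.m^n≢0 2 n}}

    0≤2^- : ∀ n → 0ℚ ℚ.≤ 2^- n
    0≤2^- n = 0≤/ 1 (2 ℕ.^ n) {{ℕ.m^n≢0 2 n}}

    2^-*2^ : ∀ n → 2^- n ℚ.* fromℕℚ (2 ℕ.^ n) ≡ 1ℚ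
    2^-*2^ n = 1/* (2 ℕ.^ n) {{ℕ.m^n≢0 2 n}}

    2^-0 : 2^- 0 ≡ 1ℚ
    2^-0 = refl

  0<2^ : ∀ n → 0ℚ ℚ.< fromℕℚ (2 ℕ.^ n)
  0<2^ n = 0<fromℕℚ (2 ℕ.^ n) {{ℕ.m^n≢0 2 n}}

  0<! : ∀ n → 0ℚ ℚ.< fromℕℚ (n !)
  0<! n = 0<fromℕℚ (n !) {{n ℕ.!≢0}}

  cancelʳ-≤ : ∀ {p q} r → 0ℚ ℚ.< r → p ℚ.* r ℚ.≤ q ℚ.* r → p ℚ.≤ q
  cancelʳ-≤ r 0<r = ℚ.*-cancelʳ-≤-pos r {{ℚ.positive 0<r}}

  2^-double : ∀ n → 2^- (suc n) ℚ.+ 2^- (suc n) ≡ 2^- n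
  2^-double n = begin
    P ℚ.+ P                                        ≡⟨ ℚ.*-identityʳ _ ⟨
    (P ℚ.+ P) ℚ.* 1ℚ                               ≡⟨ cong ((P ℚ.+ P) ℚ.*_) (2^-*2^ n) ⟨
    (P ℚ.+ P) ℚ.* (2^- n ℚ.* F)                    ≡⟨ solve 3 (λ P b c → (P :+ P) :* (b :* c) := (P :* (c :+ c)) :* b) refl P (2^- n) F ⟩
    P ℚ.* (F ℚ.+ F) ℚ.* 2^- n                      ≡⟨ cong (λ z → P ℚ.* z ℚ.* 2^- n) (fromℕℚ-2* (2 ℕ.^ n)) ⟨
    P ℚ.* fromℕℚ (2 ℕ.^ suc n) ℚ.* 2^- n           ≡⟨ cong (ℚ._* 2^- n) (2^-*2^ (suc n)) ⟩
    1ℚ ℚ.* 2^- n                                   ≡⟨ ℚ.*-identityˡ _ ⟩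
    2^- n                                          ∎
    where
    open ≡-Reasoning
    P = 2^- (suc n)
    F = fromℕℚ (2 ℕ.^ n)

  2^-anti : ∀ n d → 2^- (n ℕ.+ d) ℚ.≤ 2^- n
  2^-anti n zero    = ℚ.≤-reflexive (cong 2^- (ℕ.+-identityʳ n))
  2^-anti n (suc d) = begin
    2^- (n ℕ.+ suc d)                                  ≡⟨ cong 2^- (ℕ.+-suc n d) ⟩
    2^- (suc (n ℕ.+ d))                                ≡⟨ ℚ.+-identityʳ _ ⟨
    2^- (suc (n ℕ.+ d)) ℚ.+ 0ℚ                         ≤⟨ ℚ.+-monoʳ-≤ (2^- (suc (n ℕ.+ d))) (0≤2^- (suc (n ℕ.+ d))) ⟩
    2^- (suc (n ℕ.+ d)) ℚ.+ 2^- (suc (n ℕ.+ d))        ≡⟨ 2^-double (n ℕ.+ d) ⟩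
    2^- (n ℕ.+ d)                                      ≤⟨ 2^-anti n d ⟩
    2^- n                                              ∎
    where open ℚ.≤-Reasoning

  n<2^n : ∀ n → n ℕ.< 2 ℕ.^ n
  n<2^n zero    = s≤s z≤n
  n<2^n (suc n) = begin-strict
    suc n                       ≤⟨ n<2^n n ⟩
    2 ℕ.^ n                     <⟨ ℕ.m<m+n (2 ℕ.^ n) (ℕ.m^n>0 2 n) ⟩
    2 ℕ.^ n ℕ.+ 2 ℕ.^ n         ≡⟨ cong (2 ℕ.^ n ℕ.+_) (ℕ.+-identityʳ _) ⟨
    2 ℕ.^ suc n                 ∎
    where open ℕ.≤-Reasoning

  2^-≤1/suc : ∀ n → 2^- n ℚ.≤ + 1 / suc n
  2^-≤1/suc n = cancelʳ-≤ (fromℕℚ (2 ℕ.^ n)) (0<2^ n) (begin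
    2^- n ℚ.* fromℕℚ (2 ℕ.^ n)             ≡⟨ 2^-*2^ n ⟩
    1ℚ                                     ≡⟨ 1/suc* n ⟨
    (+ 1 / suc n) ℚ.* fromℕℚ (suc n)       ≤⟨ ℚ.*-monoˡ-≤-nonNeg (+ 1 / suc n) {{ℚ.normalize-nonNeg 1 (suc n)}} (fromℕℚ-mono (n<2^n n)) ⟩
    (+ 1 / suc n) ℚ.* fromℕℚ (2 ℕ.^ n)     ∎)
    where open ℚ.≤-Reasoning

  opaque
    2^-small : ∀ ε K → 0ℚ ℚ.< ε → ∃[ N ] fromℕℚ K ℚ.* 2^- N ℚ.< ε
    2^-small ε K 0<ε with margin ε K 0<ε
    ... | η , 0<η , small with ceil ((ℚ.1/ η) {{ℚ.>-nonZero 0<η}})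
    ...   | N , big = N , ℚ.≤-<-trans (ℚ.*-monoˡ-≤-nonNeg (fromℕℚ K) {{ℚ.nonNegative (0≤fromℕℚ K)}} 2^-N≤η) small
      where
      open ℚ.≤-Reasoning
      instance
        η≢0 : ℚ.NonZero η
        η≢0 = ℚ.>-nonZero 0<η
      2^-N≤η : 2^- N ℚ.≤ η
      2^-N≤η = ℚ.≤-trans (2^-≤1/suc N) (cancelʳ-≤ (fromℕℚ (suc N)) (0<fromℕℚ (suc N)) (begin
        (+ 1 / suc N) ℚ.* fromℕℚ (suc N)   ≡⟨ 1/suc* N ⟩
        1ℚ                                 ≡⟨ ℚ.*-inverseʳ η ⟨
        η ℚ.* (ℚ.1/ η)                     ≤⟨ ℚ.*-monoˡ-≤-nonNeg η {{ℚ.nonNegative (ℚ.<⇒≤ 0<η)}} (ℚ.≤-trans big (fromℕℚ-mono (ℕ.n≤1+n N))) ⟩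
        η ℚ.* fromℕℚ (suc N)               ∎))

  Q^m≤Q^Q*m! : ∀ Q .{{_ : ℕ.NonZero Q}} m → Q ℕ.^ m ℕ.≤ Q ℕ.^ Q ℕ.* m !
  Q^m≤Q^Q*m! Q m with ℕ.≤-total m Q
  ... | inj₁ m≤Q = ℕ.≤-trans (ℕ.^-monoʳ-≤ Q m≤Q) (ℕ.m≤m*n (Q ℕ.^ Q) (m !) {{m ℕ.!≢0}})
  Q^m≤Q^Q*m! Q zero    | inj₂ Q≤m = ℕ.≤-trans (ℕ.m^n>0 Q Q) (ℕ.≤-reflexive (sym (ℕ.*-identityʳ _)))
  Q^m≤Q^Q*m! Q (suc m) | inj₂ Q≤m = begin
    Q ℕ.* Q ℕ.^ m                     ≤⟨ ℕ.*-mono-≤ Q≤m (Q^m≤Q^Q*m! Q m) ⟩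
    suc m ℕ.* (Q ℕ.^ Q ℕ.* m !)       ≡⟨ ℕ.*-assoc (suc m) (Q ℕ.^ Q) (m !) ⟨
    suc m ℕ.* Q ℕ.^ Q ℕ.* m !         ≡⟨ cong (ℕ._* m !) (ℕ.*-comm (suc m) (Q ℕ.^ Q)) ⟩
    Q ℕ.^ Q ℕ.* suc m ℕ.* m !         ≡⟨ ℕ.*-assoc (Q ℕ.^ Q) (suc m) (m !) ⟩
    Q ℕ.^ Q ℕ.* (suc m) !             ∎
    where open ℕ.≤-Reasoning

  ∣sign/!∣ : ∀ k d .{{_ : ℕ.NonZero d}} → ∣ (-1ℤ ℤ.^ k) / d ∣ ≡ + 1 / d
  ∣sign/!∣ zero    d = ℚ.0≤p⇒∣p∣≡p (0≤/ 1 d)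
  ∣sign/!∣ (suc k) d = trans (cong ∣_∣ (flip (-1ℤ ℤ.^ k))) (trans (ℚ.∣-p∣≡∣p∣ ((-1ℤ ℤ.^ k) / d)) (∣sign/!∣ k d))
    where
    flip : ∀ i → (-1ℤ ℤ.* i) / d ≡ ℚ.- (i / d)
    flip i = trans (cong (_/ d) (ℤ.-1*i≡-i i)) (neg i)
      where
      neg : ∀ i → (ℤ.- i) / d ≡ ℚ.- (i / d)
      neg (+ zero)   = trans (ℚ.0/n≡0 d) (cong ℚ.-_ (sym (ℚ.0/n≡0 d)))
      neg (+ suc n)  = refl
      neg -[1+ n ]   = solve 1 (λ q → q := :- (:- q)) refl (+ suc n / d)

  -- J bounds the arguments; J^m/m! ≤ tailConst/2^m with tailConst = (2J)^(2J).
  module _ (J : ℕ) .{{_ : ℕ.NonZero J}} where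
    Q : ℕ
    Q = 2 ℕ.* J

    instance
      Q≢0 : ℕ.NonZero Q
      Q≢0 = ℕ.m*n≢0 2 J

    tailConst : ℕ
    tailConst = Q ℕ.^ Q

    A = fromℕℚ tailConst

    ^-distrib : ∀ m → Q ℕ.^ m ≡ 2 ℕ.^ m ℕ.* J ℕ.^ m
    ^-distrib zero    = refl
    ^-distrib (suc m) = trans (cong (Q ℕ.*_) (^-distrib m)) (ℕ.[m*n]*[o*p]≡[m*o]*[n*p] 2 J (2 ℕ.^ m) (J ℕ.^ m))

    coeffBound : ∀ m → 1/! m ℚ.* fromℕℚ J ^ℚ m ℚ.≤ A ℚ.* 2^- m
    coeffBound m = cancelʳ-≤ (fromℕℚ (m !) ℚ.* fromℕℚ (2 ℕ.^ m)) (0<* (0<! m) (0<2^ m)) (begin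
      1/! m ℚ.* fromℕℚ J ^ℚ m ℚ.* (fromℕℚ (m !) ℚ.* fromℕℚ (2 ℕ.^ m))
        ≡⟨ solve 4 (λ i j f t → i :* j :* (f :* t) := (i :* f) :* (t :* j)) refl (1/! m) (fromℕℚ J ^ℚ m) (fromℕℚ (m !)) (fromℕℚ (2 ℕ.^ m)) ⟩
      1/! m ℚ.* fromℕℚ (m !) ℚ.* (fromℕℚ (2 ℕ.^ m) ℚ.* fromℕℚ J ^ℚ m)
        ≡⟨ cong₂ ℚ._*_ (1/* (m !) {{m ℕ.!≢0}}) (cong (fromℕℚ (2 ℕ.^ m) ℚ.*_) (sym (fromℕℚ-^ J m))) ⟩
      1ℚ ℚ.* (fromℕℚ (2 ℕ.^ m) ℚ.* fromℕℚ (J ℕ.^ m))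
        ≡⟨ ℚ.*-identityˡ _ ⟩
      fromℕℚ (2 ℕ.^ m) ℚ.* fromℕℚ (J ℕ.^ m)
        ≡⟨ fromℕℚ-* (2 ℕ.^ m) (J ℕ.^ m) ⟨
      fromℕℚ (2 ℕ.^ m ℕ.* J ℕ.^ m)
        ≡⟨ cong fromℕℚ (^-distrib m) ⟨
      fromℕℚ (Q ℕ.^ m)
        ≤⟨ fromℕℚ-mono (Q^m≤Q^Q*m! Q m) ⟩
      fromℕℚ (tailConst ℕ.* m !)
        ≡⟨ fromℕℚ-* tailConst (m !) ⟩
      A ℚ.* fromℕℚ (m !)
        ≡⟨ ℚ.*-identityʳ _ ⟨
      A ℚ.* fromℕℚ (m !) ℚ.* 1ℚ
        ≡⟨ cong (A ℚ.* fromℕℚ (m !) ℚ.*_) (2^-*2^ m) ⟨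
      A ℚ.* fromℕℚ (m !) ℚ.* (2^- m ℚ.* fromℕℚ (2 ℕ.^ m))
        ≡⟨ solve 4 (λ a f p t → a :* f :* (p :* t) := a :* p :* (f :* t)) refl A (fromℕℚ (m !)) (2^- m) (fromℕℚ (2 ℕ.^ m)) ⟩
      A ℚ.* 2^- m ℚ.* (fromℕℚ (m !) ℚ.* fromℕℚ (2 ℕ.^ m)) ∎)
      where open ℚ.≤-Reasoning

    coeff : ℕ → ℚ
    coeff k = ((-1ℤ ℤ.^ k) / (2 ℕ.* k) !) {{(2 ℕ.* k) ℕ.!≢0}}

    scaled : ∀ k z D → 0ℚ ℚ.≤ D → ∣ z ∣ ℚ.≤ fromℕℚ J ^ℚ (2 ℕ.* k) ℚ.* D → ∣ coeff k ℚ.* z ∣ ℚ.≤ (A ℚ.* D) ℚ.* 2^- k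
    scaled k z D 0≤D h = begin
      ∣ coeff k ℚ.* z ∣                                          ≡⟨ ℚ.∣p*q∣≡∣p∣*∣q∣ (coeff k) z ⟩
      ∣ coeff k ∣ ℚ.* ∣ z ∣                                      ≡⟨ cong (ℚ._* ∣ z ∣) (∣sign/!∣ k (m !) {{m ℕ.!≢0}}) ⟩
      1/! m ℚ.* ∣ z ∣                                      ≤⟨ ℚ.*-monoˡ-≤-nonNeg (1/! m) {{ℚ.normalize-nonNeg 1 (m !) {{m ℕ.!≢0}}}} h ⟩
      1/! m ℚ.* (fromℕℚ J ^ℚ m ℚ.* D)                      ≡⟨ ℚ.*-assoc (1/! m) (fromℕℚ J ^ℚ m) D ⟨
      1/! m ℚ.* fromℕℚ J ^ℚ m ℚ.* D                        ≤⟨ ℚ.*-monoʳ-≤-nonNeg D {{ℚ.nonNegative 0≤D}} (coeffBound m) ⟩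
      A ℚ.* 2^- m ℚ.* D                                          ≡⟨ solve 3 (λ a p d → a :* p :* d := a :* d :* p) refl A (2^- m) D ⟩
      A ℚ.* D ℚ.* 2^- m                                          ≤⟨ ℚ.*-monoˡ-≤-nonNeg (A ℚ.* D) {{ℚ.nonNegative (0≤* (0≤fromℕℚ tailConst) 0≤D)}} (2^-anti k (k ℕ.+ 0)) ⟩
      A ℚ.* D ℚ.* 2^- k                                          ∎
      where
      open ℚ.≤-Reasoning
      m = 2 ℕ.* k

    powDiff : ∀ K x y → suc K ℕ.≤ J → ∣ x ∣ ℚ.≤ fromℕℚ K → ∣ y ∣ ℚ.≤ fromℕℚ K → ∀ m →
              ∣ x ^ℚ m ℚ.- y ^ℚ m ∣ ℚ.≤ fromℕℚ J ^ℚ m ℚ.* ∣ x ℚ.- y ∣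
    powDiff K x y K<J hx hy zero    = ℚ.≤-trans (ℚ.0≤∣p∣ (x ℚ.- y)) (ℚ.≤-reflexive (sym (ℚ.*-identityˡ _)))
    powDiff K x y K<J hx hy (suc m) = begin
      ∣ x ℚ.* X ℚ.- y ℚ.* Y ∣                                 ≡⟨ cong ∣_∣ (solve 4 (λ x X y Y → x :* X :- y :* Y := x :* (X :- Y) :+ Y :* (x :- y)) refl x X y Y) ⟩
      ∣ x ℚ.* (X ℚ.- Y) ℚ.+ Y ℚ.* (x ℚ.- y) ∣                 ≤⟨ ℚ.∣p+q∣≤∣p∣+∣q∣ (x ℚ.* (X ℚ.- Y)) (Y ℚ.* (x ℚ.- y)) ⟩
      ∣ x ℚ.* (X ℚ.- Y) ∣ ℚ.+ ∣ Y ℚ.* (x ℚ.- y) ∣             ≡⟨ cong₂ ℚ._+_ (ℚ.∣p*q∣≡∣p∣*∣q∣ x (X ℚ.- Y)) (ℚ.∣p*q∣≡∣p∣*∣q∣ Y (x ℚ.- y)) ⟩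
      ∣ x ∣ ℚ.* ∣ X ℚ.- Y ∣ ℚ.+ ∣ Y ∣ ℚ.* D                   ≤⟨ ℚ.+-mono-≤
        (*-mono-≤ (ℚ.0≤∣p∣ x) (0≤* (0≤pow m (0≤fromℕℚ J)) 0≤D) hx (powDiff K x y K<J hx hy m))
        (ℚ.*-monoʳ-≤-nonNeg D {{ℚ.nonNegative 0≤D}} (pow≤ m (ℚ.≤-trans hy (fromℕℚ-mono (ℕ.≤-trans (ℕ.n≤1+n K) K<J))))) ⟩
      fromℕℚ K ℚ.* (Jm ℚ.* D) ℚ.+ Jm ℚ.* D                    ≡⟨ solve 3 (λ k j d → k :* (j :* d) :+ j :* d := (con 1ℚ :+ k) :* (j :* d)) refl (fromℕℚ K) Jm D ⟩
      (1ℚ ℚ.+ fromℕℚ K) ℚ.* (Jm ℚ.* D)                        ≡⟨ cong (ℚ._* (Jm ℚ.* D)) (fromℕℚ-suc K) ⟨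
      fromℕℚ (suc K) ℚ.* (Jm ℚ.* D)                           ≤⟨ ℚ.*-monoʳ-≤-nonNeg (Jm ℚ.* D) {{ℚ.nonNegative (0≤* (0≤pow m (0≤fromℕℚ J)) 0≤D)}} (fromℕℚ-mono K<J) ⟩
      fromℕℚ J ℚ.* (Jm ℚ.* D)                                 ≡⟨ ℚ.*-assoc (fromℕℚ J) Jm D ⟨
      fromℕℚ J ℚ.* Jm ℚ.* D                                   ∎
      where
      open ℚ.≤-Reasoning
      X = x ^ℚ m
      Y = y ^ℚ m
      Jm = fromℕℚ J ^ℚ m
      D = ∣ x ℚ.- y ∣
      0≤D = ℚ.0≤∣p∣ (x ℚ.- y)

    -- |f k| ≤ c/2^k gives |f n + ⋯ + f (n+d-1)| + 2c/2^(n+d) ≤ 2c/2^n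
    geometric : ∀ (f : ℕ → ℚ) c → (∀ k → ∣ f k ∣ ℚ.≤ c ℚ.* 2^- k) → ∀ n d →
                ∣ ∑< (n ℕ.+ d) f ℚ.- ∑< n f ∣ ℚ.+ (c ℚ.+ c) ℚ.* 2^- (n ℕ.+ d) ℚ.≤ (c ℚ.+ c) ℚ.* 2^- n
    geometric f c h n zero rewrite ℕ.+-identityʳ n = ℚ.≤-reflexive (begin
      ∣ ∑< n f ℚ.- ∑< n f ∣ ℚ.+ (c ℚ.+ c) ℚ.* 2^- n   ≡⟨ cong (λ z → ∣ z ∣ ℚ.+ (c ℚ.+ c) ℚ.* 2^- n) (ℚ.+-inverseʳ (∑< n f)) ⟩
      0ℚ ℚ.+ (c ℚ.+ c) ℚ.* 2^- n                      ≡⟨ ℚ.+-identityˡ _ ⟩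
      (c ℚ.+ c) ℚ.* 2^- n                             ∎)
      where open ≡-Reasoning
    geometric f c h n (suc d) rewrite ℕ.+-suc n d = begin
      ∣ S ℚ.+ f N ℚ.- S₀ ∣ ℚ.+ (c ℚ.+ c) ℚ.* P               ≡⟨ cong₂ (λ u v → ∣ u ∣ ℚ.+ v) (solve 3 (λ a b c → a :+ b :- c := a :- c :+ b) refl S (f N) S₀) (solve 2 (λ c p → (c :+ c) :* p := c :* (p :+ p)) refl c P) ⟩
      ∣ S ℚ.- S₀ ℚ.+ f N ∣ ℚ.+ c ℚ.* (P ℚ.+ P)               ≤⟨ ℚ.+-mono-≤ (ℚ.≤-trans (ℚ.∣p+q∣≤∣p∣+∣q∣ (S ℚ.- S₀) (f N)) (ℚ.+-monoʳ-≤ ∣ S ℚ.- S₀ ∣ (h N))) (ℚ.≤-reflexive (cong (c ℚ.*_) (2^-double N))) ⟩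
      ∣ S ℚ.- S₀ ∣ ℚ.+ c ℚ.* 2^- N ℚ.+ c ℚ.* 2^- N           ≡⟨ solve 3 (λ s c p → s :+ c :* p :+ c :* p := s :+ (c :+ c) :* p) refl ∣ S ℚ.- S₀ ∣ c (2^- N) ⟩
      ∣ S ℚ.- S₀ ∣ ℚ.+ (c ℚ.+ c) ℚ.* 2^- N                   ≤⟨ geometric f c h n d ⟩
      (c ℚ.+ c) ℚ.* 2^- n                                    ∎
      where
      open ℚ.≤-Reasoning
      N = n ℕ.+ d
      S = ∑< N f
      S₀ = ∑< n f
      P = 2^- (suc N)

    geometric′ : ∀ (f : ℕ → ℚ) c → 0ℚ ℚ.≤ c → (∀ k → ∣ f k ∣ ℚ.≤ c ℚ.* 2^- k) → ∀ n d →
                 ∣ ∑< (n ℕ.+ d) f ℚ.- ∑< n f ∣ ℚ.≤ (c ℚ.+ c) ℚ.* 2^- n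
    geometric′ f c 0≤c h n d = ℚ.≤-trans
      (subst (ℚ._≤ S ℚ.+ R) (ℚ.+-identityʳ S) (ℚ.+-monoʳ-≤ S (0≤* (ℚ.+-mono-≤ 0≤c 0≤c) (0≤2^- (n ℕ.+ d)))))
      (geometric f c h n d)
      where
      S = ∣ ∑< (n ℕ.+ d) f ℚ.- ∑< n f ∣
      R = (c ℚ.+ c) ℚ.* 2^- (n ℕ.+ d)

    ∑<-diff : ∀ N f g → ∑< N (λ k → f k ℚ.- g k) ≡ ∑< N f ℚ.- ∑< N g
    ∑<-diff zero    f g = refl
    ∑<-diff (suc N) f g = trans (cong (ℚ._+ (f N ℚ.- g N)) (∑<-diff N f g))
      (solve 4 (λ a b c d → (a :- b) :+ (c :- d) := (a :+ c) :- (b :+ d)) refl (∑< N f) (∑< N g) (f N) (g N))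

    cosPartial-tail : ∀ x → ∣ x ∣ ℚ.≤ fromℕℚ J → ∀ n d →
      ∣ cosPartial (n ℕ.+ d) x ℚ.- cosPartial n x ∣ ℚ.≤ fromℕℚ (2 ℕ.* tailConst) ℚ.* 2^- n
    cosPartial-tail x h n d = ℚ.≤-trans
      (geometric′ (cosTerm x) (A ℚ.* 1ℚ) (0≤* (0≤fromℕℚ tailConst) (ℚ.nonNegative⁻¹ 1ℚ))
        (λ k → scaled k (x ^ℚ (2 ℕ.* k)) 1ℚ (ℚ.nonNegative⁻¹ 1ℚ) (ℚ.≤-trans (pow≤ (2 ℕ.* k) h) (ℚ.≤-reflexive (sym (ℚ.*-identityʳ _))))) n d)
      (ℚ.≤-reflexive (cong (ℚ._* 2^- n) (trans (cong₂ ℚ._+_ (ℚ.*-identityʳ A) (ℚ.*-identityʳ A)) (sym (fromℕℚ-2* tailConst)))))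

    cosPartial-Lipschitz : ∀ K x y → suc K ℕ.≤ J → ∣ x ∣ ℚ.≤ fromℕℚ K → ∣ y ∣ ℚ.≤ fromℕℚ K → ∀ N →
      ∣ cosPartial N x ℚ.- cosPartial N y ∣ ℚ.≤ fromℕℚ (2 ℕ.* tailConst) ℚ.* ∣ x ℚ.- y ∣
    cosPartial-Lipschitz K x y K<J hx hy N = begin
      ∣ cosPartial N x ℚ.- cosPartial N y ∣       ≡⟨ cong ∣_∣ (∑<-diff N (cosTerm x) (cosTerm y)) ⟨
      ∣ ∑< N f ∣                                  ≡⟨ cong ∣_∣ (solve 1 (λ a → a := a :- con 0ℚ) refl (∑< N f)) ⟩
      ∣ ∑< N f ℚ.- ∑< 0 f ∣                       ≤⟨ geometric′ f (A ℚ.* D) (0≤* (0≤fromℕℚ tailConst) 0≤D) bound 0 N ⟩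
      (A ℚ.* D ℚ.+ A ℚ.* D) ℚ.* 2^- 0             ≡⟨ cong ((A ℚ.* D ℚ.+ A ℚ.* D) ℚ.*_) 2^-0 ⟩
      (A ℚ.* D ℚ.+ A ℚ.* D) ℚ.* 1ℚ                ≡⟨ solve 2 (λ a d → (a :* d :+ a :* d) :* con 1ℚ := (a :+ a) :* d) refl A D ⟩
      (A ℚ.+ A) ℚ.* D                             ≡⟨ cong (ℚ._* D) (fromℕℚ-2* tailConst) ⟨
      fromℕℚ (2 ℕ.* tailConst) ℚ.* D              ∎
      where
      open ℚ.≤-Reasoning
      D = ∣ x ℚ.- y ∣
      0≤D = ℚ.0≤∣p∣ (x ℚ.- y)
      f : ℕ → ℚ
      f k = cosTerm x k ℚ.- cosTerm y k
      bound : ∀ k → ∣ f k ∣ ℚ.≤ (A ℚ.* D) ℚ.* 2^- k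
      bound k = subst (λ z → ∣ z ∣ ℚ.≤ (A ℚ.* D) ℚ.* 2^- k)
        (solve 3 (λ c a b → c :* (a :- b) := c :* a :- c :* b) refl (coeff k) (x ^ℚ (2 ℕ.* k)) (y ^ℚ (2 ℕ.* k)))
        (scaled k (x ^ℚ (2 ℕ.* k) ℚ.- y ^ℚ (2 ℕ.* k)) D 0≤D (powDiff K x y K<J hx hy (2 ℕ.* k)))

open PowerSeriesEstimates

private
  opaque
    cos-cauchy : ∀ s K → (∀ n → ∣ s n ∣ ℚ.≤ fromℕℚ K) → IsCauchy s → IsCauchy (λ n → cosPartial n (s n))
    cos-cauchy s K hK c ε 0<ε with margin (½ ℚ.* ε) (2 ℕ.* tailConst (suc K)) (0<½* 0<ε) | 2^-small (½ ℚ.* ε) (2 ℕ.* tailConst (suc K)) (0<½* 0<ε)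
    ... | η , 0<η , Cη<½ε | M , C2^-M<½ε with c η 0<η
    ...   | N , close = L , goal
      where
      open ℚ.≤-Reasoning
      L : ℕ
      L = M ℕ.⊔ N
      C : ℚ
      C = fromℕℚ (2 ℕ.* tailConst (suc K))
      hK⁺ : ∀ n → ∣ s n ∣ ℚ.≤ fromℕℚ (suc K)
      hK⁺ n = ℚ.≤-trans (hK n) (fromℕℚ-mono (ℕ.n≤1+n K))
      0≤C : 0ℚ ℚ.≤ C
      0≤C = 0≤fromℕℚ (2 ℕ.* tailConst (suc K))

      ordered : ∀ m d → L ℕ.≤ m → ∣ cosPartial (m ℕ.+ d) (s (m ℕ.+ d)) ℚ.- cosPartial m (s m) ∣ ℚ.< ε
      ordered m d L≤m = begin-strict
        ∣ cosPartial n (s n) ℚ.- cosPartial m (s m) ∣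
          ≤⟨ ∣∣-tri (cosPartial n (s n)) (cosPartial m (s n)) (cosPartial m (s m)) ⟩
        ∣ cosPartial n (s n) ℚ.- cosPartial m (s n) ∣ ℚ.+ ∣ cosPartial m (s n) ℚ.- cosPartial m (s m) ∣
          ≤⟨ ℚ.+-mono-≤ (cosPartial-tail (suc K) (s n) (hK⁺ n) m d) (cosPartial-Lipschitz (suc K) K (s n) (s m) ℕ.≤-refl (hK n) (hK m) m) ⟩
        C ℚ.* 2^- m ℚ.+ C ℚ.* ∣ s n ℚ.- s m ∣
          ≤⟨ ℚ.+-mono-≤ (ℚ.*-monoˡ-≤-nonNeg C {{ℚ.nonNegative 0≤C}} 2^-m≤2^-M) (ℚ.*-monoˡ-≤-nonNeg C {{ℚ.nonNegative 0≤C}} (ℚ.<⇒≤ (close n m (ℕ.≤-trans N≤m (ℕ.m≤m+n m d)) N≤m))) ⟩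
        C ℚ.* 2^- M ℚ.+ C ℚ.* η
          <⟨ ℚ.+-mono-< C2^-M<½ε Cη<½ε ⟩
        ½ ℚ.* ε ℚ.+ ½ ℚ.* ε
          ≡⟨ halves ε ⟩
        ε ∎
        where
        n : ℕ
        n = m ℕ.+ d
        N≤m : N ℕ.≤ m
        N≤m = ℕ.m⊔n≤o⇒n≤o M N L≤m
        M≤m : M ℕ.≤ m
        M≤m = ℕ.m⊔n≤o⇒m≤o M N L≤m
        2^-m≤2^-M : 2^- m ℚ.≤ 2^- M
        2^-m≤2^-M = subst (λ z → 2^- z ℚ.≤ 2^- M) (ℕ.m+[n∸m]≡n M≤m) (2^-anti M (m ℕ.∸ M))

      goal : ∀ m n → L ℕ.≤ m → L ℕ.≤ n → ∣ cosPartial m (s m) ℚ.- cosPartial n (s n) ∣ ℚ.< ε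
      goal m n L≤m L≤n with ℕ.≤-total m n
      ... | inj₁ m≤n = subst (λ k → ∣ cosPartial m (s m) ℚ.- cosPartial k (s k) ∣ ℚ.< ε) (ℕ.m+[n∸m]≡n m≤n)
            (subst (ℚ._< ε) (∣-∣-comm _ (cosPartial m (s m))) (ordered m (n ℕ.∸ m) L≤m))
      ... | inj₂ n≤m = subst (λ k → ∣ cosPartial k (s k) ℚ.- cosPartial n (s n) ∣ ℚ.< ε) (ℕ.m+[n∸m]≡n n≤m)
            (ordered n (m ℕ.∸ n) L≤n)

-- The power series converges uniformly on bounded sets, so its sum at
-- x = lim qₙ is the limit of the diagonal: the n-th partial sum at qₙ.
cos : ℝ → ℝ
cos x = mkℝ (λ n → cosPartial n (seq x n)) (cos-cauchy (seq x) (proj₁ (bounded x)) (proj₂ (bounded x)) (cauchy x))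

-- π is characterised by: π/2 is the least positive zero of the cosine.
record IsPi (π : ℝ) : Set where
  ½π : ℝ
  ½π = fromℚ ½ * π
  field
    positive : 0ℝ < ½π
    zero-½π  : cos ½π ≃ 0ℝ
    least    : ∀ x → 0ℝ < x → x < ½π → ¬ (cos x ≃ 0ℝ)

-- The length t ≥ 1 is suc t-1, and the indices 1, …, t are shifted to 0, …, t-1.
record Pattern : Set where
  field
    t-1  : ℕ
    r    : Vector ℤ (suc t-1)
    h    : Vector ℕ (suc t-1)
    r≢0  : ∀ j → r j ≢ 0ℤ
    r₁≡1 : r Fin.zero ≡ 1ℤ
open Pattern public

∏r : Pattern → ℤ
∏r P = foldr ℤ._*_ 1ℤ (r P)

H : Pattern → ℕ
H P = foldr ℕ._+_ 0 (h P)

B : Pattern → ℕ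
B P = foldr ℕ._+_ 0 (λ j → h P j ℕ.* ℤ.∣ r P j ∣)

-- A finite sum of terms c u^e with c, e ∈ ℤ, listed as pairs (c , e); exponents may repeat.
Laurent : Set
Laurent = List (ℤ × ℤ)

coeffAt : ℤ → Laurent → ℤ
coeffAt M []            = 0ℤ
coeffAt M ((c , e) ∷ p) with e ℤ.≟ M
... | yes _ = c ℤ.+ coeffAt M p
... | no  _ = coeffAt M p

1ᴸ : Laurent
1ᴸ = (1ℤ , 0ℤ) ∷ []

infixl 7 _*ᴸ_
infixr 8 _^ᴸ_

_*ᴸ_ : Laurent → Laurent → Laurent
_*ᴸ_ = List.cartesianProductWith λ { (c , e) (c′ , e′) → c ℤ.* c′ , e ℤ.+ e′ }

_^ᴸ_ : Laurent → ℕ → Laurent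
p ^ᴸ zero  = 1ᴸ
p ^ᴸ suc n = p *ᴸ p ^ᴸ n

-- ∏ⱼ (u^rⱼ + u^-rⱼ)^hⱼ
patternLaurent : Pattern → Laurent
patternLaurent P = foldr _*ᴸ_ 1ᴸ λ j → ((1ℤ , r P j) ∷ (1ℤ , ℤ.- r P j) ∷ []) ^ᴸ h P j

S : ℤ → Pattern → ℤ
S M P = coeffAt M (patternLaurent P)

-- Ω_n = {1, …, n-1}; the element i stands for the number suc (toℕ i).
Ω : ℕ → Set
Ω n = Fin (ℕ.pred n)

⟦_⟧Ω : ∀ {m} → Fin m → ℕ
⟦ k ⟧Ω = suc (toℕ k)

private
  ⟦⟧Ω<n : ∀ n .{{_ : ℕ.NonZero n}} (k : Ω n) → ⟦ k ⟧Ω ℕ.< n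
  ⟦⟧Ω<n (suc n) k = s≤s (Fin.toℕ<n k)

  toΩ : ∀ n {m} → m ≢ 0 → m ℕ.< n → Σ[ k ∈ Ω n ] ⟦ k ⟧Ω ≡ m
  toΩ n       {zero}  m≢0 _         = ⊥-elim (m≢0 refl)
  toΩ (suc n) {suc m} _   (s≤s m<n) = Fin.fromℕ< m<n , cong suc (Fin.toℕ-fromℕ< m<n)

module _ (n : ℕ) .{{_ : ℕ.NonZero n}} (r : ℤ) (coprime : ℤ.gcd r (+ n) ≡ 1ℤ) where
  private
    residue : Ω n → ℕ
    residue k = (r ℤ.* + ⟦ k ⟧Ω) ℤ.%ℕ n

    residue≢0 : ∀ k → residue k ≢ 0
    residue≢0 k eq = ℕ.<⇒≱ (⟦⟧Ω<n n k) (ℕ.∣⇒≤ n∣k)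
      where
      q : ℤ
      q = (r ℤ.* + ⟦ k ⟧Ω) ℤ./ℕ n
      n∣rk : + n ℤ.∣ r ℤ.* + ⟦ k ⟧Ω
      n∣rk = ℤS.∣⇒∣ᵤ (ℤS.divides q
        (trans (ℤ.a≡a%ℕn+[a/ℕn]*n (r ℤ.* + ⟦ k ⟧Ω) n)
          (trans (cong (λ z → + z ℤ.+ q ℤ.* + n) eq) (ℤ.+-identityˡ (q ℤ.* + n)))))
      n∣k : n ℕ.∣ ⟦ k ⟧Ω
      n∣k = ℤC.coprime-divisor (+ n) r (+ ⟦ k ⟧Ω) (ℤC.sym {r} {+ n} (ℕC.gcd≡1⇒coprime (ℤ.+-injective coprime))) n∣rk

    σ′ : (k : Ω n) → Σ[ l ∈ Ω n ] ⟦ l ⟧Ω ≡ residue k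
    σ′ k = toΩ n (residue≢0 k) (ℤ.n%ℕd<d (r ℤ.* + ⟦ k ⟧Ω) n)

  σ : Ω n → Ω n
  σ k = proj₁ (σ′ k)

  σ-spec : ∀ k → ⟦ σ k ⟧Ω ≡ (r ℤ.* + ⟦ k ⟧Ω) ℤ.%ℕ n
  σ-spec k = proj₂ (σ′ k)

private
  factor∣∏ : ∀ {m} (v : Vector ℤ m) j → v j ℤ.∣ foldr ℤ._*_ 1ℤ v
  factor∣∏ v Fin.zero    = subst (ℤ.∣ v Fin.zero ∣ ℕ.∣_) (sym (ℤ.abs-* (v Fin.zero) _)) (ℕ.m∣m*n _)
  factor∣∏ v (Fin.suc j) = subst (ℤ.∣ v (Fin.suc j) ∣ ℕ.∣_) (sym (ℤ.abs-* (v Fin.zero) _))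
    (ℕ.∣-trans (factor∣∏ (λ i → v (Fin.suc i)) j) (ℕ.n∣m*n ℤ.∣ v Fin.zero ∣))

Admissible : Pattern → ℕ → Set
Admissible P n = ℤ.gcd (+ n) (∏r P) ≡ 1ℤ

admissible-r : ∀ P n → Admissible P n → ∀ j → ℤ.gcd (r P j) (+ n) ≡ 1ℤ
admissible-r P n adm j = cong +_ (ℕC.coprime⇒gcd≡1 λ (d∣rⱼ , d∣n) →
  ℕC.gcd≡1⇒coprime (ℤ.+-injective adm) (d∣n , ℕ.∣-trans d∣rⱼ (factor∣∏ (r P) j)))

-- Elements of ℚ[x₁,…,x_{n-1}] are written as ring expressions with
-- rational constants; the variable x_k is Ι k.
module _ (P : Pattern) (n : ℕ) .{{n>1 : NonTrivial n}} (adm : Admissible P n) where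
  private
    instance
      n≢0 : ℕ.NonZero n
      n≢0 = ℕ.nonTrivial⇒nonZero n

  T : Expr ℚ (ℕ.pred n)
  T = foldr _⊕_ (Κ 0ℚ) λ k →
      foldr _⊗_ (Κ 1ℚ) λ j →
        (Κ (+ 2 / 1) ⊗ Ι (σ n (r P j) (admissible-r P n adm j) k)) ⊛ h P j

open Eval ℝ-rawRing fromℚ public using () renaming (⟦_⟧ to evalℝ)

module _ (π : ℝ) (n : ℕ) .{{n>1 : NonTrivial n}} where
  private
    instance
      n≢0 : ℕ.NonZero n
      n≢0 = ℕ.nonTrivial⇒nonZero n

  -- cos(2πk/n), with π a real number satisfying IsPi
  α : Ω n → ℝ
  α k = cos (fromℚ (+ (2 ℕ.* ⟦ k ⟧Ω) / n) * π)

  αs : Vec ℝ (ℕ.pred n)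
  αs = Vec.tabulate α

{-# OPTIONS --safe #-}
-- The cosine addition theorem holds term by term: xᵐ/m! solves ∂f = x f, so by the
-- Leibniz rule the Cauchy product of the series of x and y is the series of x + y, and
-- its even part is the product formula 2 cos x cos y = cos(x + y) + cos(x − y).
-- For C k = cos(2πk/n) this formula and cos(π/2) = 0 give periodicity, and leastness of
-- π/2 gives C e ≠ 1 for 0 < |e| < n. Since C e · C(ek) is the mean of C(e(k+1)) and
-- C(e(k−1)), the sum s of C(ek) over a period satisfies C e · s = s, hence vanishes for
-- such e. Finally u^r + u^-r acts on the functions e ↦ C(ek) as multiplication by
-- 2C(rk), so the pattern sum, with k = 0 included, is ∑ₖ of the Laurent polynomial with
-- u^e replaced by C(ek); only its constant coefficient survives, n times.
module Submission where

open import Defs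
open RationalEstimates
open PowerSeriesEstimates
open import Data.Nat.Base using (ℕ; NonTrivial)
open import Data.Integer.Base as ℤ using (ℤ; +_; -[1+_]; 0ℤ; 1ℤ; -1ℤ)
open import Data.Nat.Base as ℕ using (zero; suc; z≤n; s≤s; _!)
open import Data.Product.Base using (_×_; ∃-syntax; _,_; proj₁; proj₂)

open import Algebra.Bundles using (CommutativeRing; RawRing)
import Algebra.Definitions.RawSemiring as RawSemiringDefs
import Algebra.Properties.CommutativeMonoid.Sum as MonoidSum
import Algebra.Properties.Semiring.Sum as SemiringSum
import Algebra.Solver.Ring as RingSolver
import Algebra.Solver.Ring.AlmostCommutativeRing as ACR
open import Algebra.Structures using (IsCommutativeRing)
open import Data.Fin.Base as Fin using (toℕ)
import Data.Integer.DivMod as ℤ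
import Data.Integer.GCD as ℤ
import Data.Integer.Properties as ℤ
open import Data.Integer.Tactic.RingSolver using (solve-∀)
open import Data.List.Base as List using ([]; _∷_)
open import Data.List.Relation.Unary.All as All using (All; []; _∷_)
import Data.List.Relation.Unary.All.Properties as All
open import Data.Maybe.Base using (Maybe; just; nothing)
import Data.Nat.Properties as ℕ
open import Data.Rational.Base as ℚ using (ℚ; 0ℚ; 1ℚ; ½; ∣_∣; _/_)
import Data.Rational.Properties as ℚ
open import Data.Rational.Solver using (module +-*-Solver)
import Data.Rational.Unnormalised.Base as ℚᵘ
import Data.Rational.Unnormalised.Properties as ℚᵘ
import Data.Vec.Base as Vec
open import Data.Vec.Functional using (Vector; foldr)
import Data.Vec.Properties as Vec
open import Function.Base using (_∘_)
open import Level using (0ℓ)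
open import Relation.Binary.Definitions using (tri<; tri≈; tri>)
open import Relation.Binary.PropositionalEquality
import Relation.Binary.Reasoning.Setoid as SetoidReasoning
open import Relation.Nullary using (¬_; yes; no)
open import Relation.Nullary.Negation using (contradiction)
import Tactic.RingSolver.Core.Expression as Expr

open RawSemiringDefs ℚ.+-*-rawSemiring using () renaming (_^_ to infixr 8 _^ℚ_)
open +-*-Solver using (solve; _:+_; _:*_; :-_; _:-_; _:=_; con)

-- The product formula is the only functional equation of the cosine in use; the addition theorem
-- proper would need the sine. It holds coefficientwise for the power series, but not for partial
-- sums of equal length: a product of two sums of N terms runs over a square of index pairs, the
-- Cauchy product over the triangle i + j < N. The difference consists of terms of one series times
-- tails of the other and is O(2^-N) on bounded arguments. As `cos` is read on the diagonal, this
-- estimate at n terms is directly the product formula in `ℝ`. `IsPi` speaks of zeros of the cosine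
-- up to π/2, hence the grid jπ/2n: π/2 is its point n, 2π/n is four steps, a full turn 4n steps. On
-- the grid the argument is algebraic and is carried out over an abstract commutative ring under ℚ,
-- which keeps Cauchy sequences out of the computations; the one property beyond the ring laws is
-- that a factor different from 0 can be cancelled. The hypothesis B < n ensures that 0 is the only
-- multiple of n among the exponents.

2ℚ : ℚ
2ℚ = 1ℚ ℚ.+ 1ℚ

-- Cauchy products of sequences

infixl 7 _⋆_
-- The sum of f i · g (m - i) over i ≤ m. Only f is shifted in the recursion, so laws are proved by
-- induction on m for all f, without subtraction of indices.
_⋆_ : (ℕ → ℚ) → (ℕ → ℚ) → ℕ → ℚ
(f ⋆ g) zero    = f 0 ℚ.* g 0
(f ⋆ g) (suc m) = f 0 ℚ.* g (suc m) ℚ.+ ((f ∘ suc) ⋆ g) m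

⋆-cong : ∀ {f f′ g g′} → (∀ i → f i ≡ f′ i) → (∀ i → g i ≡ g′ i) → ∀ m → (f ⋆ g) m ≡ (f′ ⋆ g′) m
⋆-cong p q zero    = cong₂ ℚ._*_ (p 0) (q 0)
⋆-cong p q (suc m) = cong₂ ℚ._+_ (cong₂ ℚ._*_ (p 0) (q (suc m))) (⋆-cong (p ∘ suc) q m)

⋆-distribʳ-+ : ∀ g f f′ m → ((λ i → f i ℚ.+ f′ i) ⋆ g) m ≡ (f ⋆ g) m ℚ.+ (f′ ⋆ g) m
⋆-distribʳ-+ g f f′ zero    = ℚ.*-distribʳ-+ (g 0) (f 0) (f′ 0)
⋆-distribʳ-+ g f f′ (suc m) = trans
  (cong ((f 0 ℚ.+ f′ 0) ℚ.* g (suc m) ℚ.+_) (⋆-distribʳ-+ g (f ∘ suc) (f′ ∘ suc) m))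
  (solve 5 (λ a b c u v → (a :+ b) :* c :+ (u :+ v) := (a :* c :+ u) :+ (b :* c :+ v)) refl
    (f 0) (f′ 0) (g (suc m)) (((f ∘ suc) ⋆ g) m) (((f′ ∘ suc) ⋆ g) m))

⋆-distribˡ-+ : ∀ f g g′ m → (f ⋆ (λ i → g i ℚ.+ g′ i)) m ≡ (f ⋆ g) m ℚ.+ (f ⋆ g′) m
⋆-distribˡ-+ f g g′ zero    = ℚ.*-distribˡ-+ (f 0) (g 0) (g′ 0)
⋆-distribˡ-+ f g g′ (suc m) = trans
  (cong (f 0 ℚ.* (g (suc m) ℚ.+ g′ (suc m)) ℚ.+_) (⋆-distribˡ-+ (f ∘ suc) g g′ m))
  (solve 5 (λ a b c u v → a :* (b :+ c) :+ (u :+ v) := (a :* b :+ u) :+ (a :* c :+ v)) refl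
    (f 0) (g (suc m)) (g′ (suc m)) (((f ∘ suc) ⋆ g) m) (((f ∘ suc) ⋆ g′) m))

⋆-scaleˡ : ∀ c f g m → ((λ i → c ℚ.* f i) ⋆ g) m ≡ c ℚ.* (f ⋆ g) m
⋆-scaleˡ c f g zero    = ℚ.*-assoc c (f 0) (g 0)
⋆-scaleˡ c f g (suc m) = trans
  (cong (c ℚ.* f 0 ℚ.* g (suc m) ℚ.+_) (⋆-scaleˡ c (f ∘ suc) g m))
  (solve 4 (λ c a b u → c :* a :* b :+ c :* u := c :* (a :* b :+ u)) refl c (f 0) (g (suc m)) (((f ∘ suc) ⋆ g) m))

⋆-scaleʳ : ∀ c f g m → (f ⋆ (λ i → c ℚ.* g i)) m ≡ c ℚ.* (f ⋆ g) m
⋆-scaleʳ c f g zero    = solve 3 (λ c a b → a :* (c :* b) := c :* (a :* b)) refl c (f 0) (g 0)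
⋆-scaleʳ c f g (suc m) = trans
  (cong (f 0 ℚ.* (c ℚ.* g (suc m)) ℚ.+_) (⋆-scaleʳ c (f ∘ suc) g m))
  (solve 4 (λ c a b u → a :* (c :* b) :+ c :* u := c :* (a :* b :+ u)) refl c (f 0) (g (suc m)) (((f ∘ suc) ⋆ g) m))

-- The formal derivative of the power series with coefficients f.
∂ : (ℕ → ℚ) → ℕ → ℚ
∂ f m = fromℕℚ (suc m) ℚ.* f (suc m)

-- With F = f 0 + t F⁺ this is the coefficient of tᵐ⁺¹ in F′ = F⁺ + t F⁺′.
∂-∘suc : ∀ f m → ∂ f (suc m) ≡ ∂ (f ∘ suc) m ℚ.+ f (suc (suc m))
∂-∘suc f m = trans (cong (ℚ._* f (suc (suc m))) (fromℕℚ-suc (suc m)))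
  (solve 2 (λ a b → (con 1ℚ :+ a) :* b := a :* b :+ b) refl (fromℕℚ (suc m)) (f (suc (suc m))))

-- Induction with f replaced by its shift f⁺. On the f 0 term the weight m + 2 turns g into `∂ g`;
-- on the rest it is split as 1 + (m + 1). The second part is the induction hypothesis, the first
-- supplies the head of `∂ f ⋆ g` and the surplus in `∂-∘suc`.
leibniz : ∀ f g m → ∂ (f ⋆ g) m ≡ (∂ f ⋆ g) m ℚ.+ (f ⋆ ∂ g) m
leibniz f g zero rewrite fromℕℚ-1 =
  solve 4 (λ a b c d → con 1ℚ :* (a :* b :+ c :* d) := con 1ℚ :* c :* d :+ a :* (con 1ℚ :* b)) refl (f 0) (g 1) (f 1) (g 0)
leibniz f g (suc m) = begin
  fromℕℚ (suc (suc m)) ℚ.* (f 0 ℚ.* g (suc (suc m)) ℚ.+ (f⁺ ⋆ g) (suc m))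
    ≡⟨ ℚ.*-distribˡ-+ (fromℕℚ (suc (suc m))) (f 0 ℚ.* g (suc (suc m))) ((f⁺ ⋆ g) (suc m)) ⟩
  fromℕℚ (suc (suc m)) ℚ.* (f 0 ℚ.* g (suc (suc m))) ℚ.+ fromℕℚ (suc (suc m)) ℚ.* (f⁺ ⋆ g) (suc m)
    ≡⟨ cong₂ ℚ._+_
         (solve 3 (λ n a b → n :* (a :* b) := a :* (n :* b)) refl (fromℕℚ (suc (suc m))) (f 0) (g (suc (suc m))))
         (trans (cong (ℚ._* (f⁺ ⋆ g) (suc m)) (fromℕℚ-suc (suc m)))
           (solve 2 (λ n a → (con 1ℚ :+ n) :* a := a :+ n :* a) refl (fromℕℚ (suc m)) ((f⁺ ⋆ g) (suc m)))) ⟩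
  f 0 ℚ.* ∂ g (suc m) ℚ.+ ((f⁺ ⋆ g) (suc m) ℚ.+ ∂ (f⁺ ⋆ g) m)
    ≡⟨ cong (λ z → f 0 ℚ.* ∂ g (suc m) ℚ.+ ((f⁺ ⋆ g) (suc m) ℚ.+ z)) (leibniz f⁺ g m) ⟩
  f 0 ℚ.* ∂ g (suc m) ℚ.+ ((f 1 ℚ.* g (suc m) ℚ.+ (f⁺ ∘ suc ⋆ g) m) ℚ.+ ((∂ f⁺ ⋆ g) m ℚ.+ (f⁺ ⋆ ∂ g) m))
    ≡⟨ solve 5 (λ p q r s t → p :+ ((q :+ r) :+ (s :+ t)) := (con 1ℚ :* q :+ (s :+ r)) :+ (p :+ t)) refl
         (f 0 ℚ.* ∂ g (suc m)) (f 1 ℚ.* g (suc m)) ((f⁺ ∘ suc ⋆ g) m) ((∂ f⁺ ⋆ g) m) ((f⁺ ⋆ ∂ g) m) ⟩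
  (1ℚ ℚ.* (f 1 ℚ.* g (suc m)) ℚ.+ ((∂ f⁺ ⋆ g) m ℚ.+ (f⁺ ∘ suc ⋆ g) m)) ℚ.+ (f ⋆ ∂ g) (suc m)
    ≡⟨ cong (ℚ._+ (f ⋆ ∂ g) (suc m)) (cong₂ ℚ._+_
         (trans (sym (ℚ.*-assoc 1ℚ (f 1) (g (suc m)))) (cong (λ z → z ℚ.* f 1 ℚ.* g (suc m)) (sym fromℕℚ-1)))
         (trans (sym (⋆-distribʳ-+ g (∂ f⁺) (f⁺ ∘ suc) m)) (⋆-cong (λ i → sym (∂-∘suc f i)) (λ _ → refl) m))) ⟩
  (∂ f ⋆ g) (suc m) ℚ.+ (f ⋆ ∂ g) (suc m) ∎
  where
  open ≡-Reasoning
  f⁺ = f ∘ suc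

-- Unlike 2 · k, this exposes two successors per step, so `_⋆_` unfolds along it.
double : ℕ → ℕ
double zero    = zero
double (suc k) = suc (suc (double k))

double≡2* : ∀ k → double k ≡ 2 ℕ.* k
double≡2* zero    = refl
double≡2* (suc k) = trans (cong (suc ∘ suc) (double≡2* k)) (sym (ℕ.*-suc 2 k))

⋆-even : ∀ f g → (∀ i → g (suc (double i)) ≡ 0ℚ) → ∀ k → (f ⋆ g) (double k) ≡ ((f ∘ double) ⋆ (g ∘ double)) k
⋆-even f g odd zero    = refl
⋆-even f g odd (suc k) = begin
  a ℚ.+ (f 1 ℚ.* g (suc (double k)) ℚ.+ (f ∘ suc ∘ suc ⋆ g) (double k))
    ≡⟨ cong₂ (λ u v → a ℚ.+ (f 1 ℚ.* u ℚ.+ v)) (odd k) (⋆-even (f ∘ suc ∘ suc) g odd k) ⟩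
  a ℚ.+ (f 1 ℚ.* 0ℚ ℚ.+ ((f ∘ suc ∘ suc ∘ double) ⋆ (g ∘ double)) k)
    ≡⟨ solve 3 (λ a b c → a :+ (b :* con 0ℚ :+ c) := a :+ c) refl a (f 1) _ ⟩
  a ℚ.+ ((f ∘ suc ∘ suc ∘ double) ⋆ (g ∘ double)) k ∎
  where
  open ≡-Reasoning
  a = f 0 ℚ.* g (double (suc k))

-- The addition theorems, term by term

expTerm : ℚ → ℕ → ℚ
expTerm x m = 1/! m ℚ.* x ^ℚ m

∂-expTerm : ∀ x m → ∂ (expTerm x) m ≡ x ℚ.* expTerm x m
∂-expTerm x m = begin
  N ℚ.* (1/! (suc m) ℚ.* (x ℚ.* x ^ℚ m))
    ≡⟨ cong (λ z → z ℚ.* (1/! (suc m) ℚ.* (x ℚ.* x ^ℚ m))) (sym (trans (ℚ.*-comm _ N) (ℚ.*-identityʳ N))) ⟩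
  1ℚ ℚ.* N ℚ.* (1/! (suc m) ℚ.* (x ℚ.* x ^ℚ m))
    ≡⟨ cong (λ z → z ℚ.* N ℚ.* (1/! (suc m) ℚ.* (x ℚ.* x ^ℚ m))) (sym (1/* (m !) {{m ℕ.!≢0}})) ⟩
  1/! m ℚ.* fromℕℚ (m !) ℚ.* N ℚ.* (1/! (suc m) ℚ.* (x ℚ.* x ^ℚ m))
    ≡⟨ solve 6 (λ i f n j x p → i :* f :* n :* (j :* (x :* p)) := (j :* (n :* f)) :* (x :* (i :* p))) refl
         (1/! m) (fromℕℚ (m !)) N (1/! (suc m)) x (x ^ℚ m) ⟩
  (1/! (suc m) ℚ.* (N ℚ.* fromℕℚ (m !))) ℚ.* (x ℚ.* expTerm x m)
    ≡⟨ cong (λ z → (1/! (suc m) ℚ.* z) ℚ.* (x ℚ.* expTerm x m)) (sym (fromℕℚ-* (suc m) (m !))) ⟩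
  (1/! (suc m) ℚ.* fromℕℚ (suc m !)) ℚ.* (x ℚ.* expTerm x m)
    ≡⟨ cong (ℚ._* (x ℚ.* expTerm x m)) (1/* (suc m !) {{suc m ℕ.!≢0}}) ⟩
  1ℚ ℚ.* (x ℚ.* expTerm x m)
    ≡⟨ ℚ.*-identityˡ _ ⟩
  x ℚ.* expTerm x m ∎
  where
  open ≡-Reasoning
  N = fromℕℚ (suc m)

fromℕℚ-cancelˡ : ∀ n .{{_ : ℕ.NonZero n}} {p q} → fromℕℚ n ℚ.* p ≡ fromℕℚ n ℚ.* q → p ≡ q
fromℕℚ-cancelˡ n {p} {q} eq = begin
  p                                  ≡⟨ unit p ⟨
  (+ 1 / n) ℚ.* (fromℕℚ n ℚ.* p)     ≡⟨ cong ((+ 1 / n) ℚ.*_) eq ⟩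
  (+ 1 / n) ℚ.* (fromℕℚ n ℚ.* q)     ≡⟨ unit q ⟩
  q                                  ∎
  where
  open ≡-Reasoning
  unit : ∀ p → (+ 1 / n) ℚ.* (fromℕℚ n ℚ.* p) ≡ p
  unit p = trans (sym (ℚ.*-assoc (+ 1 / n) (fromℕℚ n) p)) (trans (cong (ℚ._* p) (1/* n)) (ℚ.*-identityˡ p))

-- Both sides solve ∂F = (x + y) F with F 0 = 1, and since the factor m + 1 can be cancelled, the
-- equation determines F (m + 1) from F m. This takes the place of the binomial theorem.
expTerm-+ : ∀ x y m → (expTerm x ⋆ expTerm y) m ≡ expTerm (x ℚ.+ y) m
expTerm-+ x y zero    = refl
expTerm-+ x y (suc m) = fromℕℚ-cancelˡ (suc m) (begin
  ∂ (expTerm x ⋆ expTerm y) m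
    ≡⟨ leibniz (expTerm x) (expTerm y) m ⟩
  (∂ (expTerm x) ⋆ expTerm y) m ℚ.+ (expTerm x ⋆ ∂ (expTerm y)) m
    ≡⟨ cong₂ ℚ._+_
         (trans (⋆-cong (∂-expTerm x) (λ _ → refl) m) (⋆-scaleˡ x (expTerm x) (expTerm y) m))
         (trans (⋆-cong (λ _ → refl) (∂-expTerm y) m) (⋆-scaleʳ y (expTerm x) (expTerm y) m)) ⟩
  x ℚ.* E ℚ.+ y ℚ.* E
    ≡⟨ ℚ.*-distribʳ-+ E x y ⟨
  (x ℚ.+ y) ℚ.* E
    ≡⟨ cong ((x ℚ.+ y) ℚ.*_) (expTerm-+ x y m) ⟩
  (x ℚ.+ y) ℚ.* expTerm (x ℚ.+ y) m
    ≡⟨ ∂-expTerm (x ℚ.+ y) m ⟨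
  ∂ (expTerm (x ℚ.+ y)) m ∎)
  where
  open ≡-Reasoning
  E = (expTerm x ⋆ expTerm y) m

^-neg-even : ∀ x i → (ℚ.- x) ^ℚ double i ≡ x ^ℚ double i
^-neg-even x zero    = refl
^-neg-even x (suc i) = trans (cong (λ z → ℚ.- x ℚ.* (ℚ.- x ℚ.* z)) (^-neg-even x i))
  (solve 2 (λ x p → :- x :* (:- x :* p) := x :* (x :* p)) refl x (x ^ℚ double i))

expTerm-neg-even : ∀ x i → expTerm (ℚ.- x) (double i) ≡ expTerm x (double i)
expTerm-neg-even x i = cong (1/! (double i) ℚ.*_) (^-neg-even x i)

expTerm-neg-odd : ∀ x i → expTerm x (suc (double i)) ℚ.+ expTerm (ℚ.- x) (suc (double i)) ≡ 0ℚ
expTerm-neg-odd x i = trans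
  (cong (λ z → expTerm x (suc (double i)) ℚ.+ 1/! (suc (double i)) ℚ.* (ℚ.- x ℚ.* z)) (^-neg-even x i))
  (solve 3 (λ c x p → c :* (x :* p) :+ c :* (:- x :* p) := con 0ℚ) refl (1/! (suc (double i))) x (x ^ℚ double i))

sign : ℕ → ℚ
sign zero    = 1ℚ
sign (suc k) = ℚ.- sign k

-- The sign (-1)ⁱ(-1)ʲ depends on i + j only: substituting -t for t is multiplicative on power
-- series.
⋆-sign : ∀ f g k → ((λ i → sign i ℚ.* f i) ⋆ (λ i → sign i ℚ.* g i)) k ≡ sign k ℚ.* (f ⋆ g) k
⋆-sign f g zero    = solve 2 (λ a b → con 1ℚ :* a :* (con 1ℚ :* b) := con 1ℚ :* (a :* b)) refl (f 0) (g 0)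
⋆-sign f g (suc k) = begin
  1ℚ ℚ.* f 0 ℚ.* (ℚ.- sign k ℚ.* g (suc k)) ℚ.+ ((λ i → ℚ.- sign i ℚ.* f (suc i)) ⋆ sg) k
    ≡⟨ cong (1ℚ ℚ.* f 0 ℚ.* (ℚ.- sign k ℚ.* g (suc k)) ℚ.+_) (begin
         ((λ i → ℚ.- sign i ℚ.* f (suc i)) ⋆ sg) k
           ≡⟨ ⋆-cong (λ i → solve 2 (λ s a → :- s :* a := :- con 1ℚ :* (s :* a)) refl (sign i) (f (suc i))) (λ _ → refl) k ⟩
         ((λ i → ℚ.- 1ℚ ℚ.* (sign i ℚ.* f (suc i))) ⋆ sg) k
           ≡⟨ ⋆-scaleˡ (ℚ.- 1ℚ) (λ i → sign i ℚ.* f (suc i)) sg k ⟩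
         ℚ.- 1ℚ ℚ.* ((λ i → sign i ℚ.* f (suc i)) ⋆ sg) k
           ≡⟨ cong (ℚ.- 1ℚ ℚ.*_) (⋆-sign (f ∘ suc) g k) ⟩
         ℚ.- 1ℚ ℚ.* (sign k ℚ.* (f ∘ suc ⋆ g) k) ∎) ⟩
  1ℚ ℚ.* f 0 ℚ.* (ℚ.- sign k ℚ.* g (suc k)) ℚ.+ ℚ.- 1ℚ ℚ.* (sign k ℚ.* (f ∘ suc ⋆ g) k)
    ≡⟨ solve 4 (λ a s b c → con 1ℚ :* a :* (:- s :* b) :+ :- con 1ℚ :* (s :* c) := :- s :* (a :* b :+ c)) refl
         (f 0) (sign k) (g (suc k)) ((f ∘ suc ⋆ g) k) ⟩
  ℚ.- sign k ℚ.* (f ⋆ g) (suc k) ∎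
  where
  open ≡-Reasoning
  sg = λ i → sign i ℚ.* g i

/≡*1/ : ∀ i d .{{_ : ℕ.NonZero d}} → i / d ≡ (i / 1) ℚ.* (+ 1 / d)
/≡*1/ i (suc d) = ℚ.toℚᵘ-injective (begin
  ℚ.toℚᵘ (i / suc d)                           ≈⟨ ℚ.toℚᵘ-fromℚᵘ (ℚᵘ.mkℚᵘ i d) ⟩
  ℚᵘ.mkℚᵘ i d                                  ≈⟨ ℚᵘ.*≡* (cong₂ ℤ._*_ (sym (ℤ.*-identityʳ i)) (cong +_ (ℕ.+-identityʳ (suc d)))) ⟩
  ℚᵘ.mkℚᵘ i 0 ℚᵘ.* ℚᵘ.mkℚᵘ (+ 1) d             ≈⟨ ℚᵘ.*-cong (ℚ.toℚᵘ-fromℚᵘ (ℚᵘ.mkℚᵘ i 0)) (ℚ.toℚᵘ-fromℚᵘ (ℚᵘ.mkℚᵘ (+ 1) d)) ⟨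
  ℚ.toℚᵘ (i / 1) ℚᵘ.* ℚ.toℚᵘ (+ 1 / suc d)     ≈⟨ ℚ.toℚᵘ-homo-* (i / 1) (+ 1 / suc d) ⟨
  ℚ.toℚᵘ ((i / 1) ℚ.* (+ 1 / suc d))           ∎)
  where open ℚᵘ.≃-Reasoning

neg-/1 : ∀ i → (ℤ.- i) / 1 ≡ ℚ.- (i / 1)
neg-/1 i = ℚ.toℚᵘ-injective (begin
  ℚ.toℚᵘ ((ℤ.- i) / 1)      ≈⟨ toℚᵘ-/1 (ℤ.- i) ⟩
  ℚᵘ.- ℚᵘ.mkℚᵘ i 0          ≈⟨ ℚᵘ.-‿cong (toℚᵘ-/1 i) ⟨
  ℚᵘ.- ℚ.toℚᵘ (i / 1)       ≈⟨ ℚ.toℚᵘ-homo‿- (i / 1) ⟨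
  ℚ.toℚᵘ (ℚ.- (i / 1))      ∎)
  where open ℚᵘ.≃-Reasoning

sign≡-1^ : ∀ k → (-1ℤ ℤ.^ k) / 1 ≡ sign k
sign≡-1^ zero    = refl
sign≡-1^ (suc k) = trans (cong (_/ 1) (ℤ.-1*i≡-i (-1ℤ ℤ.^ k))) (trans (neg-/1 (-1ℤ ℤ.^ k)) (cong ℚ.-_ (sign≡-1^ k)))

cosTerm≡ : ∀ x k → cosTerm x k ≡ sign k ℚ.* expTerm x (double k)
cosTerm≡ x k = begin
  cosTerm x k                                                 ≡⟨ cong (ℚ._* x ^ℚ (2 ℕ.* k)) (/≡*1/ (-1ℤ ℤ.^ k) ((2 ℕ.* k) !) {{(2 ℕ.* k) ℕ.!≢0}}) ⟩
  ((-1ℤ ℤ.^ k) / 1) ℚ.* 1/! (2 ℕ.* k) ℚ.* x ^ℚ (2 ℕ.* k)      ≡⟨ ℚ.*-assoc ((-1ℤ ℤ.^ k) / 1) _ _ ⟩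
  ((-1ℤ ℤ.^ k) / 1) ℚ.* expTerm x (2 ℕ.* k)                   ≡⟨ cong₂ (λ s m → s ℚ.* expTerm x m) (sign≡-1^ k) (sym (double≡2* k)) ⟩
  sign k ℚ.* expTerm x (double k)                             ∎
  where open ≡-Reasoning

-- Adding the series of y and -y cancels its odd terms, so at even degree only the even terms of the
-- first factor meet a nonzero partner. The odd parts, which would give the sine, drop out.
cosTerm-product : ∀ x y k → cosTerm (x ℚ.+ y) k ℚ.+ cosTerm (x ℚ.- y) k ≡ 2ℚ ℚ.* (cosTerm x ⋆ cosTerm y) k
cosTerm-product x y k = begin
  cosTerm (x ℚ.+ y) k ℚ.+ cosTerm (x ℚ.- y) k
    ≡⟨ cong₂ ℚ._+_ (cosTerm≡ (x ℚ.+ y) k) (cosTerm≡ (x ℚ.- y) k) ⟩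
  sign k ℚ.* expTerm (x ℚ.+ y) (double k) ℚ.+ sign k ℚ.* expTerm (x ℚ.- y) (double k)
    ≡⟨ cong₂ (λ u v → sign k ℚ.* u ℚ.+ sign k ℚ.* v) (expTerm-+ x y (double k)) (expTerm-+ x (ℚ.- y) (double k)) ⟨
  sign k ℚ.* (expTerm x ⋆ expTerm y) (double k) ℚ.+ sign k ℚ.* (expTerm x ⋆ expTerm (ℚ.- y)) (double k)
    ≡⟨ ℚ.*-distribˡ-+ (sign k) ((expTerm x ⋆ expTerm y) (double k)) _ ⟨
  sign k ℚ.* ((expTerm x ⋆ expTerm y) (double k) ℚ.+ (expTerm x ⋆ expTerm (ℚ.- y)) (double k))
    ≡⟨ cong (sign k ℚ.*_) (⋆-distribˡ-+ (expTerm x) (expTerm y) (expTerm (ℚ.- y)) (double k)) ⟨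
  sign k ℚ.* (expTerm x ⋆ (λ i → expTerm y i ℚ.+ expTerm (ℚ.- y) i)) (double k)
    ≡⟨ cong (sign k ℚ.*_) (⋆-even (expTerm x) _ (expTerm-neg-odd y) k) ⟩
  sign k ℚ.* (X ⋆ (λ i → expTerm y (double i) ℚ.+ expTerm (ℚ.- y) (double i))) k
    ≡⟨ cong (sign k ℚ.*_) (⋆-cong (λ _ → refl) (λ i → trans (cong (Y i ℚ.+_) (expTerm-neg-even y i))
         (solve 1 (λ a → a :+ a := con 2ℚ :* a) refl (Y i))) k) ⟩
  sign k ℚ.* (X ⋆ (λ i → 2ℚ ℚ.* Y i)) k
    ≡⟨ cong (sign k ℚ.*_) (⋆-scaleʳ 2ℚ X Y k) ⟩
  sign k ℚ.* (2ℚ ℚ.* (X ⋆ Y) k)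
    ≡⟨ solve 2 (λ s c → s :* (con 2ℚ :* c) := con 2ℚ :* (s :* c)) refl (sign k) ((X ⋆ Y) k) ⟩
  2ℚ ℚ.* (sign k ℚ.* (X ⋆ Y) k)
    ≡⟨ cong (2ℚ ℚ.*_) (⋆-sign X Y k) ⟨
  2ℚ ℚ.* ((λ i → sign i ℚ.* X i) ⋆ (λ i → sign i ℚ.* Y i)) k
    ≡⟨ cong (2ℚ ℚ.*_) (⋆-cong (cosTerm≡ x) (cosTerm≡ y) k) ⟨
  2ℚ ℚ.* (cosTerm x ⋆ cosTerm y) k ∎
  where
  open ≡-Reasoning
  X = expTerm x ∘ double
  Y = expTerm y ∘ double

-- Partial sums of the cosine series

∑<-cong : ∀ N {f g} → (∀ k → f k ≡ g k) → ∑< N f ≡ ∑< N g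
∑<-cong zero    eq = refl
∑<-cong (suc N) eq = cong₂ ℚ._+_ (∑<-cong N eq) (eq N)

∑<-distrib-+ : ∀ N f g → ∑< N (λ k → f k ℚ.+ g k) ≡ ∑< N f ℚ.+ ∑< N g
∑<-distrib-+ zero    f g = refl
∑<-distrib-+ (suc N) f g = trans (cong (ℚ._+ (f N ℚ.+ g N)) (∑<-distrib-+ N f g))
  (solve 4 (λ a b c d → (a :+ b) :+ (c :+ d) := (a :+ c) :+ (b :+ d)) refl (∑< N f) (∑< N g) (f N) (g N))

*-distribˡ-∑< : ∀ N c f → c ℚ.* ∑< N f ≡ ∑< N (λ k → c ℚ.* f k)
*-distribˡ-∑< zero    c f = ℚ.*-zeroʳ c
*-distribˡ-∑< (suc N) c f = trans (ℚ.*-distribˡ-+ c (∑< N f) (f N)) (cong (ℚ._+ c ℚ.* f N) (*-distribˡ-∑< N c f))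

∑<-head : ∀ N f → ∑< (suc N) f ≡ f 0 ℚ.+ ∑< N (f ∘ suc)
∑<-head zero    f = ℚ.+-comm 0ℚ (f 0)
∑<-head (suc N) f = trans (cong (ℚ._+ f (suc N)) (∑<-head N f)) (ℚ.+-assoc (f 0) (∑< N (f ∘ suc)) (f (suc N)))

-- Sums the triangle i + j < N by rows: row i meets the first N - i terms of g.
∑<-⋆ : ∀ N f g → ∑< N (f ⋆ g) ≡ ∑< N (λ i → f i ℚ.* ∑< (N ℕ.∸ i) g)
∑<-⋆ zero    f g = refl
∑<-⋆ (suc N) f g = begin
  ∑< (suc N) (f ⋆ g)
    ≡⟨ ∑<-head N (f ⋆ g) ⟩
  f 0 ℚ.* g 0 ℚ.+ ∑< N (λ k → f 0 ℚ.* g (suc k) ℚ.+ (f ∘ suc ⋆ g) k)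
    ≡⟨ cong (f 0 ℚ.* g 0 ℚ.+_) (∑<-distrib-+ N (λ k → f 0 ℚ.* g (suc k)) (f ∘ suc ⋆ g)) ⟩
  f 0 ℚ.* g 0 ℚ.+ (∑< N (λ k → f 0 ℚ.* g (suc k)) ℚ.+ ∑< N (f ∘ suc ⋆ g))
    ≡⟨ ℚ.+-assoc (f 0 ℚ.* g 0) _ _ ⟨
  (f 0 ℚ.* g 0 ℚ.+ ∑< N (λ k → f 0 ℚ.* g (suc k))) ℚ.+ ∑< N (f ∘ suc ⋆ g)
    ≡⟨ cong₂ ℚ._+_ (trans (sym (∑<-head N (λ k → f 0 ℚ.* g k))) (sym (*-distribˡ-∑< (suc N) (f 0) g))) (∑<-⋆ N (f ∘ suc) g) ⟩
  f 0 ℚ.* ∑< (suc N) g ℚ.+ ∑< N (λ i → f (suc i) ℚ.* ∑< (N ℕ.∸ i) g)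
    ≡⟨ ∑<-head N (λ i → f i ℚ.* ∑< (suc N ℕ.∸ i) g) ⟨
  ∑< (suc N) (λ i → f i ℚ.* ∑< (suc N ℕ.∸ i) g) ∎
  where open ≡-Reasoning

-- The square i, j < N minus the triangle i + j < N: row i keeps the block of terms of y from N - i
-- to N - 1.
cosPartial-product : ∀ N x y →
  2ℚ ℚ.* (cosPartial N x ℚ.* cosPartial N y) ℚ.- (cosPartial N (x ℚ.+ y) ℚ.+ cosPartial N (x ℚ.- y)) ≡
  2ℚ ℚ.* ∑< N (λ i → cosTerm x i ℚ.* (cosPartial N y ℚ.- cosPartial (N ℕ.∸ i) y))
cosPartial-product N x y = begin
  2ℚ ℚ.* (cosPartial N x ℚ.* cosPartial N y) ℚ.- (cosPartial N (x ℚ.+ y) ℚ.+ cosPartial N (x ℚ.- y))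
    ≡⟨ cong₂ (λ u v → 2ℚ ℚ.* u ℚ.- v)
         (trans (ℚ.*-comm (cosPartial N x) (cosPartial N y)) (*-distribˡ-∑< N (cosPartial N y) (cosTerm x)))
         (begin
           cosPartial N (x ℚ.+ y) ℚ.+ cosPartial N (x ℚ.- y)                 ≡⟨ ∑<-distrib-+ N (cosTerm (x ℚ.+ y)) (cosTerm (x ℚ.- y)) ⟨
           ∑< N (λ k → cosTerm (x ℚ.+ y) k ℚ.+ cosTerm (x ℚ.- y) k)          ≡⟨ ∑<-cong N (cosTerm-product x y) ⟩
           ∑< N (λ k → 2ℚ ℚ.* (cosTerm x ⋆ cosTerm y) k)                     ≡⟨ *-distribˡ-∑< N 2ℚ (cosTerm x ⋆ cosTerm y) ⟨
           2ℚ ℚ.* ∑< N (cosTerm x ⋆ cosTerm y)                               ≡⟨ cong (2ℚ ℚ.*_) (∑<-⋆ N (cosTerm x) (cosTerm y)) ⟩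
           2ℚ ℚ.* V                                                          ∎) ⟩
  2ℚ ℚ.* U ℚ.- 2ℚ ℚ.* V
    ≡⟨ solve 2 (λ u v → con 2ℚ :* u :- con 2ℚ :* v := con 2ℚ :* (u :- v)) refl U V ⟩
  2ℚ ℚ.* (U ℚ.- V)
    ≡⟨ cong (2ℚ ℚ.*_) (∑<-diff 1 N (λ i → cosPartial N y ℚ.* cosTerm x i) (λ i → cosTerm x i ℚ.* cosPartial (N ℕ.∸ i) y)) ⟨
  2ℚ ℚ.* ∑< N (λ i → cosPartial N y ℚ.* cosTerm x i ℚ.- cosTerm x i ℚ.* cosPartial (N ℕ.∸ i) y)
    ≡⟨ cong (2ℚ ℚ.*_) (∑<-cong N (λ i → solve 3 (λ c t d → c :* t :- t :* d := t :* (c :- d)) refl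
         (cosPartial N y) (cosTerm x i) (cosPartial (N ℕ.∸ i) y))) ⟩
  2ℚ ℚ.* ∑< N (λ i → cosTerm x i ℚ.* (cosPartial N y ℚ.- cosPartial (N ℕ.∸ i) y)) ∎
  where
  open ≡-Reasoning
  U = ∑< N (λ i → cosPartial N y ℚ.* cosTerm x i)
  V = ∑< N (λ i → cosTerm x i ℚ.* cosPartial (N ℕ.∸ i) y)

2^-+ : ∀ m n → 2^- m ℚ.* 2^- n ≡ 2^- (m ℕ.+ n)
2^-+ m n = begin
  2^- m ℚ.* 2^- n
    ≡⟨ trans (cong (2^- m ℚ.* 2^- n ℚ.*_) (2^-*2^ (m ℕ.+ n))) (ℚ.*-identityʳ _) ⟨
  2^- m ℚ.* 2^- n ℚ.* (2^- (m ℕ.+ n) ℚ.* fromℕℚ (2 ℕ.^ (m ℕ.+ n)))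
    ≡⟨ cong (λ z → 2^- m ℚ.* 2^- n ℚ.* (2^- (m ℕ.+ n) ℚ.* z))
         (trans (cong fromℕℚ (ℕ.^-distribˡ-+-* 2 m n)) (fromℕℚ-* (2 ℕ.^ m) (2 ℕ.^ n))) ⟩
  2^- m ℚ.* 2^- n ℚ.* (2^- (m ℕ.+ n) ℚ.* (fromℕℚ (2 ℕ.^ m) ℚ.* fromℕℚ (2 ℕ.^ n)))
    ≡⟨ solve 5 (λ a b c d e → a :* b :* (c :* (d :* e)) := a :* d :* (b :* e) :* c) refl
         (2^- m) (2^- n) (2^- (m ℕ.+ n)) (fromℕℚ (2 ℕ.^ m)) (fromℕℚ (2 ℕ.^ n)) ⟩
  2^- m ℚ.* fromℕℚ (2 ℕ.^ m) ℚ.* (2^- n ℚ.* fromℕℚ (2 ℕ.^ n)) ℚ.* 2^- (m ℕ.+ n)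
    ≡⟨ cong₂ (λ u v → u ℚ.* v ℚ.* 2^- (m ℕ.+ n)) (2^-*2^ m) (2^-*2^ n) ⟩
  1ℚ ℚ.* 1ℚ ℚ.* 2^- (m ℕ.+ n)
    ≡⟨ solve 1 (λ a → con 1ℚ :* con 1ℚ :* a := a) refl (2^- (m ℕ.+ n)) ⟩
  2^- (m ℕ.+ n) ∎
  where open ≡-Reasoning

2^-antitone : ∀ {m n} → m ℕ.≤ n → 2^- n ℚ.≤ 2^- m
2^-antitone {m} {n} m≤n = subst (λ k → 2^- k ℚ.≤ 2^- m) (ℕ.m+[n∸m]≡n m≤n) (2^-anti m (n ℕ.∸ m))

module _ (J : ℕ) .{{_ : ℕ.NonZero J}} where
  private
    instance
      2J≢0 : ℕ.NonZero (2 ℕ.* J)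
      2J≢0 = ℕ.m*n≢0 2 J

    A₁ C₁ : ℕ
    A₁ = tailConst (2 ℕ.* J)
    C₁ = 2 ℕ.* tailConst J

  -- The second factor 2^-i compensates for the shorter tail bound 2^-(N∸i) of the
  -- other series in the Cauchy product.
  ∣cosTerm∣≤ : ∀ x → ∣ x ∣ ℚ.≤ fromℕℚ J → ∀ i → ∣ cosTerm x i ∣ ℚ.≤ fromℕℚ A₁ ℚ.* 2^- i ℚ.* 2^- i
  -- With m = 2i, Jᵐ = (2J)ᵐ 2^-m: doubling the bound on the argument frees a factor 2^-m ≤ 2^-i,
  -- which becomes the parameter `D` of `scaled`.
  ∣cosTerm∣≤ x hx i = scaled (2 ℕ.* J) i (x ^ℚ m) (2^- i) (0≤2^- i) (begin
    ∣ x ^ℚ m ∣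
      ≤⟨ pow≤ m hx ⟩
    fromℕℚ J ^ℚ m
      ≡⟨ trans (cong (fromℕℚ J ^ℚ m ℚ.*_) (2^-*2^ m)) (ℚ.*-identityʳ _) ⟨
    fromℕℚ J ^ℚ m ℚ.* (2^- m ℚ.* fromℕℚ (2 ℕ.^ m))
      ≡⟨ solve 3 (λ a b c → a :* (b :* c) := c :* a :* b) refl (fromℕℚ J ^ℚ m) (2^- m) (fromℕℚ (2 ℕ.^ m)) ⟩
    fromℕℚ (2 ℕ.^ m) ℚ.* fromℕℚ J ^ℚ m ℚ.* 2^- m
      ≡⟨ cong (λ z → fromℕℚ (2 ℕ.^ m) ℚ.* z ℚ.* 2^- m) (fromℕℚ-^ J m) ⟨
    fromℕℚ (2 ℕ.^ m) ℚ.* fromℕℚ (J ℕ.^ m) ℚ.* 2^- m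
      ≡⟨ cong (ℚ._* 2^- m) (trans (cong fromℕℚ (^-distrib J m)) (fromℕℚ-* (2 ℕ.^ m) (J ℕ.^ m))) ⟨
    fromℕℚ ((2 ℕ.* J) ℕ.^ m) ℚ.* 2^- m
      ≡⟨ cong (ℚ._* 2^- m) (fromℕℚ-^ (2 ℕ.* J) m) ⟩
    fromℕℚ (2 ℕ.* J) ^ℚ m ℚ.* 2^- m
      ≤⟨ ℚ.*-monoˡ-≤-nonNeg (fromℕℚ (2 ℕ.* J) ^ℚ m) {{ℚ.nonNegative (0≤pow m (0≤fromℕℚ (2 ℕ.* J)))}} (2^-anti i (i ℕ.+ 0)) ⟩
    fromℕℚ (2 ℕ.* J) ^ℚ m ℚ.* 2^- i ∎)
    where
    open ℚ.≤-Reasoning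
    m = 2 ℕ.* i

  -- A₁ comes from the terms and C₁ from the tails; one factor 2 belongs to the product formula, the
  -- other is the sum of the geometric series of the 2^-i.
  productError : ℕ
  productError = 2 ℕ.* (2 ℕ.* (A₁ ℕ.* C₁))

  cosPartial-product-error : ∀ x y → ∣ x ∣ ℚ.≤ fromℕℚ J → ∣ y ∣ ℚ.≤ fromℕℚ J → ∀ N →
    ∣ 2ℚ ℚ.* (cosPartial N x ℚ.* cosPartial N y) ℚ.- (cosPartial N (x ℚ.+ y) ℚ.+ cosPartial N (x ℚ.- y)) ∣
      ℚ.≤ fromℕℚ productError ℚ.* 2^- N
  cosPartial-product-error x y hx hy N = begin
    ∣ 2ℚ ℚ.* (cosPartial N x ℚ.* cosPartial N y) ℚ.- (cosPartial N (x ℚ.+ y) ℚ.+ cosPartial N (x ℚ.- y)) ∣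
      ≡⟨ cong ∣_∣ (cosPartial-product N x y) ⟩
    ∣ 2ℚ ℚ.* ∑< N f ∣
      ≡⟨ ℚ.∣p*q∣≡∣p∣*∣q∣ 2ℚ (∑< N f) ⟩
    2ℚ ℚ.* ∣ ∑< N f ∣
      ≡⟨ cong (λ z → 2ℚ ℚ.* ∣ z ∣) (ℚ.+-identityʳ (∑< N f)) ⟨
    2ℚ ℚ.* ∣ ∑< N f ℚ.- ∑< 0 f ∣
      ≤⟨ ℚ.*-monoˡ-≤-nonNeg 2ℚ (geometric′ J f c 0≤c ∣f∣≤ 0 N) ⟩
    2ℚ ℚ.* ((c ℚ.+ c) ℚ.* 2^- 0)
      ≡⟨ cong (λ z → 2ℚ ℚ.* ((c ℚ.+ c) ℚ.* z)) 2^-0 ⟩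
    2ℚ ℚ.* ((c ℚ.+ c) ℚ.* 1ℚ)
      ≡⟨ solve 3 (λ a b w → con 2ℚ :* ((a :* b :* w :+ a :* b :* w) :* con 1ℚ) := ((a :* b :+ a :* b) :+ (a :* b :+ a :* b)) :* w) refl
           (fromℕℚ A₁) (fromℕℚ C₁) (2^- N) ⟩
    ((A₁C₁ ℚ.+ A₁C₁) ℚ.+ (A₁C₁ ℚ.+ A₁C₁)) ℚ.* 2^- N
      ≡⟨ cong (λ z → (z ℚ.+ z) ℚ.* 2^- N) (trans (fromℕℚ-2* (A₁ ℕ.* C₁)) (cong (λ z → z ℚ.+ z) (fromℕℚ-* A₁ C₁))) ⟨
    (fromℕℚ (2 ℕ.* (A₁ ℕ.* C₁)) ℚ.+ fromℕℚ (2 ℕ.* (A₁ ℕ.* C₁))) ℚ.* 2^- N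
      ≡⟨ cong (ℚ._* 2^- N) (fromℕℚ-2* (2 ℕ.* (A₁ ℕ.* C₁))) ⟨
    fromℕℚ productError ℚ.* 2^- N ∎
    where
    open ℚ.≤-Reasoning
    A₁C₁ c : ℚ
    A₁C₁ = fromℕℚ A₁ ℚ.* fromℕℚ C₁
    c = A₁C₁ ℚ.* 2^- N
    0≤A₁C₁ : 0ℚ ℚ.≤ A₁C₁
    0≤A₁C₁ = 0≤* (0≤fromℕℚ A₁) (0≤fromℕℚ C₁)
    0≤c : 0ℚ ℚ.≤ c
    0≤c = 0≤* 0≤A₁C₁ (0≤2^- N)
    f : ℕ → ℚ
    f i = cosTerm x i ℚ.* (cosPartial N y ℚ.- cosPartial (N ℕ.∸ i) y)
    tail≤ : ∀ i → ∣ cosPartial N y ℚ.- cosPartial (N ℕ.∸ i) y ∣ ℚ.≤ fromℕℚ C₁ ℚ.* 2^- (N ℕ.∸ i)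
    tail≤ i = subst (λ n → ∣ cosPartial n y ℚ.- cosPartial (N ℕ.∸ i) y ∣ ℚ.≤ fromℕℚ C₁ ℚ.* 2^- (N ℕ.∸ i))
      (ℕ.m+[n∸m]≡n (ℕ.m∸n≤m N i)) (cosPartial-tail J y hy (N ℕ.∸ i) (N ℕ.∸ (N ℕ.∸ i)))
    ∣f∣≤ : ∀ i → ∣ f i ∣ ℚ.≤ c ℚ.* 2^- i
    ∣f∣≤ i = begin
      ∣ f i ∣
        ≡⟨ ℚ.∣p*q∣≡∣p∣*∣q∣ (cosTerm x i) _ ⟩
      ∣ cosTerm x i ∣ ℚ.* ∣ cosPartial N y ℚ.- cosPartial (N ℕ.∸ i) y ∣
        ≤⟨ *-mono-≤ (ℚ.0≤∣p∣ (cosTerm x i)) (0≤* (0≤fromℕℚ C₁) (0≤2^- (N ℕ.∸ i))) (∣cosTerm∣≤ x hx i) (tail≤ i) ⟩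
      fromℕℚ A₁ ℚ.* 2^- i ℚ.* 2^- i ℚ.* (fromℕℚ C₁ ℚ.* 2^- (N ℕ.∸ i))
        ≡⟨ solve 4 (λ a b p q → a :* p :* p :* (b :* q) := a :* b :* (p :* q) :* p) refl
             (fromℕℚ A₁) (fromℕℚ C₁) (2^- i) (2^- (N ℕ.∸ i)) ⟩
      A₁C₁ ℚ.* (2^- i ℚ.* 2^- (N ℕ.∸ i)) ℚ.* 2^- i
        ≡⟨ cong (λ z → A₁C₁ ℚ.* z ℚ.* 2^- i) (2^-+ i (N ℕ.∸ i)) ⟩
      A₁C₁ ℚ.* 2^- (i ℕ.+ (N ℕ.∸ i)) ℚ.* 2^- i
        -- Truncated subtraction gives i + (N ∸ i) ≥ N for every i, so i > N needs no separate case.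
        ≤⟨ ℚ.*-monoʳ-≤-nonNeg (2^- i) {{ℚ.nonNegative (0≤2^- i)}}
             (ℚ.*-monoˡ-≤-nonNeg A₁C₁ {{ℚ.nonNegative 0≤A₁C₁}} (2^-antitone (ℕ.m≤n+m∸n N i))) ⟩
      c ℚ.* 2^- i ∎

-- The commutative ring of real numbers

≃-pointwise : ∀ {x y} → (∀ n → seq x n ≡ seq y n) → x ≃ y
≃-pointwise {x} {y} eq ε 0<ε = 0 , λ n _ → subst (ℚ._< ε) (cong ∣_∣ (sym (trans (cong (ℚ._- seq y n) (eq n)) (ℚ.+-inverseʳ (seq y n))))) 0<ε

≃-refl : ∀ {x} → x ≃ x
≃-refl {x} = ≃-pointwise {x} {x} (λ _ → refl)

≃-sym : ∀ {x y} → x ≃ y → y ≃ x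
≃-sym {x} {y} x≃y ε 0<ε = let N , close = x≃y ε 0<ε in
  N , λ n N≤n → subst (ℚ._< ε) (∣-∣-comm (seq x n) (seq y n)) (close n N≤n)

≃-trans : ∀ {x y z} → x ≃ y → y ≃ z → x ≃ z
≃-trans {x} {y} {z} x≃y y≃z ε 0<ε =
  let M , p = x≃y (½ ℚ.* ε) (0<½* 0<ε)
      N , q = y≃z (½ ℚ.* ε) (0<½* 0<ε)
  in M ℕ.⊔ N , λ n L → ℚ.≤-<-trans (∣∣-tri (seq x n) (seq y n) (seq z n))
       (subst (∣ seq x n ℚ.- seq y n ∣ ℚ.+ ∣ seq y n ℚ.- seq z n ∣ ℚ.<_) (halves ε)
         (ℚ.+-mono-< (p n (ℕ.m⊔n≤o⇒m≤o M N L)) (q n (ℕ.m⊔n≤o⇒n≤o M N L))))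

-- The common form of all congruences below: a Lipschitz estimate at equal indices. `margin` divides
-- ε by K + 1, so K = 0 is harmless.
≃-dominated : ∀ {x y u v} K → x ≃ y →
  (∀ n → ∣ seq u n ℚ.- seq v n ∣ ℚ.≤ fromℕℚ K ℚ.* ∣ seq x n ℚ.- seq y n ∣) → u ≃ v
≃-dominated K x≃y h ε 0<ε =
  let η , 0<η , Kη<ε = margin ε K 0<ε
      N , close = x≃y η 0<η
  in N , λ n N≤n → ℚ.≤-<-trans (h n) (ℚ.≤-<-trans
       (ℚ.*-monoˡ-≤-nonNeg (fromℕℚ K) {{ℚ.nonNegative (0≤fromℕℚ K)}} (ℚ.<⇒≤ (close n N≤n))) Kη<ε)

private
  isometric : ∀ {p q} → p ≡ q → p ℚ.≤ fromℕℚ 1 ℚ.* q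
  isometric {q = q} eq = ℚ.≤-reflexive (trans eq (sym (trans (cong (ℚ._* q) fromℕℚ-1) (ℚ.*-identityˡ q))))

+ℝ-congʳ : ∀ {x y} z → x ≃ y → x + z ≃ y + z
+ℝ-congʳ {x} {y} z x≃y = ≃-dominated {x} {y} {x + z} {y + z} 1 x≃y λ n → isometric (cong ∣_∣
  (solve 3 (λ a b c → (a :+ c) :- (b :+ c) := a :- b) refl (seq x n) (seq y n) (seq z n)))

+ℝ-comm : ∀ x y → x + y ≃ y + x
+ℝ-comm x y = ≃-pointwise {x + y} {y + x} λ n → ℚ.+-comm (seq x n) (seq y n)

+ℝ-cong : ∀ {x y u v} → x ≃ y → u ≃ v → x + u ≃ y + v
+ℝ-cong {x} {y} {u} {v} p q = ≃-trans {x + u} {y + u} {y + v} (+ℝ-congʳ {x} {y} u p)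
  (≃-trans {y + u} {u + y} {y + v} (+ℝ-comm y u) (≃-trans {u + y} {v + y} {y + v} (+ℝ-congʳ {u} {v} y q) (+ℝ-comm v y)))

neg-cong : ∀ {x y} → x ≃ y → - x ≃ - y
neg-cong {x} {y} x≃y = ≃-dominated {x} {y} {(- x)} {(- y)} 1 x≃y λ n → isometric (trans
  (cong ∣_∣ (solve 2 (λ a b → :- a :- (:- b) := b :- a) refl (seq x n) (seq y n))) (∣-∣-comm (seq y n) (seq x n)))

*ℝ-congʳ : ∀ {x y} z → x ≃ y → x * z ≃ y * z
*ℝ-congʳ {x} {y} z x≃y = ≃-dominated {x} {y} {x * z} {y * z} (proj₁ (bounded z)) x≃y λ n → begin
  ∣ seq x n ℚ.* seq z n ℚ.- seq y n ℚ.* seq z n ∣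
    ≡⟨ cong ∣_∣ (solve 3 (λ a b c → a :* c :- b :* c := c :* (a :- b)) refl (seq x n) (seq y n) (seq z n)) ⟩
  ∣ seq z n ℚ.* (seq x n ℚ.- seq y n) ∣
    ≡⟨ ℚ.∣p*q∣≡∣p∣*∣q∣ (seq z n) _ ⟩
  ∣ seq z n ∣ ℚ.* ∣ seq x n ℚ.- seq y n ∣
    ≤⟨ ℚ.*-monoʳ-≤-nonNeg ∣ seq x n ℚ.- seq y n ∣ {{ℚ.nonNegative (ℚ.0≤∣p∣ (seq x n ℚ.- seq y n))}} (proj₂ (bounded z) n) ⟩
  fromℕℚ (proj₁ (bounded z)) ℚ.* ∣ seq x n ℚ.- seq y n ∣ ∎
  where open ℚ.≤-Reasoning

*ℝ-comm : ∀ x y → x * y ≃ y * x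
*ℝ-comm x y = ≃-pointwise {x * y} {y * x} λ n → ℚ.*-comm (seq x n) (seq y n)

*ℝ-cong : ∀ {x y u v} → x ≃ y → u ≃ v → x * u ≃ y * v
*ℝ-cong {x} {y} {u} {v} p q = ≃-trans {x * u} {y * u} {y * v} (*ℝ-congʳ {x} {y} u p)
  (≃-trans {y * u} {u * y} {y * v} (*ℝ-comm y u) (≃-trans {u * y} {v * y} {y * v} (*ℝ-congʳ {u} {v} y q) (*ℝ-comm v y)))

-- The laws hold termwise in ℚ; only the congruences need estimates. Endpoints are written out
-- because `_≃_` unfolds to a statement about sequences, from which they cannot be inferred.
ℝ-isCommutativeRing : IsCommutativeRing _≃_ _+_ _*_ -_ 0ℝ 1ℝ
ℝ-isCommutativeRing = record
  { isRing = record
    { +-isAbelianGroup = record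
      { isGroup = record
        { isMonoid = record
          { isSemigroup = record
            { isMagma = record
              { isEquivalence = record
                { refl = λ {x} → ≃-refl {x}
                ; sym = λ {x} {y} → ≃-sym {x} {y}
                ; trans = λ {x} {y} {z} → ≃-trans {x} {y} {z}
                }
              ; ∙-cong = λ {x} {y} {u} {v} → +ℝ-cong {x} {y} {u} {v}
              }
            ; assoc = λ x y z → ≃-pointwise {x + y + z} {x + (y + z)} λ n → ℚ.+-assoc (seq x n) (seq y n) (seq z n)
            }
          ; identity = (λ x → ≃-pointwise {0ℝ + x} {x} λ n → ℚ.+-identityˡ (seq x n))
                     , (λ x → ≃-pointwise {x + 0ℝ} {x} λ n → ℚ.+-identityʳ (seq x n))
          }
        ; inverse = (λ x → ≃-pointwise {(- x) + x} {0ℝ} λ n → ℚ.+-inverseˡ (seq x n))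
                  , (λ x → ≃-pointwise {x + (- x)} {0ℝ} λ n → ℚ.+-inverseʳ (seq x n))
        ; ⁻¹-cong = λ {x} {y} → neg-cong {x} {y}
        }
      ; comm = +ℝ-comm
      }
    ; *-cong = λ {x} {y} {u} {v} → *ℝ-cong {x} {y} {u} {v}
    ; *-assoc = λ x y z → ≃-pointwise {x * y * z} {x * (y * z)} λ n → ℚ.*-assoc (seq x n) (seq y n) (seq z n)
    ; *-identity = (λ x → ≃-pointwise {1ℝ * x} {x} λ n → ℚ.*-identityˡ (seq x n))
                 , (λ x → ≃-pointwise {x * 1ℝ} {x} λ n → ℚ.*-identityʳ (seq x n))
    ; distrib = (λ x y z → ≃-pointwise {x * (y + z)} {x * y + x * z} λ n → ℚ.*-distribˡ-+ (seq x n) (seq y n) (seq z n))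
              , (λ x y z → ≃-pointwise {(y + z) * x} {y * x + z * x} λ n → ℚ.*-distribʳ-+ (seq x n) (seq y n) (seq z n))
    }
  ; *-comm = *ℝ-comm
  }

ℝ-commutativeRing : CommutativeRing 0ℓ 0ℓ
ℝ-commutativeRing = record { isCommutativeRing = ℝ-isCommutativeRing }

-- Constructively, the comparison of the rational |y_N| with ε/2 for one large N
-- either bounds y by ε or keeps y away from 0, in which case x vanishes.
noZeroDivisors : ∀ {x y} → x * y ≃ 0ℝ → ¬ (x ≃ 0ℝ) → y ≃ 0ℝ
noZeroDivisors {x} {y} xy≃0 x≄0 ε 0<ε with cauchy y δ 0<δ
  where
  -- ε/4 serves both cases: if |y N| < ε/2 then |y n| < 3ε/4 for n ≥ N, and otherwise |y n| ≥ ε/2 -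
  -- ε/4 = δ.
  δ = ½ ℚ.* (½ ℚ.* ε)
  0<δ : 0ℚ ℚ.< δ
  0<δ = 0<½* (0<½* 0<ε)
... | N , close with ∣ seq y N ∣ ℚ.<? ½ ℚ.* ε
...   | yes yN<½ε = N , λ n N≤n → begin-strict
    ∣ seq y n ℚ.- 0ℚ ∣                         ≡⟨ cong ∣_∣ (solve 2 (λ a b → a :- con 0ℚ := (a :- b) :+ b) refl (seq y n) (seq y N)) ⟩
    ∣ (seq y n ℚ.- seq y N) ℚ.+ seq y N ∣      ≤⟨ ℚ.∣p+q∣≤∣p∣+∣q∣ (seq y n ℚ.- seq y N) (seq y N) ⟩
    ∣ seq y n ℚ.- seq y N ∣ ℚ.+ ∣ seq y N ∣    <⟨ ℚ.+-mono-< (close n N N≤n ℕ.≤-refl) yN<½ε ⟩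
    ½ ℚ.* (½ ℚ.* ε) ℚ.+ ½ ℚ.* ε                ≤⟨ ℚ.+-monoˡ-≤ (½ ℚ.* ε) (begin
      ½ ℚ.* (½ ℚ.* ε)                            ≡⟨ ℚ.+-identityʳ _ ⟨
      ½ ℚ.* (½ ℚ.* ε) ℚ.+ 0ℚ                     ≤⟨ ℚ.+-monoʳ-≤ (½ ℚ.* (½ ℚ.* ε)) (ℚ.<⇒≤ (0<½* (0<½* 0<ε))) ⟩
      ½ ℚ.* (½ ℚ.* ε) ℚ.+ ½ ℚ.* (½ ℚ.* ε)        ≡⟨ halves (½ ℚ.* ε) ⟩
      ½ ℚ.* ε                                    ∎) ⟩
    ½ ℚ.* ε ℚ.+ ½ ℚ.* ε                        ≡⟨ halves ε ⟩
    ε                                          ∎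
    where open ℚ.≤-Reasoning
...   | no ¬yN<½ε = contradiction x≃0 x≄0
    where
    open ℚ.≤-Reasoning
    δ = ½ ℚ.* (½ ℚ.* ε)
    0<δ : 0ℚ ℚ.< δ
    0<δ = 0<½* (0<½* 0<ε)
    δ≤∣y∣ : ∀ n → N ℕ.≤ n → δ ℚ.≤ ∣ seq y n ∣
    δ≤∣y∣ n N≤n = begin
      δ                                                          ≡⟨ solve 1 (λ d → d := (d :+ d) :- d) refl δ ⟩
      (δ ℚ.+ δ) ℚ.- δ                                            ≡⟨ cong (ℚ._- δ) (halves (½ ℚ.* ε)) ⟩
      ½ ℚ.* ε ℚ.- δ                                              ≤⟨ ℚ.+-monoˡ-≤ (ℚ.- δ) (ℚ.≮⇒≥ ¬yN<½ε) ⟩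
      ∣ seq y N ∣ ℚ.- δ                                          ≡⟨ cong (λ z → ∣ z ∣ ℚ.- δ) (solve 2 (λ a b → a := (a :- b) :+ b) refl (seq y N) (seq y n)) ⟩
      ∣ (seq y N ℚ.- seq y n) ℚ.+ seq y n ∣ ℚ.- δ                ≤⟨ ℚ.+-monoˡ-≤ (ℚ.- δ) (ℚ.∣p+q∣≤∣p∣+∣q∣ (seq y N ℚ.- seq y n) (seq y n)) ⟩
      (∣ seq y N ℚ.- seq y n ∣ ℚ.+ ∣ seq y n ∣) ℚ.- δ            ≤⟨ ℚ.+-monoˡ-≤ (ℚ.- δ) (ℚ.+-monoˡ-≤ ∣ seq y n ∣ (ℚ.<⇒≤ (close N n ℕ.≤-refl N≤n))) ⟩
      (δ ℚ.+ ∣ seq y n ∣) ℚ.- δ                                  ≡⟨ solve 2 (λ d a → (d :+ a) :- d := a) refl δ ∣ seq y n ∣ ⟩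
      ∣ seq y n ∣                                                ∎
    x≃0 : x ≃ 0ℝ
    -- The product is tested at ηδ and then divided by |y n| ≥ δ.
    x≃0 η 0<η with xy≃0 (η ℚ.* δ) (0<* 0<η 0<δ)
    ... | M , small = M ℕ.⊔ N , λ n L → ℚ.*-cancelʳ-<-nonNeg δ {{ℚ.nonNegative (ℚ.<⇒≤ 0<δ)}} (begin-strict
      ∣ seq x n ℚ.- 0ℚ ∣ ℚ.* δ                ≡⟨ cong (λ z → ∣ z ∣ ℚ.* δ) (ℚ.+-identityʳ (seq x n)) ⟩
      ∣ seq x n ∣ ℚ.* δ                       ≤⟨ ℚ.*-monoˡ-≤-nonNeg ∣ seq x n ∣ {{ℚ.nonNegative (ℚ.0≤∣p∣ (seq x n))}} (δ≤∣y∣ n (ℕ.m⊔n≤o⇒n≤o M N L)) ⟩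
      ∣ seq x n ∣ ℚ.* ∣ seq y n ∣             ≡⟨ ℚ.∣p*q∣≡∣p∣*∣q∣ (seq x n) (seq y n) ⟨
      ∣ seq x n ℚ.* seq y n ∣                 ≡⟨ cong ∣_∣ (ℚ.+-identityʳ (seq x n ℚ.* seq y n)) ⟨
      ∣ seq x n ℚ.* seq y n ℚ.- 0ℚ ∣          <⟨ small n (ℕ.m⊔n≤o⇒m≤o M N L) ⟩
      η ℚ.* δ                                 ∎)

fromℚ-≄0 : ∀ q → 0ℚ ℚ.< q → ¬ (fromℚ q ≃ 0ℝ)
fromℚ-≄0 q 0<q q≃0 = let N , close = q≃0 q 0<q in
  ℚ.<-irrefl (trans (cong ∣_∣ (ℚ.+-identityʳ q)) (ℚ.0≤p⇒∣p∣≡p (ℚ.<⇒≤ 0<q))) (close N ℕ.≤-refl)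

-- The cosine

-- The Lipschitz constant depends on a common bound for the arguments but not on the number of
-- summands, so it applies along the diagonal.
cos-cong : ∀ {x y} → x ≃ y → cos x ≃ cos y
cos-cong {x} {y} x≃y = ≃-dominated {x} {y} {cos x} {cos y} (2 ℕ.* tailConst (suc K)) x≃y λ n →
  cosPartial-Lipschitz (suc K) K (seq x n) (seq y n) ℕ.≤-refl
    (ℚ.≤-trans (proj₂ (bounded x) n) (fromℕℚ-mono (ℕ.m≤m⊔n (proj₁ (bounded x)) (proj₁ (bounded y)))))
    (ℚ.≤-trans (proj₂ (bounded y) n) (fromℕℚ-mono (ℕ.m≤n⊔m (proj₁ (bounded x)) (proj₁ (bounded y))))) n
  where K = proj₁ (bounded x) ℕ.⊔ proj₁ (bounded y)

cosPartial-0 : ∀ n → cosPartial (suc n) 0ℚ ≡ 1ℚ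
cosPartial-0 zero    = refl
cosPartial-0 (suc n) = trans (cong₂ ℚ._+_ (cosPartial-0 n) (trans (cosTerm≡ 0ℚ (suc n))
  (solve 3 (λ s a b → s :* (a :* (con 0ℚ :* b)) := con 0ℚ) refl (sign (suc n)) (1/! (double (suc n))) (0ℚ ℚ.* 0ℚ ^ℚ double n)))) (ℚ.+-identityʳ 1ℚ)

cos-0 : cos 0ℝ ≃ 1ℝ
-- The threshold is 1 because the diagonal starts with the empty sum 0.
cos-0 ε 0<ε = 1 , λ { (suc n) _ → subst (ℚ._< ε) (sym (cong (λ z → ∣ z ℚ.- 1ℚ ∣) (cosPartial-0 n))) 0<ε }

-- All cosines are read at the same n, and the n-th entries of x + y and x - y are formed from those
-- of x and y, so the estimate for partial sums applies as it stands. The bound `suc K` makes its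
-- parameter positive.
cos-product : ∀ x y → fromℚ 2ℚ * (cos x * cos y) ≃ cos (x + y) + cos (x + (- y))
cos-product x y ε 0<ε = let N , small = 2^-small ε (productError (suc K)) 0<ε in N , λ n N≤n →
  ℚ.≤-<-trans (cosPartial-product-error (suc K) (seq x n) (seq y n)
      (ℚ.≤-trans (proj₂ (bounded x) n) (fromℕℚ-mono (ℕ.m≤n⇒m≤1+n (ℕ.m≤m⊔n (proj₁ (bounded x)) (proj₁ (bounded y))))))
      (ℚ.≤-trans (proj₂ (bounded y) n) (fromℕℚ-mono (ℕ.m≤n⇒m≤1+n (ℕ.m≤n⊔m (proj₁ (bounded x)) (proj₁ (bounded y)))))) n)
    (ℚ.≤-<-trans (ℚ.*-monoˡ-≤-nonNeg (fromℕℚ (productError (suc K))) {{ℚ.nonNegative (0≤fromℕℚ _)}} (2^-antitone N≤n)) small)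
  where K = proj₁ (bounded x) ℕ.⊔ proj₁ (bounded y)

-- Coefficients: integers in ℚ and ℚ in ℝ

ℚ-rawRing : RawRing 0ℓ 0ℓ
ℚ-rawRing = CommutativeRing.rawRing ℚ.+-*-commutativeRing

fromℚ-homomorphism : ℚ-rawRing ACR.-Raw-AlmostCommutative⟶ ACR.fromCommutativeRing ℝ-commutativeRing
fromℚ-homomorphism = record
  { ⟦_⟧    = fromℚ
  ; +-homo = λ p q → ≃-pointwise {fromℚ (p ℚ.+ q)} {fromℚ p + fromℚ q} λ _ → refl
  ; *-homo = λ p q → ≃-pointwise {fromℚ (p ℚ.* q)} {fromℚ p * fromℚ q} λ _ → refl
  ; -‿homo = λ p → ≃-pointwise {fromℚ (ℚ.- p)} {(- fromℚ p)} λ _ → refl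
  ; 0-homo = ≃-refl {0ℝ}
  ; 1-homo = ≃-refl {1ℝ}
  }

-- The reflection m ↦ n - m carries the upper half of a period to the lower half, to which
-- `C-≉1-half` applies.
2*[n∸m]<n : ∀ {m n} → m ℕ.< n → n ℕ.< 2 ℕ.* m → 2 ℕ.* (n ℕ.∸ m) ℕ.< n
2*[n∸m]<n {m} {n} m<n n<2m = ℕ.+-cancelʳ-< (2 ℕ.* m) (2 ℕ.* (n ℕ.∸ m)) n (begin-strict
  2 ℕ.* (n ℕ.∸ m) ℕ.+ 2 ℕ.* m   ≡⟨ ℕ.*-distribˡ-+ 2 (n ℕ.∸ m) m ⟨
  2 ℕ.* (n ℕ.∸ m ℕ.+ m)         ≡⟨ cong (2 ℕ.*_) (ℕ.m∸n+n≡m (ℕ.<⇒≤ m<n)) ⟩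
  2 ℕ.* n                       ≡⟨ cong (n ℕ.+_) (ℕ.+-identityʳ n) ⟩
  n ℕ.+ n                       <⟨ ℕ.+-monoʳ-< n n<2m ⟩
  n ℕ.+ 2 ℕ.* m                 ∎)
  where open ℕ.≤-Reasoning

*-/1 : ∀ i j → (i ℤ.* j) / 1 ≡ (i / 1) ℚ.* (j / 1)
*-/1 i j = ℚ.toℚᵘ-injective (begin
  ℚ.toℚᵘ ((i ℤ.* j) / 1)                 ≈⟨ toℚᵘ-/1 (i ℤ.* j) ⟩
  ℚᵘ.mkℚᵘ i 0 ℚᵘ.* ℚᵘ.mkℚᵘ j 0           ≈⟨ ℚᵘ.*-cong (toℚᵘ-/1 i) (toℚᵘ-/1 j) ⟨
  ℚ.toℚᵘ (i / 1) ℚᵘ.* ℚ.toℚᵘ (j / 1)     ≈⟨ ℚ.toℚᵘ-homo-* (i / 1) (j / 1) ⟨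
  ℚ.toℚᵘ ((i / 1) ℚ.* (j / 1))           ∎)
  where open ℚᵘ.≃-Reasoning

+-/1 : ∀ i j → (i ℤ.+ j) / 1 ≡ (i / 1) ℚ.+ (j / 1)
+-/1 i j = ℚ.toℚᵘ-injective (begin
  ℚ.toℚᵘ ((i ℤ.+ j) / 1)                 ≈⟨ toℚᵘ-/1 (i ℤ.+ j) ⟩
  ℚᵘ.mkℚᵘ (i ℤ.+ j) 0                    ≈⟨ ℚᵘ.*≡* (cong (ℤ._* 1ℤ) (sym (cong₂ ℤ._+_ (ℤ.*-identityʳ i) (ℤ.*-identityʳ j)))) ⟩
  ℚᵘ.mkℚᵘ i 0 ℚᵘ.+ ℚᵘ.mkℚᵘ j 0           ≈⟨ ℚᵘ.+-cong (toℚᵘ-/1 i) (toℚᵘ-/1 j) ⟨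
  ℚ.toℚᵘ (i / 1) ℚᵘ.+ ℚ.toℚᵘ (j / 1)     ≈⟨ ℚ.toℚᵘ-homo-+ (i / 1) (j / 1) ⟨
  ℚ.toℚᵘ ((i / 1) ℚ.+ (j / 1))           ∎)
  where open ℚᵘ.≃-Reasoning

-- Exponents of the Laurent polynomial of a pattern

ExponentsWithin : ℕ → Laurent → Set
ExponentsWithin b = All (λ { (_ , e) → ℤ.∣ e ∣ ℕ.≤ b })

*ᴸ-within : ∀ {a b p q} → ExponentsWithin a p → ExponentsWithin b q → ExponentsWithin (a ℕ.+ b) (p *ᴸ q)
*ᴸ-within {p = p} {q} p≤a q≤b = All.cartesianProductWith⁺ (setoid _) (setoid _) _ p q λ {(c , e)} {(c′ , e′)} x∈p y∈q →
  ℕ.≤-trans (ℤ.∣i+j∣≤∣i∣+∣j∣ e e′) (ℕ.+-mono-≤ (All.lookup p≤a x∈p) (All.lookup q≤b y∈q))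

^ᴸ-within : ∀ {b p} h → ExponentsWithin b p → ExponentsWithin (h ℕ.* b) (p ^ᴸ h)
^ᴸ-within zero    p≤b = z≤n ∷ []
^ᴸ-within (suc h) p≤b = *ᴸ-within p≤b (^ᴸ-within h p≤b)

∏-within : ∀ {t} (r : Vector ℤ t) (h : Vector ℕ t) →
  ExponentsWithin (foldr ℕ._+_ 0 (λ j → h j ℕ.* ℤ.∣ r j ∣)) (foldr _*ᴸ_ 1ᴸ (λ j → ((1ℤ , r j) ∷ (1ℤ , ℤ.- r j) ∷ []) ^ᴸ h j))
∏-within {zero}  r h = z≤n ∷ []
∏-within {suc t} r h = *ᴸ-within
  (^ᴸ-within (h Fin.zero) (ℕ.≤-refl ∷ ℕ.≤-reflexive (ℤ.∣-i∣≡∣i∣ (r Fin.zero)) ∷ []))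
  (∏-within (r ∘ Fin.suc) (h ∘ Fin.suc))

-- Together with B < n this leaves 0 as the only listed exponent divisible by n.
patternLaurent-within : ∀ P → ExponentsWithin (B P) (patternLaurent P)
patternLaurent-within P = ∏-within (r P) (h P)

-- Cosine sums over a commutative ring containing the rationals

module ℚ-Algebra
  (R : CommutativeRing 0ℓ 0ℓ)
  (φ : ℚ-rawRing ACR.-Raw-AlmostCommutative⟶ ACR.fromCommutativeRing R)
  where

  open CommutativeRing R using (Carrier; _≈_; 0#; 1#; +-cong; +-congˡ; +-congʳ; *-cong; *-congˡ; *-congʳ; -‿cong; reflexive)
    renaming (_+_ to _⊕_; _*_ to _⊗_; -_ to ⊖_; refl to ≈-refl; sym to ≈-sym; trans to ≈-trans)
  open ACR._-Raw-AlmostCommutative⟶_ φ renaming (⟦_⟧ to ι)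

  ι-≟ : ∀ p q → Maybe (ι p ≈ ι q)
  ι-≟ p q with p ℚ.≟ q
  ... | yes p≡q = just (reflexive (cong ι p≡q))
  ... | no  _   = nothing

  open RingSolver ℚ-rawRing (ACR.fromCommutativeRing R) φ ι-≟
    renaming (solve to solveᴿ; _:+_ to _+′_; _:*_ to _*′_; :-_ to -′_; _:-_ to _-′_; _:=_ to _≋_; con to con′)
    using ()
  open MonoidSum (CommutativeRing.+-commutativeMonoid R) using (sum; sum-cong-≋; ∑-distrib-+; sum-replicate-zero)
  open SemiringSum (CommutativeRing.semiring R) using (*-distribˡ-sum)
  open SetoidReasoning (CommutativeRing.setoid R)

  2# : Carrier
  2# = ι 2ℚ

  -- Both sides are g 0 + ⋯ + g n, with the first or the last term split off.
  sum-shift : ∀ n (g : ℕ → Carrier) → sum {n} (g ∘ suc ∘ toℕ) ⊕ g 0 ≈ sum {n} (g ∘ toℕ) ⊕ g n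
  sum-shift zero    g = ≈-refl
  sum-shift (suc n) g = begin
    g 1 ⊕ X ⊕ g 0           ≈⟨ solveᴿ 3 (λ a b c → (a +′ b) +′ c ≋ c +′ (b +′ a)) ≈-refl (g 1) X (g 0) ⟩
    g 0 ⊕ (X ⊕ g 1)         ≈⟨ +-congˡ (sum-shift n (g ∘ suc)) ⟩
    g 0 ⊕ (Y ⊕ g (suc n))   ≈⟨ solveᴿ 3 (λ a b c → a +′ (b +′ c) ≋ (a +′ b) +′ c) ≈-refl (g 0) Y (g (suc n)) ⟩
    g 0 ⊕ Y ⊕ g (suc n)     ∎
    where
    X = sum {n} (g ∘ suc ∘ suc ∘ toℕ)
    Y = sum {n} (g ∘ suc ∘ toℕ)

  -- Scalars, powers and evaluation of Laurent polynomials

  open RawSemiringDefs (RawRing.rawSemiring (CommutativeRing.rawRing R)) using (_^′_)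

  ιℤ : ℤ → Carrier
  ιℤ i = ι (i / 1)

  ιℤ-* : ∀ i j → ιℤ (i ℤ.* j) ≈ ιℤ i ⊗ ιℤ j
  ιℤ-* i j = ≈-trans (reflexive (cong ι (*-/1 i j))) (*-homo (i / 1) (j / 1))

  ιℤ-+ : ∀ i j → ιℤ (i ℤ.+ j) ≈ ιℤ i ⊕ ιℤ j
  ιℤ-+ i j = ≈-trans (reflexive (cong ι (+-/1 i j))) (+-homo (i / 1) (j / 1))

  product : ∀ {t} → Vector Carrier t → Carrier
  product = foldr _⊗_ 1#

  product-cong : ∀ {t} {f g : Vector Carrier t} → (∀ j → f j ≈ g j) → product f ≈ product g
  product-cong {zero}  eq = ≈-refl
  product-cong {suc t} eq = *-cong (eq Fin.zero) (product-cong (eq ∘ Fin.suc))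

  -- `_^′_` is the power that interprets `⊛`. It is x itself at exponent 1 and multiplies on the
  -- right, so the usual recursion needs a proof.
  ^′-suc : ∀ x h → x ^′ suc h ≈ x ⊗ x ^′ h
  ^′-suc x zero    = ≈-sym (CommutativeRing.*-identityʳ R x)
  ^′-suc x (suc h) = CommutativeRing.*-comm R (x ^′ suc h) x

  ^′-cong : ∀ {x y} h → x ≈ y → x ^′ h ≈ y ^′ h
  ^′-cong         zero          eq = ≈-refl
  ^′-cong         (suc zero)    eq = eq
  ^′-cong         (suc (suc h)) eq = *-cong (^′-cong (suc h) eq) eq

  -- The linear functional sending u^e to G e; repeated exponents are harmless, and no normal form
  -- is needed.
  ⟪_⟫ : Laurent → (ℤ → Carrier) → Carrier
  ⟪ [] ⟫          G = 0#
  ⟪ (c , e) ∷ p ⟫ G = ιℤ c ⊗ G e ⊕ ⟪ p ⟫ G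

  ⟪⟫-cong : ∀ p {G G′} → (∀ e → G e ≈ G′ e) → ⟪ p ⟫ G ≈ ⟪ p ⟫ G′
  ⟪⟫-cong []            eq = ≈-refl
  ⟪⟫-cong ((c , e) ∷ p) eq = +-cong (*-congˡ (eq e)) (⟪⟫-cong p eq)

  ⟪⟫-++ : ∀ p q G → ⟪ p List.++ q ⟫ G ≈ ⟪ p ⟫ G ⊕ ⟪ q ⟫ G
  ⟪⟫-++ []            q G = ≈-sym (CommutativeRing.+-identityˡ R (⟪ q ⟫ G))
  ⟪⟫-++ ((c , e) ∷ p) q G = ≈-trans (+-congˡ (⟪⟫-++ p q G)) (≈-sym (CommutativeRing.+-assoc R (ιℤ c ⊗ G e) (⟪ p ⟫ G) (⟪ q ⟫ G)))

  -- `f` stands for the pattern-matching lambda inside `_*ᴸ_` with its first argument fixed; the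
  -- hypothesis on it is then met by `refl`.
  ⟪⟫-map : ∀ c e f → (∀ c′ e′ → f (c′ , e′) ≡ (c ℤ.* c′ , e ℤ.+ e′)) →
    ∀ q G → ⟪ List.map f q ⟫ G ≈ ιℤ c ⊗ ⟪ q ⟫ (λ e′ → G (e ℤ.+ e′))
  ⟪⟫-map c e f f≡ []              G = ≈-sym (CommutativeRing.zeroʳ R (ιℤ c))
  ⟪⟫-map c e f f≡ ((c′ , e′) ∷ q) G rewrite f≡ c′ e′ = begin
    ιℤ (c ℤ.* c′) ⊗ G (e ℤ.+ e′) ⊕ ⟪ List.map f q ⟫ G
      ≈⟨ +-cong (*-congʳ (ιℤ-* c c′)) (⟪⟫-map c e f f≡ q G) ⟩
    ιℤ c ⊗ ιℤ c′ ⊗ G (e ℤ.+ e′) ⊕ ιℤ c ⊗ q′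
      ≈⟨ solveᴿ 4 (λ a b g q → a *′ b *′ g +′ a *′ q ≋ a *′ (b *′ g +′ q)) ≈-refl (ιℤ c) (ιℤ c′) (G (e ℤ.+ e′)) q′ ⟩
    ιℤ c ⊗ (ιℤ c′ ⊗ G (e ℤ.+ e′) ⊕ q′) ∎
    where q′ = ⟪ q ⟫ (λ e′ → G (e ℤ.+ e′))

  ⟪⟫-*ᴸ : ∀ p q G → ⟪ p *ᴸ q ⟫ G ≈ ⟪ p ⟫ (λ e → ⟪ q ⟫ (λ e′ → G (e ℤ.+ e′)))
  ⟪⟫-*ᴸ []            q G = ≈-refl
  ⟪⟫-*ᴸ ((c , e) ∷ p) q G = ≈-trans (⟪⟫-++ (List.map _ q) (p *ᴸ q) G)
    (+-cong (⟪⟫-map c e _ (λ _ _ → refl) q G) (⟪⟫-*ᴸ p q G))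

  binomial : ℤ → Laurent
  binomial r = (1ℤ , r) ∷ (1ℤ , ℤ.- r) ∷ []

  -- e ↦ C(ek) is not multiplicative, but u^r + u^-r still acts on it by a scalar.
  Eigen : (ℤ → Carrier) → ℤ → Carrier → Set
  Eigen G r μ = ∀ e → G (e ℤ.+ r) ⊕ G (e ℤ.- r) ≈ μ ⊗ G e

  -- Translations commute with the action of u^r + u^-r. This allows the factors of a product to be
  -- evaluated one at a time.
  shift-eigen : ∀ {G r μ} a → Eigen G r μ → Eigen (λ e → G (a ℤ.+ e)) r μ
  shift-eigen {G} {r} a eigen e = ≈-trans
    (+-cong (reflexive (cong G (sym (ℤ.+-assoc a e r)))) (reflexive (cong G (sym (ℤ.+-assoc a e (ℤ.- r))))))
    (eigen (a ℤ.+ e))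

  scale-eigen : ∀ {G r μ} c → Eigen G r μ → Eigen (λ e → c ⊗ G e) r μ
  scale-eigen {G} {r} {μ} c eigen e = begin
    c ⊗ G (e ℤ.+ r) ⊕ c ⊗ G (e ℤ.- r)    ≈⟨ CommutativeRing.distribˡ R c _ _ ⟨
    c ⊗ (G (e ℤ.+ r) ⊕ G (e ℤ.- r))      ≈⟨ *-congˡ (eigen e) ⟩
    c ⊗ (μ ⊗ G e)                        ≈⟨ solveᴿ 3 (λ c m g → c *′ (m *′ g) ≋ m *′ (c *′ g)) ≈-refl c μ (G e) ⟩
    μ ⊗ (c ⊗ G e)                        ∎

  ⟪1ᴸ⟫ : ∀ G → ⟪ 1ᴸ ⟫ G ≈ G 0ℤ
  ⟪1ᴸ⟫ G = begin
    ι 1ℚ ⊗ G 0ℤ ⊕ 0#       ≈⟨ +-congˡ 0-homo ⟨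
    ι 1ℚ ⊗ G 0ℤ ⊕ ι 0ℚ     ≈⟨ solveᴿ 1 (λ g → con′ 1ℚ *′ g +′ con′ 0ℚ ≋ g) ≈-refl (G 0ℤ) ⟩
    G 0ℤ                   ∎

  ⟪binomial⟫ : ∀ r G → ⟪ binomial r ⟫ G ≈ G r ⊕ G (ℤ.- r)
  ⟪binomial⟫ r G = begin
    ι 1ℚ ⊗ G r ⊕ (ι 1ℚ ⊗ G (ℤ.- r) ⊕ 0#)      ≈⟨ +-congˡ (+-congˡ 0-homo) ⟨
    ι 1ℚ ⊗ G r ⊕ (ι 1ℚ ⊗ G (ℤ.- r) ⊕ ι 0ℚ)    ≈⟨ solveᴿ 2 (λ a b → con′ 1ℚ *′ a +′ (con′ 1ℚ *′ b +′ con′ 0ℚ) ≋ a +′ b) ≈-refl (G r) (G (ℤ.- r)) ⟩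
    G r ⊕ G (ℤ.- r)                           ∎

  -- Evaluating h factors at all translates of G leaves the function e ↦ μʰ G e, again an
  -- eigenfunction, from which the last factor extracts one more μ.
  ⟪binomial^⟫ : ∀ {G r μ} → Eigen G r μ → ∀ h → ⟪ binomial r ^ᴸ h ⟫ G ≈ μ ^′ h ⊗ G 0ℤ
  ⟪binomial^⟫ {G} {r} {μ} eigen zero    = ≈-trans (⟪1ᴸ⟫ G) (≈-sym (CommutativeRing.*-identityˡ R (G 0ℤ)))
  ⟪binomial^⟫ {G} {r} {μ} eigen (suc h) = begin
    ⟪ binomial r *ᴸ binomial r ^ᴸ h ⟫ G
      ≈⟨ ⟪⟫-*ᴸ (binomial r) (binomial r ^ᴸ h) G ⟩
    ⟪ binomial r ⟫ (λ e → ⟪ binomial r ^ᴸ h ⟫ (λ e′ → G (e ℤ.+ e′)))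
      ≈⟨ ⟪⟫-cong (binomial r) (λ e → ≈-trans (⟪binomial^⟫ (shift-eigen {G} e eigen) h) (*-congˡ (reflexive (cong G (ℤ.+-identityʳ e))))) ⟩
    ⟪ binomial r ⟫ (λ e → μ ^′ h ⊗ G e)
      ≈⟨ ⟪binomial⟫ r (λ e → μ ^′ h ⊗ G e) ⟩
    μ ^′ h ⊗ G r ⊕ μ ^′ h ⊗ G (ℤ.- r)
      ≈⟨ +-cong (*-congˡ (reflexive (cong G (sym (ℤ.+-identityˡ r))))) (*-congˡ (reflexive (cong G (sym (ℤ.+-identityˡ (ℤ.- r)))))) ⟩
    μ ^′ h ⊗ G (0ℤ ℤ.+ r) ⊕ μ ^′ h ⊗ G (0ℤ ℤ.- r)
      ≈⟨ scale-eigen (μ ^′ h) eigen 0ℤ ⟩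
    μ ⊗ (μ ^′ h ⊗ G 0ℤ)
      ≈⟨ CommutativeRing.*-assoc R μ (μ ^′ h) (G 0ℤ) ⟨
    μ ⊗ μ ^′ h ⊗ G 0ℤ
      ≈⟨ *-congʳ (^′-suc μ h) ⟨
    μ ^′ suc h ⊗ G 0ℤ ∎

  ⟪∏binomial^⟫ : ∀ {t} (r : Vector ℤ t) (h : Vector ℕ t) (μ : Vector Carrier t) {G} → (∀ j → Eigen G (r j) (μ j)) →
    ⟪ foldr _*ᴸ_ 1ᴸ (λ j → binomial (r j) ^ᴸ h j) ⟫ G ≈ product (λ j → μ j ^′ h j) ⊗ G 0ℤ
  ⟪∏binomial^⟫ {zero}  r h μ {G} eigen = ≈-trans (⟪1ᴸ⟫ G) (≈-sym (CommutativeRing.*-identityˡ R (G 0ℤ)))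
  ⟪∏binomial^⟫ {suc t} r h μ {G} eigen = begin
    ⟪ b *ᴸ q ⟫ G
      ≈⟨ ⟪⟫-*ᴸ b q G ⟩
    ⟪ b ⟫ (λ e → ⟪ q ⟫ (λ e′ → G (e ℤ.+ e′)))
      ≈⟨ ⟪⟫-cong b (λ e → ≈-trans (⟪∏binomial^⟫ (r ∘ Fin.suc) (h ∘ Fin.suc) (μ ∘ Fin.suc) (λ j → shift-eigen {G} e (eigen (Fin.suc j))))
           (*-congˡ (reflexive (cong G (ℤ.+-identityʳ e))))) ⟩
    ⟪ b ⟫ (λ e → M ⊗ G e)
      ≈⟨ ⟪binomial^⟫ (scale-eigen M (eigen Fin.zero)) (h Fin.zero) ⟩
    μ Fin.zero ^′ h Fin.zero ⊗ (M ⊗ G 0ℤ)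
      ≈⟨ CommutativeRing.*-assoc R _ M (G 0ℤ) ⟨
    μ Fin.zero ^′ h Fin.zero ⊗ M ⊗ G 0ℤ ∎
    where
    b = binomial (r Fin.zero) ^ᴸ h Fin.zero
    q = foldr _*ᴸ_ 1ᴸ (λ j → binomial (r (Fin.suc j)) ^ᴸ h (Fin.suc j))
    M = product (λ j → μ (Fin.suc j) ^′ h (Fin.suc j))

  ∑-⟪⟫ : ∀ n p (G : ℕ → ℤ → Carrier) →
    sum {n} (λ k → ⟪ p ⟫ (G (toℕ k))) ≈ ⟪ p ⟫ (λ e → sum {n} (λ k → G (toℕ k) e))
  ∑-⟪⟫ n []            G = sum-replicate-zero n
  ∑-⟪⟫ n ((c , e) ∷ p) G = begin
    sum {n} (λ k → ιℤ c ⊗ G (toℕ k) e ⊕ ⟪ p ⟫ (G (toℕ k)))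
      ≈⟨ ∑-distrib-+ {n} (λ k → ιℤ c ⊗ G (toℕ k) e) (λ k → ⟪ p ⟫ (G (toℕ k))) ⟩
    sum {n} (λ k → ιℤ c ⊗ G (toℕ k) e) ⊕ sum {n} (λ k → ⟪ p ⟫ (G (toℕ k)))
      ≈⟨ +-cong (≈-sym (*-distribˡ-sum {n} (ιℤ c) (λ k → G (toℕ k) e))) (∑-⟪⟫ n p G) ⟩
    ιℤ c ⊗ sum {n} (λ k → G (toℕ k) e) ⊕ ⟪ p ⟫ (λ e → sum {n} (λ k → G (toℕ k) e)) ∎

  sum-pred : ∀ n .{{_ : ℕ.NonZero n}} (f : ℕ → Carrier) → sum {n} (f ∘ toℕ) ≈ f 0 ⊕ sum {ℕ.pred n} (λ k → f (suc (toℕ k)))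
  sum-pred (suc n) f = ≈-refl

  ^′-2# : ∀ h → 2# ^′ h ≈ ιℤ (+ (2 ℕ.^ h))
  ^′-2# zero    = ≈-sym 1-homo
  ^′-2# (suc h) = begin
    2# ^′ suc h                   ≈⟨ ^′-suc 2# h ⟩
    2# ⊗ 2# ^′ h                  ≈⟨ *-congˡ (^′-2# h) ⟩
    ιℤ (+ 2) ⊗ ιℤ (+ (2 ℕ.^ h))   ≈⟨ ιℤ-* (+ 2) (+ (2 ℕ.^ h)) ⟨
    ιℤ (+ 2 ℤ.* + (2 ℕ.^ h))      ≈⟨ reflexive (cong ιℤ (ℤ.pos-* 2 (2 ℕ.^ h))) ⟨
    ιℤ (+ (2 ℕ.^ suc h))          ∎

  product-2#^′ : ∀ {t} (h : Vector ℕ t) → product (λ j → 2# ^′ h j) ≈ ιℤ (+ (2 ℕ.^ foldr ℕ._+_ 0 h))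
  product-2#^′ {zero}  h = ≈-sym 1-homo
  product-2#^′ {suc t} h = begin
    2# ^′ h Fin.zero ⊗ product (λ j → 2# ^′ h (Fin.suc j))      ≈⟨ *-cong (^′-2# (h Fin.zero)) (product-2#^′ (h ∘ Fin.suc)) ⟩
    ιℤ (+ (2 ℕ.^ h Fin.zero)) ⊗ ιℤ (+ (2 ℕ.^ H′))               ≈⟨ ιℤ-* (+ (2 ℕ.^ h Fin.zero)) (+ (2 ℕ.^ H′)) ⟨
    ιℤ (+ (2 ℕ.^ h Fin.zero) ℤ.* + (2 ℕ.^ H′))                  ≈⟨ reflexive (cong ιℤ (trans (cong +_ (ℕ.^-distribˡ-+-* 2 (h Fin.zero) H′)) (ℤ.pos-* (2 ℕ.^ h Fin.zero) (2 ℕ.^ H′)))) ⟨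
    ιℤ (+ (2 ℕ.^ (h Fin.zero ℕ.+ H′)))                          ∎
    where H′ = foldr ℕ._+_ 0 (h ∘ Fin.suc)

  -- D j plays the role of cos(jπ/2n), and C k that of cos(2πk/n).
  module CosineValues
    (noZeroDivisors# : ∀ {x y} → x ⊗ y ≈ 0# → ¬ (x ≈ 0#) → y ≈ 0#)
    (2≉0 : ¬ (2# ≈ 0#))
    (n : ℕ)
    (D : ℤ → Carrier)
    (D-0 : D 0ℤ ≈ 1#)
    (D-product : ∀ i j → 2# ⊗ (D i ⊗ D j) ≈ D (i ℤ.+ j) ⊕ D (i ℤ.- j))
    (D-n : D (+ n) ≈ 0#)
    (D-nonzero : ∀ j → 0 ℕ.< j → j ℕ.< n → ¬ (D (+ j) ≈ 0#))
    where

    private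
      D-≡ : ∀ {i j} → i ≡ j → D i ≈ D j
      D-≡ i≡j = reflexive (cong D i≡j)

    1≉0 : ¬ (1# ≈ 0#)
    1≉0 1≈0 = 2≉0 (begin
      2#           ≈⟨ solveᴿ 0 (con′ 2ℚ ≋ con′ 2ℚ *′ con′ 1ℚ) ≈-refl ⟩
      2# ⊗ ι 1ℚ    ≈⟨ *-congˡ 1-homo ⟩
      2# ⊗ 1#      ≈⟨ *-congˡ 1≈0 ⟩
      2# ⊗ 0#      ≈⟨ CommutativeRing.zeroʳ R 2# ⟩
      0#           ∎)

    private
      ½-cancel : ∀ {x y} → 2# ⊗ x ≈ 2# ⊗ y → x ≈ y
      ½-cancel {x} {y} eq = begin
        x                 ≈⟨ solveᴿ 1 (λ x → x ≋ con′ ½ *′ (con′ 2ℚ *′ x)) ≈-refl x ⟩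
        ι ½ ⊗ (2# ⊗ x)    ≈⟨ *-congˡ eq ⟩
        ι ½ ⊗ (2# ⊗ y)    ≈⟨ solveᴿ 1 (λ x → con′ ½ *′ (con′ 2ℚ *′ x) ≋ x) ≈-refl y ⟩
        y                 ∎

      ⊕-cancelˡ : ∀ x {y z} → x ⊕ y ≈ x ⊕ z → y ≈ z
      ⊕-cancelˡ x {y} {z} eq = begin
        y              ≈⟨ solveᴿ 2 (λ x y → y ≋ -′ x +′ (x +′ y)) ≈-refl x y ⟩
        ⊖ x ⊕ (x ⊕ y)  ≈⟨ +-congˡ eq ⟩
        ⊖ x ⊕ (x ⊕ z)  ≈⟨ solveᴿ 2 (λ x y → -′ x +′ (x +′ y) ≋ y) ≈-refl x z ⟩
        z              ∎

    -- Parity, periods and the value 1 of the cosine on the grid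

    D-even : ∀ j → D (ℤ.- j) ≈ D j
    D-even j = ⊕-cancelˡ (D j) (begin
      D j ⊕ D (ℤ.- j)                  ≈⟨ +-cong (D-≡ (sym (ℤ.+-identityˡ j))) (D-≡ (sym (ℤ.+-identityˡ (ℤ.- j)))) ⟩
      D (0ℤ ℤ.+ j) ⊕ D (0ℤ ℤ.- j)      ≈⟨ D-product 0ℤ j ⟨
      2# ⊗ (D 0ℤ ⊗ D j)                ≈⟨ *-congˡ (*-congʳ (≈-trans D-0 (≈-sym 1-homo))) ⟩
      2# ⊗ (ι 1ℚ ⊗ D j)                ≈⟨ solveᴿ 1 (λ d → con′ 2ℚ *′ (con′ 1ℚ *′ d) ≋ d +′ d) ≈-refl (D j) ⟩
      D j ⊕ D j                        ∎)

    -- The product formula at j + n and n, where D n = 0; 2n steps are a half turn, so this is cos(θ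
    -- + π) = -cos θ.
    D-antiperiodic : ∀ j → D (j ℤ.+ + n ℤ.+ + n) ≈ ⊖ D j
    D-antiperiodic j = ⊕-cancelˡ (D j) (begin
      D j ⊕ D (j ℤ.+ + n ℤ.+ + n)                            ≈⟨ CommutativeRing.+-comm R _ _ ⟩
      D (j ℤ.+ + n ℤ.+ + n) ⊕ D j                            ≈⟨ +-congˡ (D-≡ (index j (+ n))) ⟩
      D (j ℤ.+ + n ℤ.+ + n) ⊕ D (j ℤ.+ + n ℤ.- + n)          ≈⟨ D-product (j ℤ.+ + n) (+ n) ⟨
      2# ⊗ (D (j ℤ.+ + n) ⊗ D (+ n))                         ≈⟨ *-congˡ (*-congˡ (≈-trans D-n (≈-sym 0-homo))) ⟩
      2# ⊗ (D (j ℤ.+ + n) ⊗ ι 0ℚ)                            ≈⟨ solveᴿ 2 (λ a b → con′ 2ℚ *′ (a *′ con′ 0ℚ) ≋ b -′ b) ≈-refl (D (j ℤ.+ + n)) (D j) ⟩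
      D j ⊕ ⊖ D j                                            ∎)
      where
      index : ∀ j n → j ≡ j ℤ.+ n ℤ.- n
      index = solve-∀

    D-periodic : ∀ j → D (j ℤ.+ + 4 ℤ.* + n) ≈ D j
    D-periodic j = begin
      D (j ℤ.+ + 4 ℤ.* + n)                       ≈⟨ D-≡ (index j (+ n)) ⟩
      D (j ℤ.+ + n ℤ.+ + n ℤ.+ + n ℤ.+ + n)       ≈⟨ D-antiperiodic (j ℤ.+ + n ℤ.+ + n) ⟩
      ⊖ D (j ℤ.+ + n ℤ.+ + n)                     ≈⟨ -‿cong (D-antiperiodic j) ⟩
      ⊖ ⊖ D j                                     ≈⟨ solveᴿ 1 (λ d → -′ -′ d ≋ d) ≈-refl (D j) ⟩
      D j                                         ∎
      where
      index : ∀ j n → j ℤ.+ + 4 ℤ.* n ≡ j ℤ.+ n ℤ.+ n ℤ.+ n ℤ.+ n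
      index = solve-∀

    D-nonzero-ℤ : ∀ i → ℤ.∣ i ∣ ℕ.< n → ¬ (D i ≈ 0#)
    D-nonzero-ℤ (+ zero)   i<n Di≈0 = 1≉0 (≈-trans (≈-sym D-0) Di≈0)
    D-nonzero-ℤ (+ suc j)  i<n Di≈0 = D-nonzero (suc j) (s≤s z≤n) i<n Di≈0
    D-nonzero-ℤ (-[1+ j ]) i<n Di≈0 = D-nonzero (suc j) (s≤s z≤n) i<n (≈-trans (≈-sym (D-even (+ suc j))) Di≈0)

    C : ℤ → Carrier
    C k = D (+ 4 ℤ.* k)

    private
      C-≡ : ∀ {i j} → i ≡ j → C i ≈ C j
      C-≡ i≡j = reflexive (cong C i≡j)

    C-0 : C 0ℤ ≈ 1#
    C-0 = D-0

    C-product : ∀ i j → 2# ⊗ (C i ⊗ C j) ≈ C (i ℤ.+ j) ⊕ C (i ℤ.- j)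
    C-product i j = ≈-trans (D-product (+ 4 ℤ.* i) (+ 4 ℤ.* j)) (+-cong (D-≡ (plus i j)) (D-≡ (minus i j)))
      where
      plus : ∀ i j → + 4 ℤ.* i ℤ.+ + 4 ℤ.* j ≡ + 4 ℤ.* (i ℤ.+ j)
      plus = solve-∀
      minus : ∀ i j → + 4 ℤ.* i ℤ.- + 4 ℤ.* j ≡ + 4 ℤ.* (i ℤ.- j)
      minus = solve-∀

    C-even : ∀ k → C (ℤ.- k) ≈ C k
    C-even k = ≈-trans (D-≡ (sym (ℤ.neg-distribʳ-* (+ 4) k))) (D-even (+ 4 ℤ.* k))

    C-periodic : ∀ k → C (k ℤ.+ + n) ≈ C k
    C-periodic k = ≈-trans (D-≡ (ℤ.*-distribˡ-+ (+ 4) k (+ n))) (D-periodic (+ 4 ℤ.* k))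

    C-periodic-ℕ* : ∀ k q → C (k ℤ.+ + q ℤ.* + n) ≈ C k
    C-periodic-ℕ* k zero    = C-≡ (trans (cong (λ z → k ℤ.+ z) (ℤ.*-zeroˡ (+ n))) (ℤ.+-identityʳ k))
    C-periodic-ℕ* k (suc q) = ≈-trans (C-≡ (index k (+ q) (+ n))) (≈-trans (C-periodic (k ℤ.+ + q ℤ.* + n)) (C-periodic-ℕ* k q))
      where
      index : ∀ k q n → k ℤ.+ (1ℤ ℤ.+ q) ℤ.* n ≡ k ℤ.+ q ℤ.* n ℤ.+ n
      index = solve-∀

    C-periodic-* : ∀ k q → C (k ℤ.+ q ℤ.* + n) ≈ C k
    C-periodic-* k (+ q)    = C-periodic-ℕ* k q
    C-periodic-* k -[1+ q ] = ≈-trans (≈-sym (C-periodic-ℕ* (k ℤ.+ -[1+ q ] ℤ.* + n) (suc q))) (C-≡ (index k (+ suc q) (+ n)))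
      where
      index : ∀ k q n → k ℤ.+ (ℤ.- q) ℤ.* n ℤ.+ q ℤ.* n ≡ k
      index = solve-∀

    -- If cos θ = 1 then 2cos²(π/2 − θ) = 1 − cos 2θ = 0, while
    -- π/2 − θ lies strictly between −π/2 and π/2.
    C-≉1-half : ∀ m → 0 ℕ.< m → 2 ℕ.* m ℕ.< n → ¬ (C (+ m) ≈ 1#)
    C-≉1-half m 0<m 2m<n Cm≈1 = Di≉0 (noZeroDivisors# Di²≈0 Di≉0)
      where
      θ i : ℤ
      θ = + 4 ℤ.* + m
      i = + n ℤ.- θ

      D2θ≈1 : D (θ ℤ.+ θ) ≈ 1#
      D2θ≈1 = ⊕-cancelˡ 1# (begin
        1# ⊕ D (θ ℤ.+ θ)               ≈⟨ CommutativeRing.+-comm R _ _ ⟩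
        D (θ ℤ.+ θ) ⊕ 1#               ≈⟨ +-congˡ (≈-trans (D-≡ (ℤ.+-inverseʳ θ)) D-0) ⟨
        D (θ ℤ.+ θ) ⊕ D (θ ℤ.- θ)      ≈⟨ D-product θ θ ⟨
        2# ⊗ (D θ ⊗ D θ)               ≈⟨ *-congˡ (*-cong (≈-trans Cm≈1 (≈-sym 1-homo)) (≈-trans Cm≈1 (≈-sym 1-homo))) ⟩
        2# ⊗ (ι 1ℚ ⊗ ι 1ℚ)             ≈⟨ solveᴿ 0 (con′ 2ℚ *′ (con′ 1ℚ *′ con′ 1ℚ) ≋ con′ 1ℚ +′ con′ 1ℚ) ≈-refl ⟩
        ι 1ℚ ⊕ ι 1ℚ                    ≈⟨ +-cong 1-homo 1-homo ⟩
        1# ⊕ 1#                        ∎)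

      Di²≈0 : D i ⊗ D i ≈ 0#
      Di²≈0 = ½-cancel (begin
        2# ⊗ (D i ⊗ D i)                                   ≈⟨ D-product i i ⟩
        D (i ℤ.+ i) ⊕ D (i ℤ.- i)                          ≈⟨ +-cong (D-≡ (index (+ n) θ)) (≈-trans (D-≡ (ℤ.+-inverseʳ i)) D-0) ⟩
        D (ℤ.- (θ ℤ.+ θ) ℤ.+ + n ℤ.+ + n) ⊕ 1#             ≈⟨ +-congʳ (D-antiperiodic (ℤ.- (θ ℤ.+ θ))) ⟩
        ⊖ D (ℤ.- (θ ℤ.+ θ)) ⊕ 1#                           ≈⟨ +-congʳ (-‿cong (≈-trans (D-even (θ ℤ.+ θ)) D2θ≈1)) ⟩
        ⊖ 1# ⊕ 1#                                          ≈⟨ CommutativeRing.-‿inverseˡ R 1# ⟩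
        0#                                                 ≈⟨ CommutativeRing.zeroʳ R 2# ⟨
        2# ⊗ 0#                                            ∎)
        where
        index : ∀ n θ → (n ℤ.- θ) ℤ.+ (n ℤ.- θ) ≡ ℤ.- (θ ℤ.+ θ) ℤ.+ n ℤ.+ n
        index = solve-∀

      ∣i∣<n : ℤ.∣ i ∣ ℕ.< n
      ∣i∣<n with ℕ.m≤n⇒∃[o]m+o≡n 2m<n
      -- With n = 1 + 2m + k the index is (1 + k) - 2m, so |i| ≤ max(1 + k, 2m). The first entry is
      -- below n because m > 0, the second because k ≥ 0.
      ... | k , refl = subst (λ z → ℤ.∣ z ∣ ℕ.< suc (2 ℕ.* m) ℕ.+ k) (sym i≡)
            (ℕ.≤-<-trans (ℤ.∣m⊝n∣≤m⊔n (suc k) (2 ℕ.* m)) (ℕ.⊔-pres-<m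
              (subst (suc k ℕ.<_) (ℕ-lem m k) (ℕ.m<n+m (suc k) (ℕ.*-monoʳ-< 2 0<m)))
              (s≤s (ℕ.m≤m+n (2 ℕ.* m) k))))
        where
        ℕ-lem : ∀ m k → 2 ℕ.* m ℕ.+ suc k ≡ suc (2 ℕ.* m) ℕ.+ k
        ℕ-lem m k = ℕ.+-suc (2 ℕ.* m) k
        i≡ : i ≡ suc k ℤ.⊖ (2 ℕ.* m)
        i≡ = trans (trans (cong (λ z → z ℤ.- + 4 ℤ.* + m) (trans (ℤ.pos-+ (suc (2 ℕ.* m)) k) (cong (λ z → 1ℤ ℤ.+ z ℤ.+ + k) (ℤ.pos-* 2 m))))
               (index (+ m) (+ k))) (trans (cong (λ z → (1ℤ ℤ.+ + k) ℤ.- z) (sym (ℤ.pos-* 2 m))) (ℤ.m-n≡m⊖n (suc k) (2 ℕ.* m)))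
          where
          index : ∀ m k → 1ℤ ℤ.+ + 2 ℤ.* m ℤ.+ k ℤ.- + 4 ℤ.* m ≡ (1ℤ ℤ.+ k) ℤ.- + 2 ℤ.* m
          index = solve-∀

      Di≉0 : ¬ (D i ≈ 0#)
      Di≉0 = D-nonzero-ℤ i ∣i∣<n

    -- At 2m = n the index n - 4m of the previous argument is -n, where D vanishes; there C m = cos
    -- π = -1 is used instead. Beyond the half period, C (n - m) = C m reduces to the first half.
    C-≉1 : ∀ m → 0 ℕ.< m → m ℕ.< n → ¬ (C (+ m) ≈ 1#)
    C-≉1 m 0<m m<n Cm≈1 with ℕ.<-cmp (2 ℕ.* m) n
    ... | tri< 2m<n _ _ = C-≉1-half m 0<m 2m<n Cm≈1
    ... | tri≈ _ 2m≡n _ = 2≉0 (begin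
        2#              ≈⟨ solveᴿ 0 (con′ 2ℚ ≋ con′ 1ℚ +′ con′ 1ℚ) ≈-refl ⟩
        ι 1ℚ ⊕ ι 1ℚ     ≈⟨ +-cong 1-homo 1-homo ⟩
        1# ⊕ 1#         ≈⟨ +-congʳ Cm≈1 ⟨
        C (+ m) ⊕ 1#    ≈⟨ +-congʳ Cm≈-1 ⟩
        ⊖ 1# ⊕ 1#       ≈⟨ CommutativeRing.-‿inverseˡ R 1# ⟩
        0#              ∎)
      where
      index : ∀ m → + 4 ℤ.* m ≡ 0ℤ ℤ.+ + 2 ℤ.* m ℤ.+ + 2 ℤ.* m
      index = solve-∀
      Cm≈-1 : C (+ m) ≈ ⊖ 1#
      Cm≈-1 = begin
        C (+ m)                              ≈⟨ D-≡ (index (+ m)) ⟩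
        D (0ℤ ℤ.+ + 2 ℤ.* + m ℤ.+ + 2 ℤ.* + m) ≈⟨ D-≡ (cong (λ z → 0ℤ ℤ.+ z ℤ.+ z) (trans (sym (ℤ.pos-* 2 m)) (cong +_ 2m≡n))) ⟩
        D (0ℤ ℤ.+ + n ℤ.+ + n)               ≈⟨ D-antiperiodic 0ℤ ⟩
        ⊖ D 0ℤ                               ≈⟨ -‿cong D-0 ⟩
        ⊖ 1#                                 ∎
    ... | tri> _ _ n<2m = C-≉1-half (n ℕ.∸ m) (ℕ.m<n⇒0<n∸m m<n) (2*[n∸m]<n m<n n<2m) (begin
        C (+ (n ℕ.∸ m))            ≈⟨ C-≡ (trans (sym (ℤ.⊖-≥ (ℕ.<⇒≤ m<n))) (trans (sym (ℤ.m-n≡m⊖n n m)) (ℤ.+-comm (+ n) (ℤ.- + m)))) ⟩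
        C (ℤ.- + m ℤ.+ + n)        ≈⟨ C-periodic (ℤ.- + m) ⟩
        C (ℤ.- + m)                ≈⟨ C-even (+ m) ⟩
        C (+ m)                    ≈⟨ Cm≈1 ⟩
        1#                         ∎)

    -- Cosine sums over a period

    powerSum : ℤ → Carrier
    powerSum e = sum {n} (λ k → C (e ℤ.* + toℕ k))

    powerSum-0 : powerSum 0ℤ ≈ ι (+ n / 1)
    powerSum-0 = go n
      where
      go : ∀ n → sum {n} (λ k → C (0ℤ ℤ.* + toℕ k)) ≈ ι (+ n / 1)
      go zero    = ≈-sym 0-homo
      go (suc n) = begin
        C 0ℤ ⊕ sum {n} (λ k → C 0ℤ)    ≈⟨ +-cong (≈-trans C-0 (≈-sym 1-homo)) (go n) ⟩
        ι 1ℚ ⊕ ι (+ n / 1)             ≈⟨ +-homo 1ℚ (+ n / 1) ⟨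
        ι (1ℚ ℚ.+ + n / 1)             ≈⟨ reflexive (cong ι (1+/1 n)) ⟨
        ι (+ suc n / 1)                ∎
        where
        1+/1 : ∀ n → + suc n / 1 ≡ 1ℚ ℚ.+ + n / 1
        1+/1 n = trans (sym (fromℕℚ-def (suc n))) (trans (fromℕℚ-suc n) (cong (1ℚ ℚ.+_) (fromℕℚ-def n)))

    powerSum-eigen : ∀ e → C e ⊗ powerSum e ≈ powerSum e
    powerSum-eigen e = ½-cancel (begin
      2# ⊗ (C e ⊗ powerSum e)
        ≈⟨ *-congˡ (*-distribˡ-sum {n} (C e) (λ k → C (e ℤ.* + toℕ k))) ⟩
      2# ⊗ sum {n} (λ k → C e ⊗ C (e ℤ.* + toℕ k))
        ≈⟨ *-distribˡ-sum {n} 2# (λ k → C e ⊗ C (e ℤ.* + toℕ k)) ⟩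
      sum {n} (λ k → 2# ⊗ (C e ⊗ C (e ℤ.* + toℕ k)))
        ≈⟨ sum-cong-≋ {n} (λ k → step (toℕ k)) ⟩
      sum {n} (λ k → g (suc (toℕ k)) ⊕ g′ (toℕ k))
        ≈⟨ ∑-distrib-+ {n} (λ k → g (suc (toℕ k))) (λ k → g′ (toℕ k)) ⟩
      sum {n} (λ k → g (suc (toℕ k))) ⊕ sum {n} (λ k → g′ (toℕ k))
        -- g n = C (e n) = C 0 = g 0, and likewise for g′, so moving the summation index by one
        -- leaves both sums over the period unchanged; moreover g′ (k + 1) = g k.
        ≈⟨ +-cong (shift g (C-cycle 0ℤ g (λ k → C-≡ (sym (ℤ.+-identityˡ (e ℤ.* + k))))))
                  (≈-trans (≈-sym (shift g′ (C-cycle (ℤ.- e) g′ (λ k → C-≡ (ℤ.+-comm (e ℤ.* + k) (ℤ.- e))))))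
                    (sum-cong-≋ {n} (λ k → C-≡ (back e (+ toℕ k))))) ⟩
      powerSum e ⊕ powerSum e
        ≈⟨ solveᴿ 1 (λ s → s +′ s ≋ con′ 2ℚ *′ s) ≈-refl (powerSum e) ⟩
      2# ⊗ powerSum e ∎)
      where
      g g′ : ℕ → Carrier
      g  k = C (e ℤ.* + k)
      g′ k = C (e ℤ.* + k ℤ.- e)
      C-cycle : ∀ a (f : ℕ → Carrier) → (∀ k → f k ≈ C (a ℤ.+ e ℤ.* + k)) → f n ≈ f 0
      C-cycle a f f≈ = ≈-trans (f≈ n) (≈-trans (C-periodic-* a e)
        (≈-trans (C-≡ (sym (trans (cong (λ z → a ℤ.+ z) (ℤ.*-zeroʳ e)) (ℤ.+-identityʳ a)))) (≈-sym (f≈ 0))))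
      step : ∀ k → 2# ⊗ (C e ⊗ C (e ℤ.* + k)) ≈ g (suc k) ⊕ g′ k
      step k = ≈-trans (*-congˡ (CommutativeRing.*-comm R (C e) (g k))) (≈-trans (C-product (e ℤ.* + k) e) (+-congʳ (C-≡ (next e (+ k)))))
        where
        next : ∀ e k → e ℤ.* k ℤ.+ e ≡ e ℤ.* (1ℤ ℤ.+ k)
        next = solve-∀
      back : ∀ e k → e ℤ.* (1ℤ ℤ.+ k) ℤ.- e ≡ e ℤ.* k
      back = solve-∀
      shift : ∀ f → f n ≈ f 0 → sum {n} (f ∘ suc ∘ toℕ) ≈ sum {n} (f ∘ toℕ)
      shift f fn≈f0 = ⊕-cancelˡ (f 0) (begin
        f 0 ⊕ sum {n} (f ∘ suc ∘ toℕ)     ≈⟨ CommutativeRing.+-comm R _ _ ⟩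
        sum {n} (f ∘ suc ∘ toℕ) ⊕ f 0     ≈⟨ sum-shift n f ⟩
        sum {n} (f ∘ toℕ) ⊕ f n           ≈⟨ +-congˡ fn≈f0 ⟩
        sum {n} (f ∘ toℕ) ⊕ f 0           ≈⟨ CommutativeRing.+-comm R _ _ ⟩
        f 0 ⊕ sum {n} (f ∘ toℕ)           ∎)

    powerSum-≢0 : ∀ e → e ≢ 0ℤ → ℤ.∣ e ∣ ℕ.< n → powerSum e ≈ 0#
    powerSum-≢0 e e≢0 ∣e∣<n = noZeroDivisors# [1-C]s≈0 1-C≉0
      where
      [1-C]s≈0 : (1# ⊕ ⊖ C e) ⊗ powerSum e ≈ 0#
      [1-C]s≈0 = begin
        (1# ⊕ ⊖ C e) ⊗ powerSum e                ≈⟨ *-congʳ (+-congʳ 1-homo) ⟨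
        (ι 1ℚ ⊕ ⊖ C e) ⊗ powerSum e              ≈⟨ solveᴿ 2 (λ c s → (con′ 1ℚ -′ c) *′ s ≋ s -′ c *′ s) ≈-refl (C e) (powerSum e) ⟩
        powerSum e ⊕ ⊖ (C e ⊗ powerSum e)        ≈⟨ +-congˡ (-‿cong (powerSum-eigen e)) ⟩
        powerSum e ⊕ ⊖ powerSum e                ≈⟨ CommutativeRing.-‿inverseʳ R (powerSum e) ⟩
        0#                                       ∎
      C-∣∣ : ∀ e → C (+ ℤ.∣ e ∣) ≈ C e
      C-∣∣ (+ _)    = ≈-refl
      C-∣∣ -[1+ k ] = ≈-sym (C-even (+ suc k))
      1-C≉0 : ¬ (1# ⊕ ⊖ C e ≈ 0#)
      1-C≉0 eq = C-≉1 ℤ.∣ e ∣ (ℕ.n≢0⇒n>0 (e≢0 ∘ ℤ.∣i∣≡0⇒i≡0)) ∣e∣<n (begin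
        C (+ ℤ.∣ e ∣)              ≈⟨ C-∣∣ e ⟩
        C e                        ≈⟨ CommutativeRing.+-identityˡ R (C e) ⟨
        0# ⊕ C e                   ≈⟨ +-congʳ eq ⟨
        (1# ⊕ ⊖ C e) ⊕ C e         ≈⟨ solveᴿ 2 (λ a b → (a -′ b) +′ b ≋ a) ≈-refl 1# (C e) ⟩
        1#                         ∎)

    -- A listed exponent e ≠ 0 has |e| ≤ b < n, so its sum vanishes; each entry with e = 0
    -- contributes n times its coefficient. The case split is the one by which `coeffAt` collects.
    ⟪⟫-powerSum : ∀ {b} → b ℕ.< n → ∀ p → ExponentsWithin b p → ⟪ p ⟫ powerSum ≈ ιℤ (+ n ℤ.* coeffAt 0ℤ p)
    ⟪⟫-powerSum b<n []            []        = ≈-trans (≈-sym 0-homo) (reflexive (cong ιℤ (sym (ℤ.*-zeroʳ (+ n)))))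
    ⟪⟫-powerSum b<n ((c , e) ∷ p) (e≤b ∷ p≤b) with e ℤ.≟ 0ℤ
    ... | yes refl = begin
        ιℤ c ⊗ powerSum 0ℤ ⊕ ⟪ p ⟫ powerSum                    ≈⟨ +-cong (*-congˡ powerSum-0) (⟪⟫-powerSum b<n p p≤b) ⟩
        ιℤ c ⊗ ιℤ (+ n) ⊕ ιℤ (+ n ℤ.* coeffAt 0ℤ p)            ≈⟨ +-congʳ (ιℤ-* c (+ n)) ⟨
        ιℤ (c ℤ.* + n) ⊕ ιℤ (+ n ℤ.* coeffAt 0ℤ p)             ≈⟨ ιℤ-+ (c ℤ.* + n) (+ n ℤ.* coeffAt 0ℤ p) ⟨
        ιℤ (c ℤ.* + n ℤ.+ + n ℤ.* coeffAt 0ℤ p)                ≈⟨ reflexive (cong ιℤ (collect c (+ n) (coeffAt 0ℤ p))) ⟩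
        ιℤ (+ n ℤ.* (c ℤ.+ coeffAt 0ℤ p))                      ∎
      where
      collect : ∀ c n x → c ℤ.* n ℤ.+ n ℤ.* x ≡ n ℤ.* (c ℤ.+ x)
      collect = solve-∀
    ... | no e≢0 = begin
        ιℤ c ⊗ powerSum e ⊕ ⟪ p ⟫ powerSum                     ≈⟨ +-cong (*-congˡ (powerSum-≢0 e e≢0 (ℕ.≤-<-trans e≤b b<n))) (⟪⟫-powerSum b<n p p≤b) ⟩
        ιℤ c ⊗ 0# ⊕ ιℤ (+ n ℤ.* coeffAt 0ℤ p)                  ≈⟨ +-congʳ (CommutativeRing.zeroʳ R (ιℤ c)) ⟩
        0# ⊕ ιℤ (+ n ℤ.* coeffAt 0ℤ p)                         ≈⟨ CommutativeRing.+-identityˡ R _ ⟩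
        ιℤ (+ n ℤ.* coeffAt 0ℤ p)                              ∎

    C-eigen : ∀ r k → Eigen (λ e → C (e ℤ.* k)) r (2# ⊗ C (r ℤ.* k))
    C-eigen r k e = begin
      C ((e ℤ.+ r) ℤ.* k) ⊕ C ((e ℤ.- r) ℤ.* k)                    ≈⟨ +-cong (C-≡ (plus e r k)) (C-≡ (minus e r k)) ⟩
      C (e ℤ.* k ℤ.+ r ℤ.* k) ⊕ C (e ℤ.* k ℤ.- r ℤ.* k)            ≈⟨ C-product (e ℤ.* k) (r ℤ.* k) ⟨
      2# ⊗ (C (e ℤ.* k) ⊗ C (r ℤ.* k))                             ≈⟨ solveᴿ 3 (λ a b c → a *′ (b *′ c) ≋ (a *′ c) *′ b) ≈-refl 2# (C (e ℤ.* k)) (C (r ℤ.* k)) ⟩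
      2# ⊗ C (r ℤ.* k) ⊗ C (e ℤ.* k)                               ∎
      where
      plus : ∀ e r k → (e ℤ.+ r) ℤ.* k ≡ e ℤ.* k ℤ.+ r ℤ.* k
      plus = solve-∀
      minus : ∀ e r k → (e ℤ.- r) ℤ.* k ≡ e ℤ.* k ℤ.- r ℤ.* k
      minus = solve-∀

    -- The pattern sum

    module _ (P : Pattern) where
      -- The k-th summand with r k not reduced modulo n, so that k = 0, which is outside `Ω n`, is
      -- allowed.
      patternTerm : ℕ → Carrier
      patternTerm k = product (λ j → (2# ⊗ C (r P j ℤ.* + k)) ^′ h P j)

      patternTerm-⟪⟫ : ∀ k → ⟪ patternLaurent P ⟫ (λ e → C (e ℤ.* + k)) ≈ patternTerm k
      patternTerm-⟪⟫ k = begin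
        ⟪ patternLaurent P ⟫ (λ e → C (e ℤ.* + k))   ≈⟨ ⟪∏binomial^⟫ (r P) (h P) _ (λ j → C-eigen (r P j) (+ k)) ⟩
        patternTerm k ⊗ C (0ℤ ℤ.* + k)               ≈⟨ *-congˡ C-0 ⟩
        patternTerm k ⊗ 1#                           ≈⟨ CommutativeRing.*-identityʳ R (patternTerm k) ⟩
        patternTerm k                                ∎

      -- Every cosine is 1 at k = 0. This is the origin of the subtracted 2^H: the full period
      -- includes k = 0, the pattern sum does not.
      patternTerm-0 : patternTerm 0 ≈ ιℤ (+ (2 ℕ.^ H P))
      patternTerm-0 = ≈-trans
        (product-cong (λ j → ^′-cong (h P j) (≈-trans (*-congˡ (≈-trans (C-≡ (ℤ.*-zeroʳ (r P j))) C-0)) (CommutativeRing.*-identityʳ R 2#))))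
        (product-2#^′ (h P))

      ∑-patternTerm : .{{_ : ℕ.NonZero n}} → B P ℕ.< n →
        sum {ℕ.pred n} (λ k → patternTerm (suc (toℕ k))) ≈ ιℤ (+ n ℤ.* S 0ℤ P ℤ.- + (2 ℕ.^ H P))
      ∑-patternTerm B<n = ⊕-cancelˡ (ιℤ (+ (2 ℕ.^ H P))) (begin
        ιℤ (+ (2 ℕ.^ H P)) ⊕ sum {ℕ.pred n} (λ k → patternTerm (suc (toℕ k)))
          ≈⟨ +-congʳ patternTerm-0 ⟨
        patternTerm 0 ⊕ sum {ℕ.pred n} (λ k → patternTerm (suc (toℕ k)))
          ≈⟨ sum-pred n patternTerm ⟨
        sum {n} (λ k → patternTerm (toℕ k))
          ≈⟨ sum-cong-≋ {n} (λ k → patternTerm-⟪⟫ (toℕ k)) ⟨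
        sum {n} (λ k → ⟪ patternLaurent P ⟫ (λ e → C (e ℤ.* + toℕ k)))
          ≈⟨ ∑-⟪⟫ n (patternLaurent P) (λ k e → C (e ℤ.* + k)) ⟩
        ⟪ patternLaurent P ⟫ powerSum
          ≈⟨ ⟪⟫-powerSum B<n (patternLaurent P) (patternLaurent-within P) ⟩
        ιℤ (+ n ℤ.* S 0ℤ P)
          ≈⟨ reflexive (cong ιℤ (split (+ n ℤ.* S 0ℤ P) (+ (2 ℕ.^ H P)))) ⟩
        ιℤ (+ (2 ℕ.^ H P) ℤ.+ (+ n ℤ.* S 0ℤ P ℤ.- + (2 ℕ.^ H P)))
          ≈⟨ ιℤ-+ (+ (2 ℕ.^ H P)) (+ n ℤ.* S 0ℤ P ℤ.- + (2 ℕ.^ H P)) ⟩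
        ιℤ (+ (2 ℕ.^ H P)) ⊕ ιℤ (+ n ℤ.* S 0ℤ P ℤ.- + (2 ℕ.^ H P)) ∎)
        where
        split : ∀ a b → a ≡ b ℤ.+ (a ℤ.- b)
        split = solve-∀

      patternSum : .{{_ : ℕ.NonZero n}} → B P ℕ.< n → (coprime : ∀ j → ℤ.gcd (r P j) (+ n) ≡ 1ℤ) →
        (x : Ω n → Carrier) → (∀ k → x k ≈ C (+ ⟦ k ⟧Ω)) →
        sum (λ k → product (λ j → (2# ⊗ x (σ n (r P j) (coprime j) k)) ^′ h P j)) ≈ ιℤ (+ n ℤ.* S 0ℤ P ℤ.- + (2 ℕ.^ H P))
      patternSum B<n coprime x x≈C = ≈-trans
        (sum-cong-≋ {ℕ.pred n} (λ k → product-cong (λ j → ^′-cong (h P j) (*-cong (≈-refl {2#}) (permuted j k)))))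
        (∑-patternTerm B<n)
        where
        -- `σ` returns the residue of r k modulo n, which differs from r k by a multiple of the
        -- period of C.
        permuted : ∀ j k → x (σ n (r P j) (coprime j) k) ≈ C (r P j ℤ.* + ⟦ k ⟧Ω)
        permuted j k = begin
          x (σ n (r P j) (coprime j) k)                    ≈⟨ x≈C (σ n (r P j) (coprime j) k) ⟩
          C (+ ⟦ σ n (r P j) (coprime j) k ⟧Ω)             ≈⟨ C-≡ (cong +_ (σ-spec n (r P j) (coprime j) k)) ⟩
          C (+ (m ℤ.%ℕ n))                                 ≈⟨ C-periodic-* (+ (m ℤ.%ℕ n)) (m ℤ./ℕ n) ⟨
          C (+ (m ℤ.%ℕ n) ℤ.+ (m ℤ./ℕ n) ℤ.* + n)          ≈⟨ C-≡ (ℤ.a≡a%ℕn+[a/ℕn]*n m n) ⟨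
          C m                                              ∎
          where m = r P j ℤ.* + ⟦ k ⟧Ω

-- The angles jπ/2n

+-/ : ∀ n .{{_ : ℕ.NonZero n}} i j → (i ℤ.+ j) / n ≡ i / n ℚ.+ j / n
+-/ n i j = begin
  (i ℤ.+ j) / n                                            ≡⟨ /≡*1/ (i ℤ.+ j) n ⟩
  ((i ℤ.+ j) / 1) ℚ.* (+ 1 / n)                            ≡⟨ cong (ℚ._* (+ 1 / n)) (+-/1 i j) ⟩
  (i / 1 ℚ.+ j / 1) ℚ.* (+ 1 / n)                          ≡⟨ ℚ.*-distribʳ-+ (+ 1 / n) (i / 1) (j / 1) ⟩
  (i / 1) ℚ.* (+ 1 / n) ℚ.+ (j / 1) ℚ.* (+ 1 / n)          ≡⟨ cong₂ ℚ._+_ (/≡*1/ i n) (/≡*1/ j n) ⟨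
  i / n ℚ.+ j / n                                          ∎
  where open ≡-Reasoning

neg-/ : ∀ n .{{_ : ℕ.NonZero n}} i → (ℤ.- i) / n ≡ ℚ.- (i / n)
neg-/ n i = begin
  (ℤ.- i) / n                      ≡⟨ /≡*1/ (ℤ.- i) n ⟩
  ((ℤ.- i) / 1) ℚ.* (+ 1 / n)      ≡⟨ cong (ℚ._* (+ 1 / n)) (neg-/1 i) ⟩
  ℚ.- (i / 1) ℚ.* (+ 1 / n)        ≡⟨ ℚ.neg-distribˡ-* (i / 1) (+ 1 / n) ⟨
  ℚ.- ((i / 1) ℚ.* (+ 1 / n))      ≡⟨ cong ℚ.-_ (/≡*1/ i n) ⟨
  ℚ.- (i / n)                      ∎
  where open ≡-Reasoning

n/n≡1 : ∀ n .{{_ : ℕ.NonZero n}} → + n / n ≡ 1ℚ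
n/n≡1 n = begin
  + n / n                       ≡⟨ /≡*1/ (+ n) n ⟩
  (+ n / 1) ℚ.* (+ 1 / n)       ≡⟨ ℚ.*-comm (+ n / 1) (+ 1 / n) ⟩
  (+ 1 / n) ℚ.* (+ n / 1)       ≡⟨ cong ((+ 1 / n) ℚ.*_) (fromℕℚ-def n) ⟨
  (+ 1 / n) ℚ.* fromℕℚ n        ≡⟨ 1/* n ⟩
  1ℚ                            ∎
  where open ≡-Reasoning

0</ : ∀ m n .{{_ : ℕ.NonZero n}} → 0 ℕ.< m → 0ℚ ℚ.< + m / n
0</ (suc m) n _ = ℚ.positive⁻¹ (+ suc m / n) {{ℚ.normalize-pos (suc m) n}}

module Angles (π : ℝ) (isPi : IsPi π) (n : ℕ) .{{_ : ℕ.NonZero n}} where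
  open IsPi isPi

  -- Rational multiples of a single sequence for π/2, so identities between angles reduce termwise
  -- to arithmetic of fractions.
  angle : ℤ → ℝ
  angle j = fromℚ (j / n) * ½π

  angle-0 : angle 0ℤ ≃ 0ℝ
  angle-0 = ≃-pointwise {angle 0ℤ} {0ℝ} λ k → trans (cong (ℚ._* seq ½π k) (ℚ.0/n≡0 n)) (ℚ.*-zeroˡ (seq ½π k))

  angle-n : angle (+ n) ≃ ½π
  angle-n = ≃-pointwise {angle (+ n)} {½π} λ k → trans (cong (ℚ._* seq ½π k) (n/n≡1 n)) (ℚ.*-identityˡ (seq ½π k))

  angle-+ : ∀ i j → angle i + angle j ≃ angle (i ℤ.+ j)
  angle-+ i j = ≃-pointwise {angle i + angle j} {angle (i ℤ.+ j)} λ k → sym (trans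
    (cong (ℚ._* seq ½π k) (+-/ n i j)) (ℚ.*-distribʳ-+ (seq ½π k) (i / n) (j / n)))

  angle-- : ∀ i j → angle i + - angle j ≃ angle (i ℤ.- j)
  angle-- i j = ≃-pointwise {angle i + - angle j} {angle (i ℤ.- j)} λ k → sym (trans
    (cong (ℚ._* seq ½π k) (trans (+-/ n i (ℤ.- j)) (cong ((i / n) ℚ.+_) (neg-/ n j))))
    (solve 3 (λ a b c → (a :+ :- b) :* c := a :* c :+ :- (b :* c)) refl (i / n) (j / n) (seq ½π k)))

  0<angle : ∀ j → 0 ℕ.< j → 0ℝ < angle (+ j)
  0<angle j 0<j = let ε , 0<ε , N , below = positive in
    (+ j / n) ℚ.* ε , 0<* (0</ j n 0<j) 0<ε , N , λ k N≤k → subst (ℚ._< (+ j / n) ℚ.* seq ½π k)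
      (trans (cong ((+ j / n) ℚ.*_) (ℚ.+-identityˡ ε)) (sym (ℚ.+-identityˡ _)))
      (ℚ.*-monoʳ-<-pos (+ j / n) {{ℚ.positive (0</ j n 0<j)}} (below k N≤k))

  -- The gap is (n - j)/n times π/2, so the ε that witnesses 0 < π/2 is scaled by (n - j)/n.
  angle<½π : ∀ j → j ℕ.< n → angle (+ j) < ½π
  angle<½π j j<n = let ε , 0<ε , N , below = positive in
    p ℚ.* ε , 0<* 0<p 0<ε , N , λ k N≤k → subst ((q ℚ.* seq ½π k ℚ.+ p ℚ.* ε) ℚ.<_) (q+p k)
      (ℚ.+-monoʳ-< (q ℚ.* seq ½π k) (ℚ.*-monoʳ-<-pos p {{ℚ.positive 0<p}} (subst (ℚ._< seq ½π k) (ℚ.+-identityˡ ε) (below k N≤k))))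
    where
    q p : ℚ
    q = + j / n
    p = + (n ℕ.∸ j) / n
    0<p : 0ℚ ℚ.< p
    0<p = 0</ (n ℕ.∸ j) n (ℕ.m<n⇒0<n∸m j<n)
    q+p : ∀ k → q ℚ.* seq ½π k ℚ.+ p ℚ.* seq ½π k ≡ seq ½π k
    q+p k = begin
      q ℚ.* seq ½π k ℚ.+ p ℚ.* seq ½π k              ≡⟨ ℚ.*-distribʳ-+ (seq ½π k) q p ⟨
      (q ℚ.+ p) ℚ.* seq ½π k                         ≡⟨ cong (ℚ._* seq ½π k) (+-/ n (+ j) (+ (n ℕ.∸ j))) ⟨
      (+ (j ℕ.+ (n ℕ.∸ j)) / n) ℚ.* seq ½π k         ≡⟨ cong (λ m → (+ m / n) ℚ.* seq ½π k) (ℕ.m+[n∸m]≡n (ℕ.<⇒≤ j<n)) ⟩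
      (+ n / n) ℚ.* seq ½π k                         ≡⟨ cong (ℚ._* seq ½π k) (n/n≡1 n) ⟩
      1ℚ ℚ.* seq ½π k                                ≡⟨ ℚ.*-identityˡ (seq ½π k) ⟩
      seq ½π k                                       ∎
      where open ≡-Reasoning

  D : ℤ → ℝ
  D j = cos (angle j)

  D-0 : D 0ℤ ≃ 1ℝ
  D-0 = ≃-trans {D 0ℤ} {cos 0ℝ} {1ℝ} (cos-cong {angle 0ℤ} {0ℝ} angle-0) cos-0

  D-product : ∀ i j → fromℚ 2ℚ * (D i * D j) ≃ D (i ℤ.+ j) + D (i ℤ.- j)
  D-product i j = ≃-trans {fromℚ 2ℚ * (D i * D j)} {cos (angle i + angle j) + cos (angle i + - angle j)} {D (i ℤ.+ j) + D (i ℤ.- j)}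
    (cos-product (angle i) (angle j))
    (+ℝ-cong {cos (angle i + angle j)} {D (i ℤ.+ j)} {cos (angle i + - angle j)} {D (i ℤ.- j)}
      (cos-cong {angle i + angle j} {angle (i ℤ.+ j)} (angle-+ i j))
      (cos-cong {angle i + - angle j} {angle (i ℤ.- j)} (angle-- i j)))

  D-n : D (+ n) ≃ 0ℝ
  D-n = ≃-trans {D (+ n)} {cos ½π} {0ℝ} (cos-cong {angle (+ n)} {½π} angle-n) zero-½π

  D-nonzero : ∀ j → 0 ℕ.< j → j ℕ.< n → ¬ (D (+ j) ≃ 0ℝ)
  D-nonzero j 0<j j<n = least (angle (+ j)) (0<angle j 0<j) (angle<½π j j<n)

  2k/n≡4k/n*½ : ∀ k → + (2 ℕ.* k) / n ≡ ((+ 4 ℤ.* + k) / n) ℚ.* ½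
  2k/n≡4k/n*½ k = begin
    + (2 ℕ.* k) / n                                  ≡⟨ /≡*1/ (+ (2 ℕ.* k)) n ⟩
    (+ (2 ℕ.* k) / 1) ℚ.* (+ 1 / n)                  ≡⟨ cong (λ z → (z / 1) ℚ.* (+ 1 / n)) (ℤ.pos-* 2 k) ⟩
    ((+ 2 ℤ.* + k) / 1) ℚ.* (+ 1 / n)                ≡⟨ cong (ℚ._* (+ 1 / n)) (*-/1 (+ 2) (+ k)) ⟩
    (+ 2 / 1) ℚ.* (+ k / 1) ℚ.* (+ 1 / n)            ≡⟨ solve 2 (λ a b → con (+ 2 / 1) :* a :* b := con (+ 4 / 1) :* a :* b :* con ½) refl (+ k / 1) (+ 1 / n) ⟩
    (+ 4 / 1) ℚ.* (+ k / 1) ℚ.* (+ 1 / n) ℚ.* ½      ≡⟨ cong (λ z → z ℚ.* (+ 1 / n) ℚ.* ½) (*-/1 (+ 4) (+ k)) ⟨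
    ((+ 4 ℤ.* + k) / 1) ℚ.* (+ 1 / n) ℚ.* ½          ≡⟨ cong (ℚ._* ½) (/≡*1/ (+ 4 ℤ.* + k) n) ⟨
    ((+ 4 ℤ.* + k) / n) ℚ.* ½                        ∎
    where open ≡-Reasoning

  cos-2πk/n : ∀ k → cos (fromℚ (+ (2 ℕ.* k) / n) * π) ≃ D (+ 4 ℤ.* + k)
  cos-2πk/n k = cos-cong {fromℚ (+ (2 ℕ.* k) / n) * π} {angle (+ 4 ℤ.* + k)}
    (≃-pointwise {fromℚ (+ (2 ℕ.* k) / n) * π} {angle (+ 4 ℤ.* + k)} λ i →
      trans (cong (ℚ._* seq π i) (2k/n≡4k/n*½ k)) (ℚ.*-assoc ((+ 4 ℤ.* + k) / n) ½ (seq π i)))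

-- Evaluation of the pattern sum at the cosines

evalℝ-sum : ∀ {m t} (f : Vector (Expr.Expr ℚ m) t) {ρ g} → (∀ k → evalℝ (f k) ρ ≡ g k) →
  evalℝ (foldr Expr._⊕_ (Expr.Κ 0ℚ) f) ρ ≡ foldr _+_ 0ℝ g
evalℝ-sum {t = zero}  f eq = refl
evalℝ-sum {t = suc t} f eq = cong₂ _+_ (eq Fin.zero) (evalℝ-sum (f ∘ Fin.suc) (eq ∘ Fin.suc))

evalℝ-product : ∀ {m t} (f : Vector (Expr.Expr ℚ m) t) {ρ} →
  evalℝ (foldr Expr._⊗_ (Expr.Κ 1ℚ) f) ρ ≡ foldr _*_ 1ℝ (λ j → evalℝ (f j) ρ)
evalℝ-product {t = zero}  f = refl
evalℝ-product {t = suc t} f {ρ} = cong (evalℝ (f Fin.zero) ρ *_) (evalℝ-product (f ∘ Fin.suc))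

open ℚ-Algebra ℝ-commutativeRing fromℚ-homomorphism using (module CosineValues)

-- The expression evaluates to the abstract sum of products up to propositional equality: finite
-- folds respect pointwise equality without function extensionality, so `subst` transports the
-- result.
patternSum-cos : (π : ℝ) → IsPi π → (P : Pattern) → ∀ n .{{_ : NonTrivial n}} → B P ℕ.< n → (adm : Admissible P n) →
  evalℝ (T P n adm) (αs π n) ≃ fromℤ (+ n ℤ.* S 0ℤ P ℤ.- + (2 ℕ.^ H P))
patternSum-cos π isPi P n B<n adm = subst (_≃ fromℤ (+ n ℤ.* S 0ℤ P ℤ.- + (2 ℕ.^ H P)))
  (sym (evalℝ-sum (λ k → foldr Expr._⊗_ (Expr.Κ 1ℚ) (factor k)) {αs π n} (λ k → evalℝ-product (factor k))))
  (patternSum P B<n (admissible-r P n adm) (Vec.lookup (αs π n)) λ k →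
    subst (_≃ D (+ 4 ℤ.* + ⟦ k ⟧Ω)) (sym (Vec.lookup∘tabulate (α π n) k)) (cos-2πk/n ⟦ k ⟧Ω))
  where
  instance
    n≢0 : ℕ.NonZero n
    n≢0 = ℕ.nonTrivial⇒nonZero n
  factor : Ω n → Vector (Expr.Expr ℚ (ℕ.pred n)) (suc (t-1 P))
  factor k j = (Expr.Κ (+ 2 / 1) Expr.⊗ Expr.Ι (σ n (r P j) (admissible-r P n adm j) k)) Expr.⊛ h P j
  open Angles π isPi n
  open CosineValues (λ {x} {y} → noZeroDivisors {x} {y}) (fromℚ-≄0 2ℚ (ℚ.positive⁻¹ 2ℚ)) n D D-0 D-product D-n D-nonzero using (patternSum)

-- Used with s the constant coefficient, m = n and k = 2^H: slope and intercept come from the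
-- pattern alone.
affine : ∀ s m k → fromℤ (m ℤ.* s ℤ.- k) ≃ fromℤ s * fromℤ m + - fromℤ k
affine s m k = ≃-pointwise {fromℤ (m ℤ.* s ℤ.- k)} {fromℤ s * fromℤ m + - fromℤ k} λ _ → begin
  (m ℤ.* s ℤ.- k) / 1                          ≡⟨ +-/1 (m ℤ.* s) (ℤ.- k) ⟩
  (m ℤ.* s) / 1 ℚ.+ (ℤ.- k) / 1                ≡⟨ cong₂ ℚ._+_ (trans (*-/1 m s) (ℚ.*-comm (m / 1) (s / 1))) (neg-/1 k) ⟩
  (s / 1) ℚ.* (m / 1) ℚ.+ ℚ.- (k / 1)          ∎
  where open ≡-Reasoning

theorem4p1 : (π : ℝ) → IsPi π → (P : Pattern) →
    (∀ n .{{_ : NonTrivial n}} → B P ℕ.< n → (adm : Admissible P n) →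
    evalℝ (T P n adm) (αs π n) ≃ fromℤ (+ n ℤ.* S 0ℤ P ℤ.- + (2 ℕ.^ H P)))
    × (∃[ a ] ∃[ b ] (∀ n .{{_ : NonTrivial n}} → B P ℕ.< n → (adm : Admissible P n) →
    evalℝ (T P n adm) (αs π n) ≃ a * fromℤ (+ n) + b))
theorem4p1 π isPi P = patternSum-cos π isPi P , fromℤ (S 0ℤ P) , - fromℤ (+ (2 ℕ.^ H P)) , λ n B<n adm →
  ≃-trans {evalℝ (T P n adm) (αs π n)} {fromℤ (+ n ℤ.* S 0ℤ P ℤ.- + (2 ℕ.^ H P))} {fromℤ (S 0ℤ P) * fromℤ (+ n) + - fromℤ (+ (2 ℕ.^ H P))}
    (patternSum-cos π isPi P n B<n adm) (affine (S 0ℤ P) (+ n) (+ (2 ℕ.^ H P)))
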